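{- Let $\mathbb F$ be an algebraically closed field, $G$ a Cayley bigraph on a finite group $\mathcal G$, and $L$ a subgraph of $G$. Then the generic maximum excess of $(L,G,\mathcal G,\mathbb F,\rho(L))$ is zero; equivalently, there is a nonempty Zariski open set $U\subset\mathbb F^{\rho(L)\times\mathcal G}$ such that every $M\in U$ is $L$-surjective and ${\rm m.e.}(\mathcal K_M(L))=0$.
   Context: Cayley bigraph on $\mathcal G$ with generators $g_1,g_2$: $V_G=\mathcal G$, $E_G=\mathcal G\times\{1,2\}$, edge $(g,i)$ has tail $g$, head $g_ig$. For $x\in\mathcal G$ and a subgraph $L$, $Lx$ is the image of $L$ under $g\mapsto gx$, $(g,i)\mapsto(gx,i)$; for $P\in V_G\sqcup E_G$, $\mathcal G_L(P)=\{x\in\mathcal G:P\in Lx\}$. For $k\ge0$ and $M\in\mathbb F^{k\times\mathcal G}$ with columns $m^x$, $M$ is $L$-surjective if for every $P$ the columns $m^x$, $x\in\mathcal G_L(P)$, span $\mathbb F^k$; then $\mathcal K_M(L)$ is the sheaf on $G$ with $\mathcal K_M(L)(P)=\{a\in\mathbb F^{\mathcal G}:a_x=0\ \forall x\notin\mathcal G_L(P),\ \sum_xa_xm^x=0\}$ and restriction maps the inclusions. The generic maximum excess of $(L,G,\mathcal G,\mathbb F,k)$ (for $k\le\rho(L)$) is the largest integer $m$ such that the set of $L$-surjective $M\in\mathbb F^{k\times\mathcal G}$ with ${\rm m.e.}(\mathcal K_M(L))\ge m$ is Zariski dense in $\mathbb F^{k\times\mathcal G}$. Maximum excess of a sheaf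 $\mathcal F$: with $\mathcal F(V)=\bigoplus_v\mathcal F(v)$, $d_h,d_t$ sending $\mathcal F(e)$ into $\mathcal F(he)$, $\mathcal F(te)$ by the restriction maps, $\Gamma_{\rm ht}(U)=\bigoplus_e\{w\in\mathcal F(e):d_hw,d_tw\in U\}$ and ${\rm m.e.}(\mathcal F)=\max_{U\subset\mathcal F(V)}(\dim\Gamma_{\rm ht}(U)-\dim U)$. $\rho(L)=\sum_X\max(0,|E_X|-|V_X|)$ over connected components $X$ of $L$ as an undirected graph. -}

module Defs where

open import Level using (Level; _⊔_; 0ℓ; suc)
open import Algebra.Apartness.Bundles using (HeytingField)
open import Algebra.Bundles using (CommutativeRing; Semiring)
open import Algebra.Module.Bundles using (LeftModule)
open import Algebra.Module.Morphism.Structures using (module LeftModuleMorphisms)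
import Algebra.Module.Construct.TensorUnit as TensorUnit
import Algebra.Definitions.RawMonoid as RawMonoidDefs
import Algebra.Definitions.RawSemiring as RawSemiringDefs
import Algebra.Properties.Monoid.Sum as MonoidSum
import Algebra.Properties.CommutativeMonoid.Sum as CommutativeMonoidSum
import Algebra.Properties.Semiring.Sum as SemiringSum
open import Algebra.Structures using (IsGroup)
open import Data.Bool.Base using (Bool; T)
open import Data.Bool.Properties using (T?)
open import Data.Fin.Base as Fin using (Fin; toℕ; fromℕ)
open import Data.Fin.Properties using (*↔×; inj⇒≟)
open import Data.Integer.Base as ℤ using (ℤ; _⊖_)
open import Data.List.Base as List using (List; []; _∷_)
open import Data.List.Membership.Propositional using (_∈_)
open import Data.List.Membership.Propositional.Properties using (∈-map⁺; ∈-map⁻; ∈-filter⁺; ∈-filter⁻)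
open import Data.List.Relation.Unary.Any using (here; there)
open import Data.Nat.Base as ℕ using (ℕ; _∸_)
open import Data.Product.Base using (Σ; ∃; ∃-syntax; _×_; _,_; proj₁; proj₂)
open import Data.Product.Function.NonDependent.Propositional using (_×-↔_)
open import Data.Vec.Base as Vec using (Vec)
open import Data.Vec.Functional using (Vector)
open import Data.Vec.Membership.Propositional.Properties using (∈-tabulate⁺; ∈-toList⁺)
open import Function.Base using (_∘_; id)
open import Function.Bundles using (_↔_; _⇔_; module Inverse)
open import Function.Properties.Inverse using (↔-refl; ↔-sym; ↔-trans; ↔⇒↣)
open import Relation.Binary.Construct.Closure.Equivalence as Eq using (EqClosure)
open import Relation.Binary.Core using (Rel)
open import Relation.Binary.Definitions using (DecidableEquality)
open import Relation.Binary.PropositionalEquality using (_≡_; refl; sym; trans; cong; subst; isEquivalence)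
open import Relation.Nullary.Decidable using (yes; no; _×-dec_)
open import Relation.Nullary.Negation using (¬_; contradiction)
open import Relation.Unary using (Pred; _≬_; Satisfiable)

record Finite (A : Set) : Set where
  field
    size : ℕ
    enum : A ↔ Fin size

  at : Fin size → A
  at = Inverse.from enum

  _≟_ : DecidableEquality A
  _≟_ = inj⇒≟ (↔⇒↣ enum)

  elements : Vec A size
  elements = Vec.tabulate at

  elementList : List A
  elementList = Vec.toList elements

  ∈-elementList : ∀ x → x ∈ elementList
  ∈-elementList x =
    subst (_∈ elementList) (Inverse.strictlyInverseʳ enum x)
      (∈-toList⁺ (∈-tabulate⁺ at (Inverse.to enum x)))

record FiniteGroup : Set₁ where
  infixl 7 _∙_
  field
    Carrier : Set
    _∙_     : Carrier → Carrier → Carrier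
    ε       : Carrier
    _⁻¹     : Carrier → Carrier
    isGroup : IsGroup _≡_ _∙_ ε _⁻¹
    finite  : Finite Carrier

  open IsGroup isGroup public using (assoc)
  open Finite finite public using (size; at)

record Graph : Set₁ where
  field
    V E       : Set
    tl hd     : E → V
    V-finite  : Finite V
    E-finite  : Finite E

record Subgraph (G : Graph) : Set where
  open Graph G
  field
    inV   : V → Bool
    inE   : E → Bool
    tl-in : ∀ {e} → T (inE e) → T (inV (tl e))
    hd-in : ∀ {e} → T (inE e) → T (inV (hd e))

module _ {A : Set} (_≟_ : DecidableEquality A) where

  -- A choice of one representative in each class of the equivalence
  -- relation generated by R.
  record Representatives (R : Rel A 0ℓ) : Set where
    field
      rep      : A → A
      sound    : ∀ v → EqClosure R (rep v) v
      complete : ∀ {u v} → EqClosure R u v → rep u ≡ rep v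

  Listed : List (A × A) → Rel A 0ℓ
  Listed ps u v = (u , v) ∈ ps

  listedRepresentatives : ∀ ps → Representatives (Listed ps)
  listedRepresentatives [] = record
    { rep      = id
    ; sound    = λ v → Eq.reflexive _
    ; complete = Eq.fold isEquivalence (λ ())
    }
  listedRepresentatives ((a , b) ∷ ps) = record
    { rep      = rep′
    ; sound    = sound′
    ; complete = Eq.fold
        (record { refl = refl ; sym = sym ; trans = trans }) complete′
    }
    where
    open Representatives (listedRepresentatives ps)

    rep′ : A → A
    rep′ v with rep v ≟ rep b
    ... | yes _ = rep a
    ... | no  _ = rep v

    weaken : ∀ {u v} → EqClosure (Listed ps) u v →
             EqClosure (Listed ((a , b) ∷ ps)) u v
    weaken = Eq.map there

    sound′ : ∀ v → EqClosure (Listed ((a , b) ∷ ps)) (rep′ v) v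
    sound′ v with rep v ≟ rep b
    ... | no  _  = weaken (sound v)
    ... | yes eq =
      Eq.transitive _ (weaken (sound a))
        (Eq.transitive _ (Eq.return (here refl))
          (Eq.transitive _ (weaken (Eq.symmetric _ (sound b)))
            (weaken (subst (λ r → EqClosure (Listed ps) r v) eq (sound v)))))

    rep′-cong : ∀ {u v} → rep u ≡ rep v → rep′ u ≡ rep′ v
    rep′-cong {u} {v} eq with rep u ≟ rep b | rep v ≟ rep b
    ... | yes _ | yes _ = refl
    ... | yes p | no ¬q = contradiction (trans (sym eq) p) ¬q
    ... | no ¬p | yes q = contradiction (trans eq q) ¬p
    ... | no  _ | no  _ = eq

    rep′-a : rep′ a ≡ rep a
    rep′-a with rep a ≟ rep b
    ... | yes _ = refl
    ... | no  _ = refl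

    rep′-b : rep′ b ≡ rep a
    rep′-b with rep b ≟ rep b
    ... | yes _ = refl
    ... | no ¬p = contradiction refl ¬p

    complete′ : ∀ {u v} → Listed ((a , b) ∷ ps) u v → rep′ u ≡ rep′ v
    complete′ (here refl) = trans rep′-a (sym rep′-b)
    complete′ (there p)   = rep′-cong (complete (Eq.return p))

module _ {G : Graph} (L : Subgraph G) where
  open Graph G
  open Subgraph L
  private
    module V = Finite V-finite
    module E = Finite E-finite

  Adjacent : Rel V 0ℓ
  Adjacent u v = ∃[ e ] T (inE e) × tl e ≡ u × hd e ≡ v

  Connected : Rel V 0ℓ
  Connected = EqClosure Adjacent

  components : Representatives V._≟_ Adjacent
  components = record
    { rep      = rep
    ; sound    = λ v → Eq.map listed⇒adjacent (sound v)
    ; complete = complete ∘ Eq.map adjacent⇒listed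
    }
    where
    ends : E → V × V
    ends e = tl e , hd e

    edges : List (V × V)
    edges = List.map ends (List.filter (T? ∘ inE) E.elementList)

    open Representatives (listedRepresentatives V._≟_ edges)

    adjacent⇒listed : ∀ {u v} → Adjacent u v → Listed V._≟_ edges u v
    adjacent⇒listed (e , e∈L , refl , refl) =
      ∈-map⁺ ends (∈-filter⁺ (T? ∘ inE) (E.∈-elementList e) e∈L)

    listed⇒adjacent : ∀ {u v} → Listed V._≟_ edges u v → Adjacent u v
    listed⇒adjacent p with ∈-map⁻ ends p
    ... | e , q , refl = e , proj₂ (∈-filter⁻ (T? ∘ inE) {xs = E.elementList} q) , refl , refl

  open Representatives components

  verticesOf edgesOf : V → ℕ
  verticesOf r = Vec.count (λ v → T? (inV v) ×-dec (rep v V.≟ r)) V.elements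
  edgesOf    r = Vec.count (λ e → T? (inE e) ×-dec (rep (tl e) V.≟ r)) E.elements

  -- The components of L correspond to the r representing a vertex of L;
  -- every other r contributes 0 ∸ 0.
  ρ : ℕ
  ρ = Vec.sum (Vec.map (λ r → edgesOf r ∸ verticesOf r) V.elements)

-- g₁ and g₂ are arbitrary: they may coincide and need not generate 𝒢.
module _ (𝒢 : FiniteGroup) (g₁ g₂ : FiniteGroup.Carrier 𝒢) where
  open FiniteGroup 𝒢

  generator : Fin 2 → Carrier
  generator Fin.zero    = g₁
  generator (Fin.suc _) = g₂

  cayley : Graph
  cayley = record
    { V        = Carrier
    ; E        = Carrier × Fin 2
    ; tl       = λ (g , i) → g
    ; hd       = λ (g , i) → generator i ∙ g
    ; V-finite = finite
    ; E-finite = record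
        { enum = ↔-trans (Finite.enum finite ×-↔ ↔-refl) (↔-sym *↔×) }
    }

  module Translates (L : Subgraph cayley) where
    open Graph cayley using (V; E; tl; hd)
    open Subgraph L

    -- 𝒢V v x and 𝒢E e x say that the vertex v, respectively the edge e,
    -- lies in the translate Lx.
    𝒢V : V → Pred Carrier 0ℓ
    𝒢V v x = ∃[ g ] T (inV g) × g ∙ x ≡ v

    𝒢E : E → Pred Carrier 0ℓ
    𝒢E e x = ∃[ g ] ∃[ i ] T (inE (g , i)) × (g ∙ x , i) ≡ e

    𝒢E⊆tl : ∀ {e x} → 𝒢E e x → 𝒢V (tl e) x
    𝒢E⊆tl (g , i , p , refl) = g , tl-in p , refl

    𝒢E⊆hd : ∀ {e x} → 𝒢E e x → 𝒢V (hd e) x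
    𝒢E⊆hd (g , i , p , refl) = generator i ∙ g , hd-in p , assoc _ _ _

-- Under excluded middle, _#_ of a Heyting field coincides with _≉_.
module OverField {c ℓ₁ ℓ₂ : Level} (𝔽 : HeytingField c ℓ₁ ℓ₂) where
  open HeytingField 𝔽 using (Carrier; isCommutativeRing)

  commutativeRing : CommutativeRing c ℓ₁
  commutativeRing = record { isCommutativeRing = isCommutativeRing }

  open CommutativeRing commutativeRing hiding (Carrier; refl; sym; trans)
  private module F = CommutativeRing commutativeRing
  open RawSemiringDefs (Semiring.rawSemiring semiring) using (_^_)
  open RawMonoidDefs (Semiring.+-rawMonoid semiring) using (sum)

  AlgebraicallyClosed : Set (c ⊔ ℓ₁)
  AlgebraicallyClosed =
    ∀ n (a : Vector Carrier (2 ℕ.+ n)) → a (fromℕ (ℕ.suc n)) ≉ 0# →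
    ∃[ x ] sum (λ i → a i * x ^ toℕ i) ≈ 0#

  VectorSpace : ∀ m ℓm → Set (c ⊔ ℓ₁ ⊔ suc (m ⊔ ℓm))
  VectorSpace = LeftModule ring

  record Subspace {m ℓm} (W : VectorSpace m ℓm) s : Set (c ⊔ m ⊔ ℓm ⊔ suc s) where
    open LeftModule W
    field
      Mem       : Pred Carrierᴹ s
      resp      : ∀ {x y} → x ≈ᴹ y → Mem x → Mem y
      0-closed  : Mem 0ᴹ
      +-closed  : ∀ {x y} → Mem x → Mem y → Mem (x +ᴹ y)
      *ₗ-closed : ∀ a {x} → Mem x → Mem (a *ₗ x)

    neg-closed : ∀ {x} → Mem x → Mem (-ᴹ x)
    neg-closed {x} p = resp (≈ᴹ-sym eq) (*ₗ-closed (- 1#) p)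
      where
      open import Algebra.Properties.AbelianGroup +ᴹ-abelianGroup using (inverseˡ-unique)
      eq : -ᴹ x ≈ᴹ (- 1#) *ₗ x
      eq = ≈ᴹ-sym (inverseˡ-unique _ _
        (≈ᴹ-trans (+ᴹ-congˡ (≈ᴹ-sym (*ₗ-identityˡ x)))
        (≈ᴹ-trans (≈ᴹ-sym (*ₗ-distribʳ x (- 1#) 1#))
        (≈ᴹ-trans (*ₗ-cong (-‿inverseˡ 1#) ≈ᴹ-refl) (*ₗ-zeroˡ x)))))

    asVectorSpace : VectorSpace (m ⊔ s) ℓm
    asVectorSpace = record
      { Carrierᴹ     = ∃ Mem
      ; _≈ᴹ_         = λ (x , _) (y , _) → x ≈ᴹ y
      ; _+ᴹ_         = λ (x , p) (y , q) → x +ᴹ y , +-closed p q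
      ; _*ₗ_         = λ a (x , p) → a *ₗ x , *ₗ-closed a p
      ; 0ᴹ           = 0ᴹ , 0-closed
      ; -ᴹ_          = λ (x , p) → -ᴹ x , neg-closed p
      ; isLeftModule = record
        { isLeftSemimodule = record
          { +ᴹ-isCommutativeMonoid = record
            { isMonoid = record
              { isSemigroup = record
                { isMagma = record
                  { isEquivalence = record
                    { refl = ≈ᴹ-refl ; sym = ≈ᴹ-sym ; trans = ≈ᴹ-trans }
                  ; ∙-cong = +ᴹ-cong
                  }
                ; assoc = λ _ _ _ → +ᴹ-assoc _ _ _
                }
              ; identity = (λ _ → +ᴹ-identityˡ _) , (λ _ → +ᴹ-identityʳ _)
              }
            ; comm = λ _ _ → +ᴹ-comm _ _
            }
          ; isPreleftSemimodule = record
            { *ₗ-cong      = *ₗ-cong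
            ; *ₗ-zeroˡ     = λ _ → *ₗ-zeroˡ _
            ; *ₗ-distribʳ  = λ _ _ _ → *ₗ-distribʳ _ _ _
            ; *ₗ-identityˡ = λ _ → *ₗ-identityˡ _
            ; *ₗ-assoc     = λ _ _ _ → *ₗ-assoc _ _ _
            ; *ₗ-zeroʳ     = λ _ → *ₗ-zeroʳ _
            ; *ₗ-distribˡ  = λ _ _ _ → *ₗ-distribˡ _ _ _
            }
          }
        ; -ᴹ‿cong    = -ᴹ‿cong
        ; -ᴹ‿inverse = (λ _ → -ᴹ‿inverseˡ _) , (λ _ → -ᴹ‿inverseʳ _)
        }
      }

  -- For finite A this is the direct sum of the W a.
  ∏ : ∀ {m ℓm} (A : Set) → (A → VectorSpace m ℓm) → VectorSpace m ℓm
  ∏ A W = record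
    { Carrierᴹ     = ∀ a → Carrierᴹ (W a)
    ; _≈ᴹ_         = λ x y → ∀ a → _≈ᴹ_ (W a) (x a) (y a)
    ; _+ᴹ_         = λ x y a → _+ᴹ_ (W a) (x a) (y a)
    ; _*ₗ_         = λ s x a → _*ₗ_ (W a) s (x a)
    ; 0ᴹ           = λ a → 0ᴹ (W a)
    ; -ᴹ_          = λ x a → -ᴹ_ (W a) (x a)
    ; isLeftModule = record
      { isLeftSemimodule = record
        { +ᴹ-isCommutativeMonoid = record
          { isMonoid = record
            { isSemigroup = record
              { isMagma = record
                { isEquivalence = record
                  { refl  = λ a → ≈ᴹ-refl (W a)
                  ; sym   = λ p a → ≈ᴹ-sym (W a) (p a)
                  ; trans = λ p q a → ≈ᴹ-trans (W a) (p a) (q a)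
                  }
                ; ∙-cong = λ p q a → +ᴹ-cong (W a) (p a) (q a)
                }
              ; assoc = λ _ _ _ a → +ᴹ-assoc (W a) _ _ _
              }
            ; identity = (λ _ a → +ᴹ-identityˡ (W a) _) , (λ _ a → +ᴹ-identityʳ (W a) _)
            }
          ; comm = λ _ _ a → +ᴹ-comm (W a) _ _
          }
        ; isPreleftSemimodule = record
          { *ₗ-cong      = λ p q a → *ₗ-cong (W a) p (q a)
          ; *ₗ-zeroˡ     = λ _ a → *ₗ-zeroˡ (W a) _
          ; *ₗ-distribʳ  = λ _ _ _ a → *ₗ-distribʳ (W a) _ _ _
          ; *ₗ-identityˡ = λ _ a → *ₗ-identityˡ (W a) _
          ; *ₗ-assoc     = λ _ _ _ a → *ₗ-assoc (W a) _ _ _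
          ; *ₗ-zeroʳ     = λ _ a → *ₗ-zeroʳ (W a) _
          ; *ₗ-distribˡ  = λ _ _ _ a → *ₗ-distribˡ (W a) _ _ _
          }
        }
      ; -ᴹ‿cong    = λ p a → -ᴹ‿cong (W a) (p a)
      ; -ᴹ‿inverse = (λ _ a → -ᴹ‿inverseˡ (W a) _) , (λ _ a → -ᴹ‿inverseʳ (W a) _)
      }
    }
    where open LeftModule

  module _ {m ℓm} (W : VectorSpace m ℓm) where
    open LeftModule W

    combination : ∀ {d} → Vector Carrier d → Vector Carrierᴹ d → Carrierᴹ
    combination a b = RawMonoidDefs.sum +ᴹ-rawMonoid (λ i → a i *ₗ b i)

    record IsBasis {s} (S : Subspace W s) {d} (b : Vector Carrierᴹ d) : Set (c ⊔ ℓ₁ ⊔ m ⊔ ℓm ⊔ s) where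
      open Subspace S
      field
        members     : ∀ i → Mem (b i)
        independent : ∀ a → combination a b ≈ᴹ 0ᴹ → ∀ i → a i ≈ 0#
        spanning    : ∀ {x} → Mem x → ∃[ a ] x ≈ᴹ combination a b

    HasDim : ∀ {s} → Subspace W s → ℕ → Set (c ⊔ ℓ₁ ⊔ m ⊔ ℓm ⊔ s)
    HasDim S d = ∃[ b ] IsBasis S {d} b

  record LinearMap {m n ℓm ℓn} (W : VectorSpace m ℓm) (W′ : VectorSpace n ℓn) : Set (c ⊔ m ⊔ n ⊔ ℓm ⊔ ℓn) where
    private
      module W  = LeftModule W
      module W′ = LeftModule W′
    field
      map            : W.Carrierᴹ → W′.Carrierᴹ
      isHomomorphism : LeftModuleMorphisms.IsLeftModuleHomomorphism W.rawLeftModule W′.rawLeftModule map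

    open LeftModuleMorphisms.IsLeftModuleHomomorphism isHomomorphism public
      using (⟦⟧-cong; +ᴹ-homo; 0ᴹ-homo; *ₗ-homo)

  record Sheaf (G : Graph) m ℓm : Set (c ⊔ ℓ₁ ⊔ suc (m ⊔ ℓm)) where
    open Graph G
    field
      atV  : V → VectorSpace m ℓm
      atE  : E → VectorSpace m ℓm
      resₜ : ∀ e → LinearMap (atE e) (atV (tl e))
      resₕ : ∀ e → LinearMap (atE e) (atV (hd e))

  module _ {G : Graph} {m ℓm} (𝓕 : Sheaf G m ℓm) where
    open Graph G
    open Sheaf 𝓕
    private
      module At v = LeftModule (atV v)
      module At′ e = LeftModule (atE e)
      open Finite V-finite using (_≟_)

    𝓕V 𝓕E : VectorSpace m ℓm
    𝓕V = ∏ V atV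
    𝓕E = ∏ E atE

    private
      module 𝓕V = LeftModule 𝓕V

    summand : ∀ v → At.Carrierᴹ v → 𝓕V.Carrierᴹ
    summand v x u with v ≟ u
    ... | yes refl = x
    ... | no  _    = At.0ᴹ u

    dₜ dₕ : ∀ e → At′.Carrierᴹ e → 𝓕V.Carrierᴹ
    dₜ e w = summand (tl e) (LinearMap.map (resₜ e) w)
    dₕ e w = summand (hd e) (LinearMap.map (resₕ e) w)

    summand-cong : ∀ v {x y} → At._≈ᴹ_ v x y → summand v x 𝓕V.≈ᴹ summand v y
    summand-cong v eq u with v ≟ u
    ... | yes refl = eq
    ... | no  _    = At.≈ᴹ-refl u

    summand-0 : ∀ v → summand v (At.0ᴹ v) 𝓕V.≈ᴹ 𝓕V.0ᴹ
    summand-0 v u with v ≟ u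
    ... | yes refl = At.≈ᴹ-refl u
    ... | no  _    = At.≈ᴹ-refl u

    summand-+ : ∀ v x y → summand v (At._+ᴹ_ v x y) 𝓕V.≈ᴹ summand v x 𝓕V.+ᴹ summand v y
    summand-+ v x y u with v ≟ u
    ... | yes refl = At.≈ᴹ-refl u
    ... | no  _    = At.≈ᴹ-sym u (At.+ᴹ-identityˡ u _)

    summand-* : ∀ v a x → summand v (At._*ₗ_ v a x) 𝓕V.≈ᴹ a 𝓕V.*ₗ summand v x
    summand-* v a x u with v ≟ u
    ... | yes refl = At.≈ᴹ-refl u
    ... | no  _    = At.≈ᴹ-sym u (At.*ₗ-zeroʳ u a)

    module Pull {s} (U : Subspace 𝓕V s) (e : E) (v : V) (r : LinearMap (atE e) (atV v)) where
      open Subspace U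
      open LinearMap r

      d : At′.Carrierᴹ e → 𝓕V.Carrierᴹ
      d w = summand v (map w)

      pull-resp : ∀ {x y} → At′._≈ᴹ_ e x y → Mem (d x) → Mem (d y)
      pull-resp eq = resp (summand-cong v (⟦⟧-cong eq))

      pull-0 : Mem (d (At′.0ᴹ e))
      pull-0 = resp (𝓕V.≈ᴹ-sym (𝓕V.≈ᴹ-trans (summand-cong v 0ᴹ-homo) (summand-0 v))) 0-closed

      pull-+ : ∀ {x y} → Mem (d x) → Mem (d y) → Mem (d (At′._+ᴹ_ e x y))
      pull-+ p q =
        resp (𝓕V.≈ᴹ-sym (𝓕V.≈ᴹ-trans (summand-cong v (+ᴹ-homo _ _)) (summand-+ v _ _))) (+-closed p q)

      pull-* : ∀ a {x} → Mem (d x) → Mem (d (At′._*ₗ_ e a x))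
      pull-* a p =
        resp (𝓕V.≈ᴹ-sym (𝓕V.≈ᴹ-trans (summand-cong v (*ₗ-homo _ _)) (summand-* v a _))) (*ₗ-closed a p)

    Γht : ∀ {s} → Subspace 𝓕V s → Subspace 𝓕E s
    Γht U = record
      { Mem       = λ w → ∀ e → Mem (dₕ e (w e)) × Mem (dₜ e (w e))
      ; resp      = λ eq p e → H.pull-resp e (eq e) (proj₁ (p e)) , T′.pull-resp e (eq e) (proj₂ (p e))
      ; 0-closed  = λ e → H.pull-0 e , T′.pull-0 e
      ; +-closed  = λ p q e → H.pull-+ e (proj₁ (p e)) (proj₁ (q e)) , T′.pull-+ e (proj₂ (p e)) (proj₂ (q e))
      ; *ₗ-closed = λ a p e → H.pull-* e a (proj₁ (p e)) , T′.pull-* e a (proj₂ (p e))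
      }
      where
      open Subspace U using (Mem)
      module H e  = Pull U e (hd e) (resₕ e)
      module T′ e = Pull U e (tl e) (resₜ e)

    IsExcess : ∀ {s} → Subspace 𝓕V s → ℤ → Set (c ⊔ ℓ₁ ⊔ m ⊔ ℓm ⊔ s)
    IsExcess U z = ∃[ d ] ∃[ d′ ] HasDim 𝓕E (Γht U) d × HasDim 𝓕V U d′ × z ≡ d ⊖ d′

    -- Presupposes finite-dimensional stalks: a subspace U without a finite
    -- basis has no excess here.
    record IsMaxExcess (z : ℤ) : Set (suc (c ⊔ ℓ₁ ⊔ m ⊔ ℓm)) where
      field
        attained : ∃[ U ] IsExcess {c ⊔ ℓ₁ ⊔ m ⊔ ℓm} U z
        maximal  : ∀ (U : Subspace 𝓕V (c ⊔ ℓ₁ ⊔ m ⊔ ℓm)) {y} → IsExcess U y → y ℤ.≤ z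

  data Poly (I : Set) : Set c where
    con     : Carrier → Poly I
    var     : I → Poly I
    _⊕_ _⊗_ : Poly I → Poly I → Poly I

  module _ {I : Set} where

    ⟦_⟧ : Poly I → (I → Carrier) → Carrier
    ⟦ con a ⟧ x = a
    ⟦ var i ⟧ x = x i
    ⟦ p ⊕ q ⟧ x = ⟦ p ⟧ x + ⟦ q ⟧ x
    ⟦ p ⊗ q ⟧ x = ⟦ p ⟧ x * ⟦ q ⟧ x

    -- S may be infinite; U is the complement of its common zero locus.
    ZariskiOpen : ∀ {s} → Pred (I → Carrier) s → Set (suc (c ⊔ ℓ₁) ⊔ s)
    ZariskiOpen U =
      Σ (Pred (Poly I) (c ⊔ ℓ₁)) λ S →
      ∀ x → U x ⇔ (∃[ p ] S p × ⟦ p ⟧ x ≉ 0#)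

    ZariskiDense : ∀ {s} → Pred (I → Carrier) s → Set (suc (c ⊔ ℓ₁) ⊔ s)
    ZariskiDense X =
      ∀ (U : Pred (I → Carrier) (c ⊔ ℓ₁)) → ZariskiOpen U → Satisfiable U → U ≬ X

  module Kernels (𝒢 : FiniteGroup) (g₁ g₂ : FiniteGroup.Carrier 𝒢)
                 (L : Subgraph (cayley 𝒢 g₁ g₂)) (k : ℕ) where
    private module 𝒢 = FiniteGroup 𝒢
    open Graph (cayley 𝒢 g₁ g₂) using (V; E; tl; hd)
    open Translates 𝒢 g₁ g₂ L

    Matrix : Set c
    Matrix = Fin k × 𝒢.Carrier → Carrier

    𝔽^𝒢 : VectorSpace c ℓ₁
    𝔽^𝒢 = ∏ 𝒢.Carrier (λ _ → TensorUnit.leftModule)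

    -- (M · a) is ∑ₓ aₓ mˣ.
    _·_ : Matrix → (𝒢.Carrier → Carrier) → Vector Carrier k
    (M · a) j = sum (λ i → a (𝒢.at i) * M (j , 𝒢.at i))

    SupportedOn : Pred 𝒢.Carrier 0ℓ → (𝒢.Carrier → Carrier) → Set ℓ₁
    SupportedOn X a = ∀ x → ¬ X x → a x ≈ 0#

    ColumnsSpan : Matrix → Pred 𝒢.Carrier 0ℓ → Set (c ⊔ ℓ₁)
    ColumnsSpan M X = ∀ (b : Vector Carrier k) → ∃[ a ] SupportedOn X a × (∀ j → (M · a) j ≈ b j)

    LSurjective : Pred Matrix (c ⊔ ℓ₁)
    LSurjective M = (∀ v → ColumnsSpan M (𝒢V v)) × (∀ e → ColumnsSpan M (𝒢E e))

    open MonoidSum +-monoid using (sum-cong-≋; sum-replicate-zero)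
    open CommutativeMonoidSum +-commutativeMonoid using (∑-distrib-+)
    open SemiringSum semiring using (*-distribˡ-sum)

    kernel : Matrix → Pred 𝒢.Carrier 0ℓ → Subspace 𝔽^𝒢 ℓ₁
    kernel M X = record
      { Mem       = λ a → SupportedOn X a × (∀ j → (M · a) j ≈ 0#)
      ; resp      = λ eq (p , q) →
          (λ x x∉ → F.trans (F.sym (eq x)) (p x x∉)) ,
          (λ j → F.trans (sum-cong-≋ {n = 𝒢.size} λ i → *-congʳ (F.sym (eq (𝒢.at i)))) (q j))
      ; 0-closed  =
          (λ _ _ → F.refl) ,
          (λ j → F.trans (sum-cong-≋ {n = 𝒢.size} λ i → zeroˡ _) (sum-replicate-zero 𝒢.size))
      ; +-closed  = λ (p , q) (p′ , q′) →
          (λ x x∉ → F.trans (+-cong (p x x∉) (p′ x x∉)) (+-identityˡ 0#)) ,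
          (λ j → F.trans (sum-cong-≋ {n = 𝒢.size} λ i → distribʳ _ _ _)
                (F.trans (∑-distrib-+ {n = 𝒢.size} _ _)
                (F.trans (+-cong (q j) (q′ j)) (+-identityˡ 0#))))
      ; *ₗ-closed = λ s (p , q) →
          (λ x x∉ → F.trans (*-congˡ (p x x∉)) (zeroʳ s)) ,
          (λ j → F.trans (sum-cong-≋ {n = 𝒢.size} λ i → *-assoc _ _ _)
                (F.trans (F.sym (*-distribˡ-sum {n = 𝒢.size} s _))
                (F.trans (*-congˡ (q j)) (zeroʳ s))))
      }

    kernelInclusion : ∀ M {X Y} → (∀ {x} → X x → Y x) →
      LinearMap (Subspace.asVectorSpace (kernel M X)) (Subspace.asVectorSpace (kernel M Y))
    kernelInclusion M X⊆Y = record
      { map            = λ (a , p , q) → a , (λ x x∉Y → p x (x∉Y ∘ X⊆Y)) , q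
      ; isHomomorphism = record
        { +ᴹ-isGroupHomomorphism = record
          { isMonoidHomomorphism = record
            { isMagmaHomomorphism = record
              { isRelHomomorphism = record { cong = id }
              ; homo              = λ _ _ _ → F.refl
              }
            ; ε-homo = λ _ → F.refl
            }
          ; ⁻¹-homo = λ _ _ → F.refl
          }
        ; *ₗ-homo = λ _ _ _ → F.refl
        }
      }

    𝒦 : Matrix → Sheaf (cayley 𝒢 g₁ g₂) (c ⊔ ℓ₁) ℓ₁
    𝒦 M = record
      { atV  = λ v → Subspace.asVectorSpace (kernel M (𝒢V v))
      ; atE  = λ e → Subspace.asVectorSpace (kernel M (𝒢E e))
      ; resₜ = λ e → kernelInclusion M 𝒢E⊆tl
      ; resₕ = λ e → kernelInclusion M 𝒢E⊆hd
      }

    ExcessAtLeast : ℤ → Pred Matrix (suc (c ⊔ ℓ₁))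
    ExcessAtLeast m M = LSurjective M × (∃[ z ] IsMaxExcess (𝒦 M) z × m ℤ.≤ z)

    record IsGenericMaxExcess (m : ℤ) : Set (suc (c ⊔ ℓ₁)) where
      field
        dense   : ZariskiDense (ExcessAtLeast m)
        largest : ∀ m′ → ZariskiDense (ExcessAtLeast m′) → m′ ℤ.≤ m

{-# OPTIONS --safe #-}

-- Let F be the free group on X₀ and X₁. Sending Xᵢ to 1 + Xᵢ in ℤ⟨⟨X₀ , X₁⟩⟩ / (X₀² , X₁²) and truncating at a large
-- degree gives a nilpotent quotient A of F with a bi-invariant order in which both generators are positive and no
-- short reduced word is trivial. Let Q be the set of vertices of L from which two walks, one starting with each
-- outgoing edge, stay above their starting point in this order.
--
-- |Q| ≤ ρ(L): delete from L one outgoing edge at each u ∈ Q. If a component left behind were a tree, heights in A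
-- would be well defined on it; starting from the highest deleted edge touching it, the walk given by Q can never leave
-- the tree, since it would do so along a higher deleted edge, so it closes up along a short reduced word: contradiction.
--
-- m.e. ≤ 0: suppose dim Γₕₜ(U) > dim U and any ρ(L) distinct columns of M are independent. As A is amenable,
-- there is a nonzero finitely supported element of Γₕₜ(U) ⊗ 𝔽[A] killed by the boundary twisted by A. Consider its
-- component of least height. At the vertex v its x-coordinate can be nonzero only if v x⁻¹ ∈ Q: non-backtracking walks
-- in the support never descend below the minimum. So it is a linear relation between at most |Q| ≤ ρ(L) columns of M,
-- hence zero: contradiction.
--
-- Independence of any ρ(L) columns is a nonempty Zariski open condition, as a Vandermonde matrix shows.
module Submission where

open import Algebra.Apartness.Bundles using (HeytingField)
open import Algebra.Bundles using (CommutativeRing; CommutativeSemiring; Group; Semiring)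
import Algebra.Definitions.RawMonoid as RawMonoidDefinitions
import Algebra.Definitions.RawSemiring as RawSemiring
open import Algebra.Module.Bundles using (LeftModule)
import Algebra.Properties.CommutativeMonoid.Sum as CommutativeMonoidSum
import Algebra.Properties.Group as GroupProperties
import Algebra.Properties.Monoid.Sum as MonoidSum
import Algebra.Properties.Ring as RingProperties
import Algebra.Properties.Semiring.Sum as SemiringSum
import Algebra.Solver.Ring.NaturalCoefficients.Default as SemiringSolver
open import Axiom.ExcludedMiddle using (ExcludedMiddle)
open import Data.Bool.Base using (Bool; true; false; not; T)
open import Data.Bool.Properties using (not-involutive; T?)
open import Data.Empty using (⊥)
open import Data.Fin.Base as Fin using (Fin; zero; suc; punchIn; combine; _↑ˡ_; _↑ʳ_; toℕ; fromℕ<; remQuot; fromℕ; inject≤)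
open import Data.Fin.Properties using (punchIn-punchOut; toℕ<n; toℕ-injective; toℕ-fromℕ<; remQuot-combine; combine-remQuot; injective⇒≤; pigeonhole; any?; combine-injective; suc-injective; inject≤-injective) renaming (_≟_ to _≟ᶠ_)
open import Data.Integer.Base as ℤ using (ℤ; 0ℤ; 1ℤ; -1ℤ; +_; _⊖_)
import Data.Integer.Properties as ℤ
open import Data.Integer.Solver using (module +-*-Solver)
open import Data.List.Base as List using (List; []; _∷_; _++_; length; filter; lookup; take; drop; allFin)
open import Data.List.Membership.Propositional using (_∈_; _∉_)
open import Data.List.Membership.Propositional.Properties using (∈-filter⁺; ∈-filter⁻; ∈-lookup; ∈-map⁺; ∈-map⁻; ∈-cartesianProduct⁺; ∈-allFin)
open import Data.List.Properties using (filter-all; filter-reject; filter-some; filter-none; length-map; length-take; length-drop; take++drop≡id; take-take; ++-assoc; length-++)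
open import Data.List.Relation.Unary.All as All using (All; []; _∷_)
open import Data.List.Relation.Unary.Any as Any using (Any; here; there; index)
open import Data.List.Relation.Unary.Any.Properties using (lookup-index)
open import Data.List.Relation.Unary.Linked as Linked using (Linked; []; [-]; _∷_)
open import Data.List.Relation.Unary.Unique.Propositional using (Unique; []; _∷_)
import Data.List.Relation.Unary.Unique.Propositional.Properties as Unique
open import Data.Nat.Base as ℕ using (ℕ; zero; suc; s≤s; z≤n; _∸_)
import Data.Nat.Properties as ℕ
open import Data.Nat.Solver using () renaming (module +-*-Solver to ℕSolver)
open import Data.Product.Base using (Σ; ∃; ∃-syntax; _×_; _,_; proj₁; proj₂; ∃₂)
open import Data.Product.Properties using (,-injectiveˡ)
open import Data.Sum.Base using (_⊎_; inj₁; inj₂)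
open import Data.Unit.Base using (⊤)
open import Data.Vec.Base as Vec using (Vec; []; _∷_)
open import Data.Vec.Functional using (Vector)
open import Data.Vec.Properties using (lookup∘tabulate)
open import Defs
open import Function.Base using (_∘_; _$_; id)
open import Function.Bundles using (module Inverse; module Equivalence; mk⇔)
open import Level using (Level; _⊔_; Lift; lift; lower; 0ℓ)
import Relation.Binary.Construct.Closure.Equivalence as Eq
open import Relation.Binary.Construct.Closure.ReflexiveTransitive using (ε; _◅_)
open import Relation.Binary.Construct.Closure.Symmetric using (fwd; bwd)
open import Relation.Binary.Definitions using (tri<; tri≈; tri>; DecidableEquality)
open import Relation.Binary.PropositionalEquality as ≡ using (_≡_; _≢_)
open import Relation.Nullary.Decidable using (Dec; yes; no; map′; does; ¬?; _×-dec_)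
open import Relation.Nullary.Negation using (¬_; contradiction)
open import Relation.Unary using (Pred; Decidable; _⊆_; Satisfiable)

-- Two demands on the group of heights pull in opposite directions. Excluding tree components, and
-- seeing that a walk has really left its starting height, need a group without short relations,
-- such as the free group. Comparing dimensions by counting needs finite sets with small boundary,
-- which the free group does not have. A nilpotent quotient meets both demands because all words in
-- play have at most 1 + |𝒢| letters: after |𝒢| steps a walk has repeated a vertex, so relations
-- longer than that do no harm. Bi-invariance of the order matters because it makes staying above
-- the start a property of the word alone. The minimum of a finitely supported flow sits at one
-- particular height, whereas the set Q is defined without reference to any height. Both outgoing
-- edges enter the definition of Q since nothing flows into the lowest height, so the two outgoing
-- values there cancel and are nonzero together. The second walk is what the tree argument falls
-- back on when the other outgoing edge has been deleted.

-- Linear algebra over a field in which being zero is decided.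

module Identities {a b} (R : CommutativeSemiring a b) where

  open CommutativeSemiring R
  open SemiringSolver R using (solve; _:=_; _:+_; _:*_)

  -- Here and below `m` stands for -1: written with a variable in its place, the identities hold in
  -- every commutative semiring, without subtraction.
  pivot-identity : ∀ k m y t → k * (m * (y * t)) + t ≈ t + m * (y * k * t)
  pivot-identity = solve 4 (λ k m y t → k :* (m :* (y :* t)) :+ t := t :+ m :* (y :* k :* t)) refl

  row-identity : ∀ k m y t s → k * (m * (y * t)) + s ≈ s + m * (k * y) * t
  row-identity = solve 5 (λ k m y t s → k :* (m :* (y :* t)) :+ s := s :+ m :* (k :* y) :* t) refl

  cramer-identity : ∀ m y b x s → y * x * b + m * (y * x * b) + m * y * s ≈ y * x * b + m * y * (b * x + s)
  cramer-identity = solve 5 (λ m y b x s →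
    y :* x :* b :+ m :* (y :* x :* b) :+ m :* y :* s := y :* x :* b :+ m :* y :* (b :* x :+ s)) refl

record DiscreteField c ℓ : Set (Level.suc (c ⊔ ℓ)) where
  field
    commutativeRing : CommutativeRing c ℓ

  open CommutativeRing commutativeRing

  field
    1≉0                : 1# ≉ 0#
    zero-or-invertible : ∀ x → x ≈ 0# ⊎ (x ≉ 0# × ∃[ y ] y * x ≈ 1#)

module FieldProperties {c ℓ₁ ℓ₂ : Level} (em : ExcludedMiddle (c ⊔ ℓ₁ ⊔ ℓ₂)) (𝔽 : HeytingField c ℓ₁ ℓ₂) where

  open OverField 𝔽 using (commutativeRing)
  open CommutativeRing commutativeRing
  open HeytingField 𝔽 using (_#_; #⇒invertible; invertible⇒#; #-irrefl; tight)
  open RingProperties ring using (-0#≈0#)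

  1≉0 : 1# ≉ 0#
  -- If 1 ≈ 0, all elements coincide, so 0 - 0 is invertible and 0 would be apart from itself.
  1≉0 1≈0 = #-irrefl refl (invertible⇒# {0#} {0#} (0# , absorb _ , absorb _))
    where
    absorb : ∀ x → x ≈ 1#
    absorb x = trans (trans (sym (*-identityʳ x)) (*-congˡ 1≈0)) (trans (zeroʳ x) (sym 1≈0))

  zero-or-invertible : ∀ x → x ≈ 0# ⊎ (x ≉ 0# × ∃[ y ] y * x ≈ 1#)
  zero-or-invertible x with map′ lower lift (em {Lift (c ⊔ ℓ₁ ⊔ ℓ₂) (x # 0#)})
  ... | no ¬x#0 = inj₁ (proj₁ (tight x 0#) ¬x#0)
  ... | yes x#0 with y , y* , _ ← #⇒invertible x#0 =
    inj₂ ((λ x≈0 → #-irrefl x≈0 x#0) , y , trans (*-congˡ (sym x-0)) y*)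
    where
    x-0 : x - 0# ≈ x
    x-0 = trans (+-congˡ -0#≈0#) (+-identityʳ x)

  discreteField : DiscreteField c ℓ₁
  discreteField = record { commutativeRing = commutativeRing ; 1≉0 = 1≉0 ; zero-or-invertible = zero-or-invertible }

module LinearAlgebra {c ℓ : Level} (𝔽 : DiscreteField c ℓ) where

  open DiscreteField 𝔽
  open CommutativeRing commutativeRing hiding (zero) renaming (Carrier to F)
  open MonoidSum +-monoid using (sum; sum-cong-≋; sum-replicate-zero)
  open CommutativeMonoidSum +-commutativeMonoid using (∑-distrib-+)
  open SemiringSum semiring using (*-distribˡ-sum)
  open Identities commutativeSemiring
  open import Relation.Binary.Reasoning.Setoid setoid

  -1# : F
  -1# = - 1#

  x+-1*x : ∀ x → x + -1# * x ≈ 0#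
  x+-1*x x = begin
    x + -1# * x      ≈⟨ +-congʳ (*-identityˡ x) ⟨
    1# * x + -1# * x ≈⟨ distribʳ x 1# -1# ⟨
    (1# + -1#) * x   ≈⟨ *-congʳ (-‿inverseʳ 1#) ⟩
    0# * x           ≈⟨ zeroˡ x ⟩
    0#               ∎

  *-nonzero : ∀ {x y} → x ≉ 0# → y ≉ 0# → x * y ≉ 0#
  *-nonzero {x} {y} x≉0 y≉0 xy≈0 with zero-or-invertible x
  ... | inj₁ x≈0 = x≉0 x≈0
  ... | inj₂ (_ , z , zx≈1) = y≉0 (begin
    y           ≈⟨ *-identityˡ y ⟨
    1# * y      ≈⟨ *-congʳ zx≈1 ⟨
    z * x * y   ≈⟨ *-assoc z x y ⟩
    z * (x * y) ≈⟨ *-congˡ xy≈0 ⟩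
    z * 0#      ≈⟨ zeroʳ z ⟩
    0#          ∎)

  *-nonzero⁻ˡ : ∀ {x y} → x * y ≉ 0# → x ≉ 0#
  *-nonzero⁻ˡ {x} {y} xy≉0 x≈0 = xy≉0 (trans (*-congʳ x≈0) (zeroˡ y))

  *-nonzero⁻ʳ : ∀ {x y} → x * y ≉ 0# → y ≉ 0#
  *-nonzero⁻ʳ {x} {y} xy≉0 y≈0 = xy≉0 (trans (*-congˡ y≈0) (zeroʳ x))

  *-cancel-nonzero : ∀ {x y} → x ≉ 0# → x * y ≈ 0# → y ≈ 0#
  *-cancel-nonzero {x} {y} x≉0 xy≈0 with zero-or-invertible y
  ... | inj₁ y≈0       = y≈0
  ... | inj₂ (y≉0 , _) = contradiction xy≈0 (*-nonzero x≉0 y≉0)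

  all-zero-or-invertible : ∀ {n} (f : Vector F n) →
    (∀ i → f i ≈ 0#) ⊎ (∃[ i ] f i ≉ 0# × ∃[ y ] y * f i ≈ 1#)
  all-zero-or-invertible {zero}  f = inj₁ λ ()
  all-zero-or-invertible {suc n} f with zero-or-invertible (f zero) | all-zero-or-invertible (f ∘ suc)
  ... | inj₂ inv | _              = inj₂ (zero , inv)
  ... | inj₁ _   | inj₂ (i , inv) = inj₂ (suc i , inv)
  ... | inj₁ f0  | inj₁ fs        = inj₁ λ { zero → f0 ; (suc i) → fs i }

  sum-zero : ∀ {n} {f : Vector F n} → (∀ i → f i ≈ 0#) → sum f ≈ 0#
  sum-zero {n} f≈0 = trans (sum-cong-≋ f≈0) (sum-replicate-zero n)

  sum-single : ∀ {n} (f : Vector F n) i → (∀ j → ¬ j ≡ i → f j ≈ 0#) → sum f ≈ f i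
  sum-single f zero    f≈0 = trans (+-congˡ (sum-zero λ j → f≈0 (suc j) λ ())) (+-identityʳ _)
  sum-single f (suc i) f≈0 =
    trans (+-cong (f≈0 zero λ ()) (sum-single (f ∘ suc) i λ j j≢i → f≈0 (suc j) λ { ≡.refl → j≢i ≡.refl }))
      (+-identityˡ _)

  sum-++ : ∀ m {n} (f : Vector F (m ℕ.+ n)) → sum f ≈ sum (λ i → f (i ↑ˡ n)) + sum (λ i → f (m ↑ʳ i))
  sum-++ zero    f = sym (+-identityˡ _)
  sum-++ (suc m) f = trans (+-congˡ (sum-++ m (f ∘ suc))) (sym (+-assoc _ _ _))

  sum-combine : ∀ m n (f : Vector F (m ℕ.* n)) → sum f ≈ sum {m} λ i → sum {n} λ j → f (combine i j)
  sum-combine zero    n f = refl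
  sum-combine (suc m) n f = trans (sum-++ n f) (+-congˡ (sum-combine m n _))


  module Elimination {m n} (K : Fin (suc m) → Fin (suc n) → F) (p : Fin (suc m)) (y : F) (yK≈1 : y * K p zero ≈ 1#) where

    reduced : Fin m → Fin n → F
    reduced j i = K (punchIn p j) (suc i) + -1# * (K (punchIn p j) zero * y) * K p (suc i)

    module _ (x′ : Vector F n) where

      t : F
      t = sum (λ i → K p (suc i) * x′ i)

      extend : Vector F (suc n)
      extend zero    = -1# * (y * t)
      extend (suc i) = x′ i

      row-pivot : sum (λ i → K p i * extend i) ≈ 0#
      row-pivot = begin
        K p zero * (-1# * (y * t)) + t   ≈⟨ pivot-identity (K p zero) -1# y t ⟩
        t + -1# * (y * K p zero * t)     ≈⟨ +-congˡ (*-congˡ (trans (*-congʳ yK≈1) (*-identityˡ t))) ⟩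
        t + -1# * t                      ≈⟨ x+-1*x t ⟩
        0#                               ∎

      row-other : ∀ j → sum (λ i → K (punchIn p j) i * extend i) ≈ sum (λ i → reduced j i * x′ i)
      row-other j = begin
        k * (-1# * (y * t)) + s
          ≈⟨ row-identity k -1# y t s ⟩
        s + -1# * (k * y) * t
          ≈⟨ +-congˡ (*-distribˡ-sum {n} (-1# * (k * y)) _) ⟩
        s + sum (λ i → -1# * (k * y) * (K p (suc i) * x′ i))
          ≈⟨ ∑-distrib-+ {n} _ _ ⟨
        sum (λ i → K (punchIn p j) (suc i) * x′ i + -1# * (k * y) * (K p (suc i) * x′ i))
          ≈⟨ sum-cong-≋ {n} (λ i → trans (+-congˡ (sym (*-assoc _ _ _))) (sym (distribʳ _ _ _))) ⟩
        sum (λ i → reduced j i * x′ i) ∎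
        where
        k s : F
        k = K (punchIn p j) zero
        s = sum (λ i → K (punchIn p j) (suc i) * x′ i)

      solves : (∀ j → sum (λ i → reduced j i * x′ i) ≈ 0#) → ∀ j → sum (λ i → K j i * extend i) ≈ 0#
      solves eq j with p ≟ᶠ j
      ... | yes ≡.refl = row-pivot
      ... | no p≢j     = ≡.subst (λ j → sum (λ i → K j i * extend i) ≈ 0#) (punchIn-punchOut p≢j)
                           (trans (row-other _) (eq _))

  -- Gaussian elimination on the first column. If the column vanishes, the first unit vector is a
  -- solution. Otherwise a pivot removes one equation and one unknown, and the nonzero coordinate of
  -- the smaller solution survives because `extend` only prepends an entry.
  underdetermined : ∀ m n → m ℕ.< n → (K : Fin m → Fin n → F) →
    Σ (Vector F n) λ x → (∃[ i ] x i ≉ 0#) × (∀ j → sum (λ i → K j i * x i) ≈ 0#)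
  underdetermined m (suc n) (s≤s m≤n) K with all-zero-or-invertible (λ j → K j zero)
  ... | inj₁ K₀≈0 = e , (zero , 1≉0) , λ j →
          trans (+-cong (trans (*-identityʳ _) (K₀≈0 j)) (sum-zero {n} {λ i → K j (suc i) * 0#} λ i → zeroʳ _)) (+-identityˡ 0#)
    where
    e : Vector F (suc n)
    e zero    = 1#
    e (suc _) = 0#
  underdetermined (suc m) (suc n) (s≤s m<n) K | inj₂ (p , _ , y , yK≈1)
    with x′ , (i , xi≉0) , eq ← underdetermined m n m<n (Elimination.reduced K p y yK≈1) =
      Elimination.extend K p y yK≈1 x′ , (suc i , xi≉0) , Elimination.solves K p y yK≈1 x′ eq

  Independent : ∀ {m k} → (Fin m → Fin k → F) → Set (c ⊔ ℓ)
  Independent {m} v = ∀ (a : Vector F m) → (∀ j → sum (λ i → a i * v i j) ≈ 0#) → ∀ i → a i ≈ 0#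

  -- The k + 1 vectors consisting of b and the v i satisfy a nontrivial relation in dimension k.
  -- Independence of v forces the coefficient of b in it to be nonzero, so the relation can be
  -- solved for b.
  independent⇒spanning : ∀ {k} (v : Fin k → Fin k → F) → Independent v →
    ∀ (b : Vector F k) → Σ (Vector F k) λ a → ∀ j → sum (λ i → a i * v i j) ≈ b j
  independent⇒spanning {k} v ind b with underdetermined k (suc k) ℕ.≤-refl
    (λ { j zero → b j ; j (suc i) → v i j })
  ... | x , x≉0 , eq with zero-or-invertible (x zero)
  ... | inj₁ x₀≈0 = contradiction (all-zero (proj₁ x≉0)) (proj₂ x≉0)
    where
    all-zero : ∀ i → x i ≈ 0#
    all-zero zero    = x₀≈0
    all-zero (suc i) = ind (x ∘ suc) (λ j → begin
      sum (λ i → x (suc i) * v i j)               ≈⟨ sum-cong-≋ {k} (λ i → *-comm _ _) ⟩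
      sum (λ i → v i j * x (suc i))               ≈⟨ +-identityˡ _ ⟨
      0# + sum (λ i → v i j * x (suc i))          ≈⟨ +-congʳ (trans (*-congˡ x₀≈0) (zeroʳ _)) ⟨
      b j * x zero + sum (λ i → v i j * x (suc i)) ≈⟨ eq j ⟩
      0#                                          ∎) i
  ... | inj₂ (_ , y , yx≈1) = (λ i → -1# * y * x (suc i)) , λ j → begin
      sum (λ i → -1# * y * x (suc i) * v i j)
        ≈⟨ sum-cong-≋ {k} (λ i → trans (*-assoc _ _ _) (*-congˡ (*-comm _ _))) ⟩
      sum (λ i → -1# * y * (v i j * x (suc i)))
        ≈⟨ *-distribˡ-sum {k} (-1# * y) _ ⟨
      -1# * y * s j
        ≈⟨ +-identityˡ _ ⟨
      0# + -1# * y * s j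
        ≈⟨ +-congʳ (x+-1*x (y * x zero * b j)) ⟨
      y * x zero * b j + -1# * (y * x zero * b j) + -1# * y * s j
        ≈⟨ cramer-identity -1# y (b j) (x zero) (s j) ⟩
      y * x zero * b j + -1# * y * (b j * x zero + s j)
        ≈⟨ +-cong (trans (*-congʳ yx≈1) (*-identityˡ _)) (trans (*-congˡ (eq j)) (zeroʳ _)) ⟩
      b j + 0#
        ≈⟨ +-identityʳ _ ⟩
      b j ∎
    where
    s : Fin k → F
    s j = sum (λ i → v i j * x (suc i))

-- Words acting on alternating power series.

-- Letters (i , true) and (i , false) stand for a generator and its inverse.
Letter : Set
Letter = Fin 2 × Bool

inv : Letter → Letter
inv (i , σ) = i , not σ

Reduced : List Letter → Set
Reduced = Linked (λ s s′ → s′ ≢ inv s)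

other : Fin 2 → Fin 2
other zero       = suc zero
other (suc zero) = zero

other-involutive : ∀ i → other (other i) ≡ i
other-involutive zero       = ≡.refl
other-involutive (suc zero) = ≡.refl

same-or-other : ∀ i j → j ≡ i ⊎ j ≡ other i
same-or-other zero       zero       = inj₁ ≡.refl
same-or-other zero       (suc zero) = inj₂ ≡.refl
same-or-other (suc zero) zero       = inj₂ ≡.refl
same-or-other (suc zero) (suc zero) = inj₁ ≡.refl

sgn : Bool → ℤ
sgn true  = 1ℤ
sgn false = -1ℤ

coef : Letter → Fin 2 → ℤ
coef (zero     , σ) zero       = sgn σ
coef (zero     , σ) (suc zero) = 0ℤ
coef (suc zero , σ) zero       = 0ℤ
coef (suc zero , σ) (suc zero) = sgn σ

coef-same : ∀ i σ → coef (i , σ) i ≡ sgn σ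
coef-same zero       σ = ≡.refl
coef-same (suc zero) σ = ≡.refl

coef-other : ∀ i σ → coef (i , σ) (other i) ≡ 0ℤ
coef-other zero       σ = ≡.refl
coef-other (suc zero) σ = ≡.refl

-- A height h encodes an element of ℤ⟨⟨X₀ , X₁⟩⟩ / (X₀² , X₁²) with constant term 1:
-- h j k is the coefficient of the alternating monomial of degree k + 1 that starts with Xⱼ.
-- The letter (i , ±) acts as left multiplication by 1 ± Xᵢ.
Height : Set
Height = Fin 2 → ℕ → ℤ

full : Height → Fin 2 → ℕ → ℤ
full h j zero    = 1ℤ
full h j (suc k) = h j k

act : Letter → Height → Height
act s h j k = h j k ℤ.+ coef s j ℤ.* full h (other j) k

run : List Letter → Height → Height
run []      h = h
run (s ∷ r) h = run r (act s h)

run-++ : ∀ r r′ h → run (r ++ r′) h ≡ run r′ (run r h)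
run-++ []      r′ h = ≡.refl
run-++ (s ∷ r) r′ h = run-++ r r′ (act s h)

𝟙 : Height
𝟙 j k = 0ℤ

full-act : ∀ s h j → coef s j ≡ 0ℤ → ∀ k → full (act s h) j k ≡ full h j k
full-act s h j c≡0 zero    = ≡.refl
full-act s h j c≡0 (suc k) =
  ≡.trans (≡.cong (λ c → h j k ℤ.+ c ℤ.* full h (other j) k) c≡0) (ℤ.+-identityʳ _)

-- (1 + Xᵢ)(1 - Xᵢ) = 1 because Xᵢ² = 0: a letter changes only coefficients of monomials starting
-- with Xᵢ, and the change is read off from monomials starting with the other variable, which stay
-- fixed.
act-inverse : ∀ s h j k → act (inv s) (act s h) j k ≡ h j k
act-inverse (i , σ) h j k with same-or-other i j
... | inj₂ ≡.refl rewrite coef-other i σ | coef-other i (not σ) =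
  ≡.trans (ℤ.+-identityʳ _) (ℤ.+-identityʳ _)
... | inj₁ ≡.refl rewrite coef-same i σ | coef-same i (not σ)
                        | full-act (i , σ) h (other i) (coef-other i σ) k = cancel σ
  where
  open +-*-Solver
  cancel : ∀ σ → h i k ℤ.+ sgn σ ℤ.* full h (other i) k ℤ.+ sgn (not σ) ℤ.* full h (other i) k ≡ h i k
  cancel true  = solve 2 (λ x y → x :+ con 1ℤ :* y :+ con -1ℤ :* y := x) ≡.refl (h i k) (full h (other i) k)
  cancel false = solve 2 (λ x y → x :+ con -1ℤ :* y :+ con 1ℤ :* y := x) ≡.refl (h i k) (full h (other i) k)

-- Multiplication of the series with coefficients κ along the monomials starting with Xⱼ by v.
conv : (ℕ → ℤ) → (Fin 2 → ℕ → ℤ) → Fin 2 → ℕ → ℤ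
conv κ v j zero    = κ 0 ℤ.* v j 0
conv κ v j (suc k) = κ 0 ℤ.* v j (suc k) ℤ.+ conv (κ ∘ suc) v (other j) k

conv-linear : ∀ a x b v j k → conv (λ m → a m ℤ.+ x ℤ.* b m) v j k ≡ conv a v j k ℤ.+ x ℤ.* conv b v j k
conv-linear a x b v j zero = solve 4 (λ a x b v → (a :+ x :* b) :* v := a :* v :+ x :* (b :* v)) ≡.refl (a 0) x (b 0) (v j 0)
  where open +-*-Solver
conv-linear a x b v j (suc k) rewrite conv-linear (a ∘ suc) x (b ∘ suc) v (other j) k =
  solve 6 (λ a x b v p q → (a :+ x :* b) :* v :+ (p :+ x :* q) := a :* v :+ p :+ x :* (b :* v :+ q)) ≡.refl
    (a 0) x (b 0) (v j (suc k)) (conv (a ∘ suc) v (other j) k) (conv (b ∘ suc) v (other j) k)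
  where open +-*-Solver

conv-leading : ∀ κ v j k → (∀ m → m ℕ.< k → κ m ≡ 0ℤ) → conv κ (full v) j k ≡ κ k
conv-leading κ v j zero    κ≡0 = ℤ.*-identityʳ _
conv-leading κ v j (suc k) κ≡0 rewrite κ≡0 0 (s≤s z≤n) =
  ≡.trans (ℤ.+-identityˡ _) (conv-leading (κ ∘ suc) v (other j) k λ m m<k → κ≡0 (suc m) (s≤s m<k))

-- The series of h is the product of those of κ and v. An alternating monomial has one factorization
-- for each length of the prefix, and alternation determines the first variable of the suffix, so a
-- single convolution gives the product.
IsProduct : Height → Height → Height → Set
IsProduct h κ v = ∀ j k → full h j k ≡ conv (full κ j) (full v) j k

-- Left multiplications commute with right multiplications.
act-product : ∀ s {h κ v} → IsProduct h κ v → IsProduct (act s h) (act s κ) v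
act-product s eq j zero = eq j zero
act-product s {h} {κ} {v} eq j (suc k) = begin
  h j k ℤ.+ c ℤ.* full h (other j) k
    ≡⟨ ≡.cong₂ (λ a b → a ℤ.+ c ℤ.* b) (eq j (suc k)) (eq (other j) k) ⟩
  (1ℤ ℤ.* v j k ℤ.+ conv (κ j) (full v) (other j) k) ℤ.+ c ℤ.* conv (full κ (other j)) (full v) (other j) k
    ≡⟨ ℤ.+-assoc (1ℤ ℤ.* v j k) _ _ ⟩
  1ℤ ℤ.* v j k ℤ.+ (conv (κ j) (full v) (other j) k ℤ.+ c ℤ.* conv (full κ (other j)) (full v) (other j) k)
    ≡⟨ ≡.cong (λ a → 1ℤ ℤ.* v j k ℤ.+ a) (conv-linear (κ j) c (full κ (other j)) (full v) (other j) k) ⟨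
  1ℤ ℤ.* v j k ℤ.+ conv (act s κ j) (full v) (other j) k ∎
  where
  open ≡.≡-Reasoning
  c = coef s j

run-product : ∀ r {h κ v} → IsProduct h κ v → IsProduct (run r h) (run r κ) v
run-product []      eq = eq
run-product (s ∷ r) eq = run-product r (act-product s eq)

conv-zero : ∀ κ v j k → (∀ m → κ m ≡ 0ℤ) → conv κ v j k ≡ 0ℤ
conv-zero κ v j zero    κ≡0 rewrite κ≡0 0 = ≡.refl
conv-zero κ v j (suc k) κ≡0 rewrite κ≡0 0 =
  ≡.trans (ℤ.+-identityˡ _) (conv-zero (κ ∘ suc) v (other j) k (κ≡0 ∘ suc))

𝟙-product : ∀ v → IsProduct v 𝟙 v
𝟙-product v j zero    = ≡.refl
𝟙-product v j (suc k) = ≡.sym $ ≡.trans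
  (≡.cong₂ ℤ._+_ (ℤ.*-identityˡ (v j k)) (conv-zero (𝟙 j) (full v) (other j) k λ _ → ≡.refl))
  (ℤ.+-identityʳ _)

-- The series of `run r v` is that of `run r 𝟙` times that of v. If the first factor is 1 plus terms
-- of index at least k, its terms of index k meet only the constant term 1 of v. Hence the leading
-- displacement caused by a word is the same at every height.
run-leading : ∀ r v k → (∀ j m → m ℕ.< k → run r 𝟙 j m ≡ 0ℤ) →
  ∀ j → run r v j k ≡ v j k ℤ.+ run r 𝟙 j k
run-leading r v k κ≡0 j = ≡.trans (run-product r (𝟙-product v) j (suc k))
  (≡.cong₂ ℤ._+_ (ℤ.*-identityˡ (v j k)) (conv-leading (run r 𝟙 j) v (other j) k (κ≡0 j)))

run-below : ∀ r v k → (∀ j m → m ℕ.< k → run r 𝟙 j m ≡ 0ℤ) →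
  ∀ j m → m ℕ.< k → run r v j m ≡ v j m
run-below r v k κ≡0 j m m<k = ≡.trans
  (run-leading r v m (λ j m′ m′<m → κ≡0 j m′ (ℕ.<-trans m′<m m<k)) j)
  (≡.trans (≡.cong (λ a → v j m ℤ.+ a) (κ≡0 j m m<k)) (ℤ.+-identityʳ _))

-- The action is free degree by degree: by induction on k, `run-leading` applies in the next degree,
-- and cancelling v j k there leaves the coefficient of `run r 𝟙`.
run-below⁻ : ∀ r v k → (∀ j m → m ℕ.< k → run r v j m ≡ v j m) →
  ∀ j m → m ℕ.< k → run r 𝟙 j m ≡ 0ℤ
run-below⁻ r v zero    eq j m ()
run-below⁻ r v (suc k) eq j m (s≤s m≤k) with ℕ.m≤n⇒m<n∨m≡n m≤k
... | inj₁ m<k = run-below⁻ r v k (λ j m m<k → eq j m (ℕ.m<n⇒m<1+n m<k)) j m m<k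
... | inj₂ ≡.refl = identityʳ-unique (v j k) _ (≡.trans
        (≡.sym (run-leading r v k (run-below⁻ r v k (λ j m m<k → eq j m (ℕ.m<n⇒m<1+n m<k))) j))
        (eq j k ℕ.≤-refl))
  where open import Algebra.Properties.AbelianGroup ℤ.+-0-abelianGroup using (identityʳ-unique)

-- The state of run r 𝟙 after a reduced word r with last letter (i , σ) and L + 1 syllables,
-- the last of which has length n + 1.
record Syllables (κ : Height) (i : Fin 2) (σ : Bool) (L n : ℕ) : Set where
  field
    nonzero : full κ (other i) L ≢ 0ℤ
    leading : κ i L ≡ (+ suc n) ℤ.* (sgn σ ℤ.* full κ (other i) L)
    beyond  : ∀ j m → L ℕ.< m → κ j m ≡ 0ℤ
    vanish  : κ (other i) L ≡ 0ℤ

  sgn-nonzero : ∀ σ → sgn σ ≢ 0ℤ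
  sgn-nonzero true  ()
  sgn-nonzero false ()

  leading-nonzero : κ i L ≢ 0ℤ
  leading-nonzero κ≡0 with ℤ.i*j≡0⇒i≡0∨j≡0 (+ suc n) (≡.trans (≡.sym leading) κ≡0)
  ... | inj₂ eq with ℤ.i*j≡0⇒i≡0∨j≡0 (sgn σ) eq
  ... | inj₁ eq′ = sgn-nonzero σ eq′
  ... | inj₂ eq′ = nonzero eq′

syllables-start : ∀ i σ → Syllables (act (i , σ) 𝟙) i σ 0 0
syllables-start i σ = record
  { nonzero = λ ()
  ; leading = ≡.trans (ℤ.+-identityˡ _)
      (≡.trans (≡.cong (ℤ._* 1ℤ) (coef-same i σ)) (≡.sym (ℤ.*-identityˡ _)))
  ; beyond  = λ { j (suc m) _ → ≡.trans (ℤ.+-identityˡ _) (ℤ.*-zeroʳ (coef (i , σ) j)) }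
  ; vanish  = ≡.trans (ℤ.+-identityˡ _) (≡.cong (ℤ._* 1ℤ) (coef-other i σ))
  }

-- Since X² = 0, (1 ± X)ⁿ = 1 ± nX: repeating a letter scales the leading coefficient by the length
-- of the syllable, which is nonzero over ℤ.
syllables-extend : ∀ {κ i σ L n} → Syllables κ i σ L n → Syllables (act (i , σ) κ) i σ L (suc n)
syllables-extend {κ} {i} {σ} {L} {n} inv = record
  { nonzero = λ eq → nonzero (≡.trans (≡.sym same) eq)
  ; leading = begin
      κ i L ℤ.+ coef (i , σ) i ℤ.* a
        ≡⟨ ≡.cong₂ (λ x c → x ℤ.+ c ℤ.* a) leading (coef-same i σ) ⟩
      (+ suc n) ℤ.* (sgn σ ℤ.* a) ℤ.+ sgn σ ℤ.* a
        ≡⟨ solve 2 (λ n x → n :* x :+ x := (con 1ℤ :+ n) :* x) ≡.refl (+ suc n) (sgn σ ℤ.* a) ⟩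
      (+ suc (suc n)) ℤ.* (sgn σ ℤ.* a)
        ≡⟨ ≡.cong (λ x → (+ suc (suc n)) ℤ.* (sgn σ ℤ.* x)) same ⟨
      (+ suc (suc n)) ℤ.* (sgn σ ℤ.* full (act (i , σ) κ) (other i) L) ∎
  ; beyond  = beyond′
  ; vanish  = ≡.trans (full-act (i , σ) κ (other i) (coef-other i σ) (suc L)) vanish
  }
  where
  open Syllables inv
  open ≡.≡-Reasoning
  open +-*-Solver
  a = full κ (other i) L
  same : full (act (i , σ) κ) (other i) L ≡ a
  same = full-act (i , σ) κ (other i) (coef-other i σ) L
  beyond′ : ∀ j m → L ℕ.< m → act (i , σ) κ j m ≡ 0ℤ
  beyond′ j (suc m) (s≤s L≤m) with same-or-other i j
  ... | inj₂ ≡.refl = ≡.trans (full-act (i , σ) κ (other i) (coef-other i σ) (suc (suc m))) (beyond _ _ (s≤s L≤m))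
  ... | inj₁ ≡.refl = ≡.cong₂ ℤ._+_ (beyond i (suc m) (s≤s L≤m))
          (≡.trans (≡.cong (coef (i , σ) i ℤ.*_) zero-there) (ℤ.*-zeroʳ (coef (i , σ) i)))
    where
    zero-there : κ (other i) m ≡ 0ℤ
    zero-there with ℕ.m≤n⇒m<n∨m≡n L≤m
    ... | inj₁ L<m    = beyond _ _ L<m
    -- In the borderline case m = L the field `beyond` says nothing.
    ... | inj₂ ≡.refl = vanish

-- A letter of the other generator puts a new variable in front of the top monomial: the degree
-- rises by one and the old leading coefficient is kept up to sign.
syllables-new : ∀ {κ σ L n} o σ′ → Syllables κ (other o) σ L n → Syllables (act (o , σ′) κ) o σ′ (suc L) 0
syllables-new {κ} {σ} {L} {n} o σ′ inv = record
  { nonzero = λ eq → leading-nonzero (≡.trans (≡.sym same) eq)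
  ; leading = begin
      κ o (suc L) ℤ.+ coef (o , σ′) o ℤ.* κ (other o) L
        ≡⟨ ≡.cong₂ (λ x c → x ℤ.+ c ℤ.* κ (other o) L) (beyond o (suc L) ℕ.≤-refl) (coef-same o σ′) ⟩
      0ℤ ℤ.+ sgn σ′ ℤ.* κ (other o) L
        ≡⟨ ℤ.+-identityˡ _ ⟩
      sgn σ′ ℤ.* κ (other o) L
        ≡⟨ ℤ.*-identityˡ _ ⟨
      1ℤ ℤ.* (sgn σ′ ℤ.* κ (other o) L)
        ≡⟨ ≡.cong (λ x → 1ℤ ℤ.* (sgn σ′ ℤ.* x)) same ⟨
      1ℤ ℤ.* (sgn σ′ ℤ.* full (act (o , σ′) κ) (other o) (suc L)) ∎
  ; beyond  = beyond′
  ; vanish  = ≡.trans (full-act (o , σ′) κ (other o) (coef-other o σ′) (suc (suc L))) (beyond (other o) (suc L) ℕ.≤-refl)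
  }
  where
  open Syllables inv
  open ≡.≡-Reasoning
  same : full (act (o , σ′) κ) (other o) (suc L) ≡ κ (other o) L
  same = full-act (o , σ′) κ (other o) (coef-other o σ′) (suc L)
  beyond′ : ∀ j m → suc L ℕ.< m → act (o , σ′) κ j m ≡ 0ℤ
  beyond′ j (suc m) (s≤s L<m) = ≡.cong₂ ℤ._+_ (beyond j (suc m) (ℕ.m<n⇒m<1+n L<m))
    (≡.trans (≡.cong (coef (o , σ′) j ℤ.*_) (beyond (other j) m L<m)) (ℤ.*-zeroʳ (coef (o , σ′) j)))

-- A reduced word never has opposite signs inside a syllable, so each letter either lengthens the
-- current syllable or opens a new one. There are at most as many syllables as letters, hence
-- truncation at degree c still detects every nonempty reduced word of at most c letters.
reduced-nonzero : ∀ {κ i σ L n} r → Syllables κ i σ L n → Reduced ((i , σ) ∷ r) →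
  ∃[ m ] m ℕ.≤ L ℕ.+ length r × ∃[ j ] run r κ j m ≢ 0ℤ
reduced-nonzero {L = L} [] inv _ = L , ℕ.m≤m+n L 0 , _ , Syllables.leading-nonzero inv
reduced-nonzero {i = i} {σ} {L} ((i′ , σ′) ∷ r) inv (s′≢ ∷ red) with same-or-other i i′
reduced-nonzero {i = i} {σ} {L} ((_ , σ′) ∷ r) inv (s′≢ ∷ red) | inj₂ ≡.refl
  with m , m≤ , rest ← reduced-nonzero r (syllables-new (other i) σ′ (≡.subst (λ i → Syllables _ i σ L _) (≡.sym (other-involutive i)) inv)) red =
    m , ≡.subst (m ℕ.≤_) (≡.sym (ℕ.+-suc L (length r))) m≤ , rest
reduced-nonzero {σ = true} ((i , false) ∷ r) inv (s′≢ ∷ red) | inj₁ ≡.refl = contradiction ≡.refl s′≢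
reduced-nonzero {σ = false} ((i , true) ∷ r) inv (s′≢ ∷ red) | inj₁ ≡.refl = contradiction ≡.refl s′≢
reduced-nonzero {σ = true} {L} ((i , true) ∷ r) inv (s′≢ ∷ red) | inj₁ ≡.refl
  with m , m≤ , rest ← reduced-nonzero r (syllables-extend inv) red =
    m , ℕ.≤-trans m≤ (ℕ.+-monoʳ-≤ L (ℕ.n≤1+n _)) , rest
reduced-nonzero {σ = false} {L} ((i , false) ∷ r) inv (s′≢ ∷ red) | inj₁ ≡.refl
  with m , m≤ , rest ← reduced-nonzero r (syllables-extend inv) red =
    m , ℕ.≤-trans m≤ (ℕ.+-monoʳ-≤ L (ℕ.n≤1+n _)) , rest

-- The order on truncated heights.

-- Heights are compared up to degree c only: this makes the boxes below finite.
module Truncated (c : ℕ) where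

  infix 4 _≃_ _⊏_

  _≃_ : Height → Height → Set
  h ≃ h′ = ∀ j k → k ℕ.< c → h j k ≡ h′ j k

  ≃-refl : ∀ {h} → h ≃ h
  ≃-refl j k _ = ≡.refl

  ≃-sym : ∀ {h h′} → h ≃ h′ → h′ ≃ h
  ≃-sym p j k k<c = ≡.sym (p j k k<c)

  ≃-trans : ∀ {h h′ h″} → h ≃ h′ → h′ ≃ h″ → h ≃ h″
  ≃-trans p q j k k<c = ≡.trans (p j k k<c) (q j k k<c)

  act-cong : ∀ s {h h′} → h ≃ h′ → act s h ≃ act s h′
  act-cong s p j zero    k<c = ≡.cong (ℤ._+ (coef s j ℤ.* 1ℤ)) (p j zero k<c)
  act-cong s p j (suc k) k<c = ≡.cong₂ (λ a b → a ℤ.+ coef s j ℤ.* b) (p j (suc k) k<c)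
    (p (other j) k (ℕ.<-trans ℕ.≤-refl k<c))

  run-cong : ∀ r {h h′} → h ≃ h′ → run r h ≃ run r h′
  run-cong []      p = p
  run-cong (s ∷ r) p = run-cong r (act-cong s p)

  act-inverse-≃ : ∀ s h → act (inv s) (act s h) ≃ h
  act-inverse-≃ s h j k _ = act-inverse s h j k

  LexLess : (Fin 2 → ℤ) → (Fin 2 → ℤ) → Set
  LexLess x y = x zero ℤ.< y zero ⊎ (x zero ≡ y zero × x (suc zero) ℤ.< y (suc zero))

  -- The Magnus order: the lowest degree in which two series differ decides, and within it the
  -- monomial starting with X₀ takes precedence.
  record _⊏_ (h h′ : Height) : Set where
    constructor less
    field
      degree  : ℕ
      bounded : degree ℕ.< c
      agree   : ∀ j m → m ℕ.< degree → h j m ≡ h′ j m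
      lex     : LexLess (λ j → h j degree) (λ j → h′ j degree)

  ⊏-irrefl : ∀ {h h′} → h ≃ h′ → ¬ h ⊏ h′
  ⊏-irrefl p (less k k<c _ (inj₁ x<y))       = ℤ.<-irrefl (p zero k k<c) x<y
  ⊏-irrefl p (less k k<c _ (inj₂ (_ , x<y))) = ℤ.<-irrefl (p (suc zero) k k<c) x<y

  ⊏-respʳ-≃ : ∀ {h h′ h″} → h′ ≃ h″ → h ⊏ h′ → h ⊏ h″
  ⊏-respʳ-≃ {h} p (less k k<c agree lex) = less k k<c
    (λ j m m<k → ≡.trans (agree j m m<k) (p j m (ℕ.<-trans m<k k<c)))
    (≡.subst₂ (λ a b → h zero k ℤ.< a ⊎ (h zero k ≡ a × h (suc zero) k ℤ.< b)) (p zero k k<c) (p (suc zero) k k<c) lex)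

  ⊏-respˡ-≃ : ∀ {h h′ h″} → h ≃ h′ → h ⊏ h″ → h′ ⊏ h″
  ⊏-respˡ-≃ {h″ = h} p (less k k<c agree lex) = less k k<c
    (λ j m m<k → ≡.trans (≡.sym (p j m (ℕ.<-trans m<k k<c))) (agree j m m<k))
    (≡.subst₂ (λ a b → a ℤ.< h zero k ⊎ (a ≡ h zero k × b ℤ.< h (suc zero) k)) (p zero k k<c) (p (suc zero) k k<c) lex)

  lex-trans : ∀ {x y z} → LexLess x y → LexLess y z → LexLess x z
  lex-trans (inj₁ p) (inj₁ q) = inj₁ (ℤ.<-trans p q)
  lex-trans {x} (inj₁ p) (inj₂ (e , _)) = inj₁ (≡.subst (x zero ℤ.<_) e p)
  lex-trans {z = z} (inj₂ (e , _)) (inj₁ q) = inj₁ (≡.subst (ℤ._< z zero) (≡.sym e) q)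
  lex-trans (inj₂ (e , p)) (inj₂ (e′ , q)) = inj₂ (≡.trans e e′ , ℤ.<-trans p q)

  ⊏-trans : ∀ {h h′ h″} → h ⊏ h′ → h′ ⊏ h″ → h ⊏ h″
  ⊏-trans {h} {h′} {h″} (less k k<c p x) (less l l<c q y) with ℕ.<-cmp k l
  ... | tri≈ _ ≡.refl _ = less k k<c (λ j m m<k → ≡.trans (p j m m<k) (q j m m<k))
          (lex-trans {λ j → h j k} {λ j → h′ j k} {λ j → h″ j k} x y)
  ... | tri< k<l _ _ = less k k<c (λ j m m<k → ≡.trans (p j m m<k) (q j m (ℕ.<-trans m<k k<l)))
          (≡.subst₂ (λ a b → h zero k ℤ.< a ⊎ (h zero k ≡ a × h (suc zero) k ℤ.< b)) (q zero k k<l) (q (suc zero) k k<l) x)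
  ... | tri> _ _ l<k = less l l<c (λ j m m<l → ≡.trans (p j m (ℕ.<-trans m<l l<k)) (q j m m<l))
          (≡.subst₂ (λ a b → a ℤ.< h″ zero l ⊎ (a ≡ h″ zero l × b ℤ.< h″ (suc zero) l)) (≡.sym (p zero l l<k)) (≡.sym (p (suc zero) l l<k)) y)

  compare-upto : ∀ h h′ b → b ℕ.≤ c → (∀ j m → m ℕ.< b → h j m ≡ h′ j m) ⊎ (h ⊏ h′ ⊎ h′ ⊏ h)
  compare-upto h h′ zero    _   = inj₁ λ _ _ ()
  compare-upto h h′ (suc b) b<c with compare-upto h h′ b (ℕ.<⇒≤ b<c)
  ... | inj₂ unequal  = inj₂ unequal
  ... | inj₁ agree with ℤ.<-cmp (h zero b) (h′ zero b) | ℤ.<-cmp (h (suc zero) b) (h′ (suc zero) b)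
  ... | tri< p _ _ | _          = inj₂ (inj₁ (less b b<c agree (inj₁ p)))
  ... | tri> _ _ p | _          = inj₂ (inj₂ (less b b<c (λ j m m<b → ≡.sym (agree j m m<b)) (inj₁ p)))
  ... | tri≈ _ e _ | tri< p _ _ = inj₂ (inj₁ (less b b<c agree (inj₂ (e , p))))
  ... | tri≈ _ e _ | tri> _ _ p = inj₂ (inj₂ (less b b<c (λ j m m<b → ≡.sym (agree j m m<b)) (inj₂ (≡.sym e , p))))
  ... | tri≈ _ e _ | tri≈ _ e′ _ = inj₁ agree′
    where
    agree′ : ∀ j m → m ℕ.< suc b → h j m ≡ h′ j m
    agree′ j m (s≤s m≤b) with ℕ.m≤n⇒m<n∨m≡n m≤b
    agree′ j          m (s≤s m≤b) | inj₁ m<b    = agree j m m<b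
    agree′ zero       m (s≤s m≤b) | inj₂ ≡.refl = e
    agree′ (suc zero) m (s≤s m≤b) | inj₂ ≡.refl = e′

  compare : ∀ h h′ → h ≃ h′ ⊎ (h ⊏ h′ ⊎ h′ ⊏ h)
  compare h h′ = compare-upto h h′ c ℕ.≤-refl

  ≃-dec : ∀ h h′ → Dec (h ≃ h′)
  ≃-dec h h′ with compare h h′
  ... | inj₁ p        = yes p
  ... | inj₂ (inj₁ p) = no λ q → ⊏-irrefl q p
  ... | inj₂ (inj₂ p) = no λ q → ⊏-irrefl (≃-sym q) p

  ⊏-dec : ∀ h h′ → Dec (h ⊏ h′)
  ⊏-dec h h′ with compare h h′
  ... | inj₁ p        = no (⊏-irrefl p)
  ... | inj₂ (inj₁ p) = yes p
  ... | inj₂ (inj₂ p) = no λ q → ⊏-irrefl ≃-refl (⊏-trans p q)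

  x<x+1 : ∀ x → x ℤ.< x ℤ.+ 1ℤ
  x<x+1 x = ≡.subst (ℤ._< x ℤ.+ 1ℤ) (ℤ.+-identityʳ x) (ℤ.+-monoʳ-< x (ℤ.+<+ (s≤s z≤n)))

  act-⊏ : 0 ℕ.< c → ∀ i h → h ⊏ act (i , true) h
  act-⊏ 0<c zero       h = less 0 0<c (λ _ _ ()) (inj₁ (x<x+1 (h zero 0)))
  act-⊏ 0<c (suc zero) h = less 0 0<c (λ _ _ ())
    (inj₂ (≡.sym (ℤ.+-identityʳ _) , x<x+1 (h (suc zero) 0)))

  Positive : List Letter → Set
  Positive r = ∀ h → h ⊏ run r h

  -- Below `degree` the word acts trivially, and in `degree` it adds the same constants at every
  -- height by `run-leading`. So the comparison made at h carries over to h′.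
  positive : ∀ r h → h ⊏ run r h → Positive r
  positive r h (less k k<c agree lex) h′ =
    less k k<c (λ j m m<k → ≡.sym (run-below r h′ k κ≡0 j m m<k)) (shift lex)
    where
    κ≡0 = run-below⁻ r h k λ j m m<k → ≡.sym (agree j m m<k)
    lead : ∀ v j → run r v j k ≡ v j k ℤ.+ run r 𝟙 j k
    lead v = run-leading r v k κ≡0
    transfer : ∀ {a b x} → a ℤ.< a ℤ.+ x → b ℤ.< b ℤ.+ x
    transfer {a} {b} {x} p = ≡.subst₂ ℤ._<_
      (solve 2 (λ a b → b :- a :+ a := b) ≡.refl a b)
      (solve 3 (λ a b x → b :- a :+ (a :+ x) := b :+ x) ≡.refl a b x)
      (ℤ.+-monoʳ-< (b ℤ.- a) p)
      where open +-*-Solver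
    moved : ∀ j → h j k ℤ.< run r h j k → h′ j k ℤ.< run r h′ j k
    moved j p = ≡.subst (h′ j k ℤ.<_) (≡.sym (lead h′ j)) (transfer (≡.subst (h j k ℤ.<_) (lead h j) p))
    shift : LexLess (λ j → h j k) (λ j → run r h j k) → LexLess (λ j → h′ j k) (λ j → run r h′ j k)
    shift (inj₁ p)       = inj₁ (moved zero p)
    shift (inj₂ (e , p)) = inj₂ (≡.sym (≡.trans (lead h′ zero) (≡.trans (≡.cong (λ x → h′ zero k ℤ.+ x) κ₀≡0) (ℤ.+-identityʳ _))) , moved (suc zero) p)
      where
      open import Algebra.Properties.AbelianGroup ℤ.+-0-abelianGroup using (identityʳ-unique)
      κ₀≡0 : run r 𝟙 zero k ≡ 0ℤ
      κ₀≡0 = identityʳ-unique (h zero k) _ (≡.trans (≡.sym (lead h zero)) (≡.sym e))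

  reduced-moves : ∀ s r → Reduced (s ∷ r) → length (s ∷ r) ℕ.≤ c → ∀ h → ¬ run (s ∷ r) h ≃ h
  reduced-moves s r red len h fixed with reduced-nonzero r (syllables-start (proj₁ s) (proj₂ s)) red
  ... | m , m≤ , j , κ≢0 = κ≢0 (run-below⁻ (s ∷ r) h c fixed j m (ℕ.≤-trans (s≤s m≤) len))

-- Boxes of heights and Følner sets.

-- A box lets both coefficients of index k range over 0, ..., b k - 1, hence two factors `b 0` in
-- each degree.
volume : (ℕ → ℕ) → ℕ → ℕ
volume b zero    = 1
volume b (suc c) = b 0 ℕ.* (b 0 ℕ.* volume (b ∘ suc) c)

cons : ℕ → ℕ → Height → Height
cons p q h zero       zero    = + p
cons p q h (suc zero) zero    = + q
cons p q h j          (suc k) = h j k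

point : ∀ b c → Fin (volume b c) → Height
-- A default: coefficients from the truncation degree on are invisible to `_≃_`.
point b zero    i = 𝟙
point b (suc c) i = cons (toℕ (proj₁ outermost)) (toℕ (proj₁ next)) (point (b ∘ suc) c (proj₂ next))
  where
  outermost = remQuot {b 0} (b 0 ℕ.* volume (b ∘ suc) c) i
  next      = remQuot {b 0} (volume (b ∘ suc) c) (proj₂ outermost)

point-combine : ∀ b c p q i →
  point b (suc c) (combine {b 0} p (combine {b 0} q i)) ≡ cons (toℕ p) (toℕ q) (point (b ∘ suc) c i)
point-combine b c p q i = ≡.trans
  (≡.cong (λ x → cons (toℕ (proj₁ x)) (toℕ (proj₁ (remQuot {b 0} V (proj₂ x)))) (point (b ∘ suc) c (proj₂ (remQuot {b 0} V (proj₂ x)))))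
    (remQuot-combine {b 0} p (combine q i)))
  (≡.cong (λ x → cons (toℕ p) (toℕ (proj₁ x)) (point (b ∘ suc) c (proj₂ x))) (remQuot-combine {b 0} q i))
  where V = volume (b ∘ suc) c

record InBox (b : ℕ → ℕ) (c : ℕ) (h : Height) : Set where
  constructor inBox
  field at : ∀ j k → k ℕ.< c → ∃[ n ] n ℕ.< b k × h j k ≡ + n

point-inBox : ∀ b c i → InBox b c (point b c i)
point-inBox b zero    i .InBox.at j k ()
point-inBox b (suc c) i .InBox.at zero       zero    _         = toℕ _ , toℕ<n _ , ≡.refl
point-inBox b (suc c) i .InBox.at (suc zero) zero    _         = toℕ _ , toℕ<n _ , ≡.refl
point-inBox b (suc c) i .InBox.at zero       (suc k) (s≤s k<c) = point-inBox (b ∘ suc) c _ .InBox.at zero k k<c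
point-inBox b (suc c) i .InBox.at (suc zero) (suc k) (s≤s k<c) = point-inBox (b ∘ suc) c _ .InBox.at (suc zero) k k<c

point-covers : ∀ b c h → InBox b c h → ∃[ i ] Truncated._≃_ c (point b c i) h
point-covers b zero    h box = zero , λ _ _ ()
point-covers b (suc c) h (inBox box)
  with i , eq ← point-covers (b ∘ suc) c (λ j k → h j (suc k)) (inBox λ j k k<c → box j (suc k) (s≤s k<c))
  with p , p< , hp ← box zero 0 (s≤s z≤n)
  with q , q< , hq ← box (suc zero) 0 (s≤s z≤n) = combine (fromℕ< p<) (combine (fromℕ< q<) i) , agrees
  where
  go : Truncated._≃_ (suc c) (cons (toℕ (fromℕ< p<)) (toℕ (fromℕ< q<)) (point (b ∘ suc) c i)) h
  go zero       zero    _         = ≡.trans (≡.cong +_ (toℕ-fromℕ< p<)) (≡.sym hp)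
  go (suc zero) zero    _         = ≡.trans (≡.cong +_ (toℕ-fromℕ< q<)) (≡.sym hq)
  go zero       (suc k) (s≤s k<c) = eq zero k k<c
  go (suc zero) (suc k) (s≤s k<c) = eq (suc zero) k k<c
  agrees : Truncated._≃_ (suc c) (point b (suc c) (combine (fromℕ< p<) (combine (fromℕ< q<) i))) h
  agrees = ≡.subst (λ h′ → Truncated._≃_ (suc c) h′ h) (≡.sym (point-combine b c (fromℕ< p<) (fromℕ< q<) i)) go

remQuot-injective : ∀ {n} k (i i′ : Fin (n ℕ.* k)) → remQuot {n} k i ≡ remQuot k i′ → i ≡ i′
remQuot-injective {n} k i i′ eq =
  ≡.trans (≡.sym (combine-remQuot {n} k i)) (≡.trans (≡.cong (λ (p , q) → combine p q) eq) (combine-remQuot {n} k i′))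

point-injective : ∀ b c i i′ → Truncated._≃_ c (point b c i) (point b c i′) → i ≡ i′
point-injective b zero    zero zero eq = ≡.refl
point-injective b (suc c) i i′ eq =
  remQuot-injective {b 0} (b 0 ℕ.* volume (b ∘ suc) c) i i′ (≡.cong₂ _,_
    (toℕ-injective (ℤ.+-injective (eq zero 0 (s≤s z≤n))))
    (remQuot-injective {b 0} (volume (b ∘ suc) c) _ _ (≡.cong₂ _,_
      (toℕ-injective (ℤ.+-injective (eq (suc zero) 0 (s≤s z≤n))))
      (point-injective (b ∘ suc) c _ _ λ
        { zero k k<c → eq zero (suc k) (s≤s k<c)
        ; (suc zero) k k<c → eq (suc zero) (suc k) (s≤s k<c) }))))

-- Bernoulli's inequality (1 - 1/(N + 1))^m ≥ 1 - m/(N + 1) with denominators cleared; e is N + 1 -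
-- m.
bernoulli : ∀ N m e → e ℕ.+ m ≡ suc N → suc N ℕ.^ m ℕ.* e ℕ.≤ suc N ℕ.* N ℕ.^ m
bernoulli N zero e eq = ℕ.≤-reflexive (≡.trans (ℕ.*-identityˡ e)
  (≡.trans (≡.trans (≡.sym (ℕ.+-identityʳ e)) eq) (≡.sym (ℕ.*-identityʳ _))))
bernoulli N (suc m) e eq = begin
  suc N ℕ.* P ℕ.* e             ≡⟨ solve 3 (λ n p e → (con 1 :+ n) :* p :* e := p :* (e :+ n :* e)) ≡.refl N P e ⟩
  P ℕ.* (e ℕ.+ N ℕ.* e)         ≤⟨ ℕ.*-monoʳ-≤ P (ℕ.+-monoˡ-≤ (N ℕ.* e) e≤N) ⟩
  P ℕ.* (N ℕ.+ N ℕ.* e)         ≡⟨ solve 3 (λ n p e → p :* (n :+ n :* e) := n :* (p :* (con 1 :+ e))) ≡.refl N P e ⟩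
  N ℕ.* (P ℕ.* suc e)           ≤⟨ ℕ.*-monoʳ-≤ N (bernoulli N m (suc e) (≡.trans (≡.sym (ℕ.+-suc e m)) eq)) ⟩
  N ℕ.* (suc N ℕ.* N ℕ.^ m)     ≡⟨ solve 2 (λ n p → n :* ((con 1 :+ n) :* p) := (con 1 :+ n) :* (n :* p)) ≡.refl N (N ℕ.^ m) ⟩
  suc N ℕ.* (N ℕ.* N ℕ.^ m)     ∎
  where
  open ℕ.≤-Reasoning
  open ℕSolver
  P = suc N ℕ.^ m
  e≤N : e ℕ.≤ N
  e≤N = ℕ.≤-pred (≡.subst (suc e ℕ.≤_) eq (≡.subst (suc e ℕ.≤_) (≡.sym (ℕ.+-suc e m)) (s≤s (ℕ.m≤m+n e m))))

-- `small-boundary` is tailored to a count: at least d + 1 unknowns for each point of `base`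
-- outnumber d equations for each point of `base⁺`.
record FølnerSet (c d : ℕ) : Set where
  field
    size size⁺     : ℕ
    base           : Fin size → Height
    base⁺          : Fin size⁺ → Height
    base-injective : ∀ i i′ → Truncated._≃_ c (base i) (base i′) → i ≡ i′
    base⊆base⁺     : ∀ i → ∃[ i⁺ ] Truncated._≃_ c (base⁺ i⁺) (base i)
    act-base⊆base⁺ : ∀ g i → ∃[ i⁺ ] Truncated._≃_ c (base⁺ i⁺) (act (g , true) (base i))
    small-boundary : d ℕ.* size⁺ ℕ.< suc d ℕ.* size

module Følner (c d : ℕ) where

  -- m is the number of coordinates of a truncated height. Stretching every side of a box by 1 + 1/N
  -- multiplies the volume by at most (N + 1)/e, and N is chosen so that (d + 1) e exceeds d (N +
  -- 1), by exactly 2.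
  m N e : ℕ
  m = c ℕ.+ c
  N = suc (suc d ℕ.* m)
  e = suc (suc (d ℕ.* m))

  e+m≡1+N : e ℕ.+ m ≡ suc N
  e+m≡1+N = solve 2 (λ d m → con 2 :+ d :* m :+ m := con 2 :+ (con 1 :+ d) :* m) ≡.refl d m
    where open ℕSolver

  -- Multiplication by 1 + Xᵢ adds to a coefficient one of the next lower degree. With sides growing
  -- by a factor N per degree, that summand is at most 1/N of the side it is added to.
  inner outer : ℕ → ℕ
  inner k = N ℕ.^ suc k
  outer k = N ℕ.^ suc k ℕ.+ N ℕ.^ k

  inner⊆outer : ∀ {h} → InBox inner c h → InBox outer c h
  inner⊆outer (inBox box) .InBox.at j k k<c with n , n< , eq ← box j k k<c =
    n , ℕ.≤-trans n< (ℕ.m≤m+n _ _) , eq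

  act-inBox : ∀ {h} i → InBox inner c h → InBox outer c (act (i , true) h)
  act-inBox {h} i (inBox box) .InBox.at j k k<c with same-or-other i j | box j k k<c
  ... | _ | n , n< , eq with full-value (other j) k k<c
    where
    -- The bound is not strict because the constant term 1 equals N ^ 0.
    full-value : ∀ j k → k ℕ.< c → ∃[ n ] n ℕ.≤ N ℕ.^ k × full h j k ≡ + n
    full-value j zero    _   = 1 , ℕ.≤-refl , ≡.refl
    full-value j (suc k) k<c with n , n< , eq ← box j k (ℕ.<-trans ℕ.≤-refl k<c) = n , ℕ.<⇒≤ n< , eq
  act-inBox {h} i _ .InBox.at j k k<c | inj₁ ≡.refl | n , n< , eq | n′ , n′≤ , eq′ = n ℕ.+ n′ , ℕ.+-mono-<-≤ n< n′≤ ,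
    ≡.cong₂ ℤ._+_ eq (≡.trans (≡.cong₂ ℤ._*_ (coef-same i true) eq′) (ℤ.*-identityˡ (+ n′)))
  act-inBox {h} i _ .InBox.at j k k<c | inj₂ ≡.refl | n , n< , eq | _ = n , ℕ.≤-trans n< (ℕ.m≤m+n _ _) ,
    ≡.trans (≡.trans (≡.cong (λ a → h j k ℤ.+ a ℤ.* full h (other j) k) (coef-other i true)) (ℤ.+-identityʳ _)) eq

  volume-ratio : ∀ c {b b⁺} → (∀ k → b⁺ k ℕ.* N ≡ b k ℕ.* suc N) →
    volume b⁺ c ℕ.* N ℕ.^ (c ℕ.+ c) ≡ volume b c ℕ.* suc N ℕ.^ (c ℕ.+ c)
  volume-ratio zero eq = ≡.refl
  volume-ratio (suc c) {b} {b⁺} eq rewrite ℕ.+-suc c c = begin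
    b⁺ 0 ℕ.* (b⁺ 0 ℕ.* V⁺) ℕ.* (N ℕ.* (N ℕ.* P))
      ≡⟨ solve 4 (λ b v n p → b :* (b :* v) :* (n :* (n :* p)) := b :* n :* (b :* n) :* (v :* p)) ≡.refl (b⁺ 0) V⁺ N P ⟩
    b⁺ 0 ℕ.* N ℕ.* (b⁺ 0 ℕ.* N) ℕ.* (V⁺ ℕ.* P)
      ≡⟨ ≡.cong₂ (λ x y → x ℕ.* x ℕ.* y) (eq 0) (volume-ratio c (eq ∘ suc)) ⟩
    b 0 ℕ.* suc N ℕ.* (b 0 ℕ.* suc N) ℕ.* (V ℕ.* Q)
      ≡⟨ solve 4 (λ b v n p → b :* n :* (b :* n) :* (v :* p) := b :* (b :* v) :* (n :* (n :* p))) ≡.refl (b 0) V (suc N) Q ⟩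
    b 0 ℕ.* (b 0 ℕ.* V) ℕ.* (suc N ℕ.* (suc N ℕ.* Q)) ∎
    where
    open ≡.≡-Reasoning
    open ℕSolver
    V⁺ = volume (b⁺ ∘ suc) c
    V = volume (b ∘ suc) c
    P = N ℕ.^ (c ℕ.+ c)
    Q = suc N ℕ.^ (c ℕ.+ c)

  volume-positive : ∀ c b → (∀ k → 0 ℕ.< b k) → 0 ℕ.< volume b c
  volume-positive zero    b 0<b = s≤s z≤n
  volume-positive (suc c) b 0<b = ℕ.*-mono-< (0<b 0) (ℕ.*-mono-< (0<b 0) (volume-positive c (b ∘ suc) (0<b ∘ suc)))

  size size⁺ : ℕ
  size  = volume inner c
  size⁺ = volume outer c

  small-boundary : d ℕ.* size⁺ ℕ.< suc d ℕ.* size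
  small-boundary = ℕ.*-cancelʳ-< (N ℕ.^ m ℕ.* e) (d ℕ.* size⁺) (suc d ℕ.* size) (begin-strict
    d ℕ.* size⁺ ℕ.* (N ℕ.^ m ℕ.* e)
      ≡⟨ solve 4 (λ d s p e → d :* s :* (p :* e) := d :* (s :* p) :* e) ≡.refl d size⁺ (N ℕ.^ m) e ⟩
    d ℕ.* (size⁺ ℕ.* N ℕ.^ m) ℕ.* e
      ≡⟨ ≡.cong (λ x → d ℕ.* x ℕ.* e) (volume-ratio c outer-inner) ⟩
    d ℕ.* (size ℕ.* suc N ℕ.^ m) ℕ.* e
      ≡⟨ solve 4 (λ d s p e → d :* (s :* p) :* e := d :* s :* (p :* e)) ≡.refl d size (suc N ℕ.^ m) e ⟩
    d ℕ.* size ℕ.* (suc N ℕ.^ m ℕ.* e)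
      ≤⟨ ℕ.*-monoʳ-≤ (d ℕ.* size) (bernoulli N m e e+m≡1+N) ⟩
    d ℕ.* size ℕ.* (suc N ℕ.* N ℕ.^ m)
      ≡⟨ solve 4 (λ d s n p → d :* s :* (n :* p) := d :* n :* (s :* p)) ≡.refl d size (suc N) (N ℕ.^ m) ⟩
    d ℕ.* suc N ℕ.* (size ℕ.* N ℕ.^ m)
      <⟨ ℕ.*-monoˡ-< (size ℕ.* N ℕ.^ m) {{ℕ.>-nonZero (ℕ.*-mono-< size>0 (ℕ.m^n>0 N m))}} numbers ⟩
    suc d ℕ.* e ℕ.* (size ℕ.* N ℕ.^ m)
      ≡⟨ solve 4 (λ d s e p → d :* e :* (s :* p) := d :* s :* (p :* e)) ≡.refl (suc d) size e (N ℕ.^ m) ⟩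
    suc d ℕ.* size ℕ.* (N ℕ.^ m ℕ.* e) ∎)
    where
    open ℕ.≤-Reasoning
    open ℕSolver
    size>0 : 0 ℕ.< size
    size>0 = volume-positive c inner λ k → ℕ.m^n>0 N (suc k)
    outer-inner : ∀ k → outer k ℕ.* N ≡ inner k ℕ.* suc N
    outer-inner k = solve 2 (λ n p → (n :* p :+ p) :* n := n :* p :* (con 1 :+ n)) ≡.refl N (N ℕ.^ k)
    numbers : d ℕ.* suc N ℕ.< suc d ℕ.* e
    numbers = ≡.subst (d ℕ.* suc N ℕ.<_)
      (solve 2 (λ d m → con 2 :+ d :* (con 2 :+ (con 1 :+ d) :* m) := (con 1 :+ d) :* (con 2 :+ d :* m)) ≡.refl d m)
      (ℕ.m<n⇒m<1+n ℕ.≤-refl)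

  følnerSet : FølnerSet c d
  følnerSet = record
    { base           = point inner c
    ; base⁺          = point outer c
    ; base-injective = point-injective inner c
    ; base⊆base⁺     = λ i → point-covers outer c _ (inner⊆outer (point-inBox inner c i))
    ; act-base⊆base⁺ = λ g i → point-covers outer c _ (act-inBox g (point-inBox inner c i))
    ; small-boundary = small-boundary
    }

-- Counting with duplicate-free lists.

lookup-injective : ∀ {Item : Set} {xs : List Item} → Unique xs → ∀ i j → lookup xs i ≡ lookup xs j → i ≡ j
lookup-injective (x∉ ∷ u) zero    zero    eq = ≡.refl
lookup-injective (x∉ ∷ u) zero    (suc j) eq = contradiction eq (All.lookup x∉ (∈-lookup j))
lookup-injective (x∉ ∷ u) (suc i) zero    eq = contradiction (≡.sym eq) (All.lookup x∉ (∈-lookup i))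
lookup-injective (x∉ ∷ u) (suc i) (suc j) eq = ≡.cong suc (lookup-injective u i j eq)

unique-length : ∀ {Item : Set} {xs ys : List Item} → Unique xs → (∀ {x} → x ∈ xs → x ∈ ys) → length xs ℕ.≤ length ys
unique-length {xs = xs} {ys} u xs⊆ys = injective⇒≤ {f = position} λ {i} {j} eq →
  lookup-injective u i j (≡.trans (found i) (≡.trans (≡.cong (lookup ys) eq) (≡.sym (found j))))
  where
  position : Fin (length xs) → Fin (length ys)
  position i = Any.index (xs⊆ys (∈-lookup i))
  found : ∀ i → lookup xs i ≡ lookup ys (position i)
  found i = lookup-index (xs⊆ys (∈-lookup i))

count-filter : ∀ {Item : Set} {P : Pred Item 0ℓ} (P? : Decidable P) → ∀ {n} (v : Vec Item n) →
  Vec.count P? v ≡ length (filter P? (Vec.toList v))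
count-filter P? []      = ≡.refl
count-filter P? (x ∷ v) with does (P? x)
... | true  = ≡.cong suc (count-filter P? v)
... | false = count-filter P? v

toList-tabulate : ∀ {Item : Set} {n} (f : Fin n → Item) → Vec.toList (Vec.tabulate f) ≡ List.tabulate f
toList-tabulate {n = zero}  f = ≡.refl
toList-tabulate {n = suc n} f = ≡.cong (f zero ∷_) (toList-tabulate (f ∘ suc))

filter-split : ∀ {Item : Set} {P Q : Pred Item 0ℓ} (P? : Decidable P) (Q? : Decidable Q) (Q⊆P : Q ⊆ P) → ∀ xs →
  length (filter P? xs) ≡ length (filter Q? xs) ℕ.+ length (filter (¬? ∘ Q?) (filter P? xs))
filter-split P? Q? Q⊆P []       = ≡.refl
filter-split P? Q? Q⊆P (x ∷ xs) with P? x
... | no ¬px rewrite filter-reject Q? {xs = xs} (¬px ∘ Q⊆P) = filter-split P? Q? Q⊆P xs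
... | yes px with Q? x
... | yes qx = ≡.cong suc (filter-split P? Q? Q⊆P xs)
... | no ¬qx = ≡.trans (≡.cong suc (filter-split P? Q? Q⊆P xs)) (≡.sym (ℕ.+-suc _ _))

module Fibers {Item Key : Set} (_≟_ : DecidableEquality Key) (f : Item → Key) where

  fiber : List Item → Key → ℕ
  fiber xs r = length (filter (λ x → f x ≟ r) xs)

  total : ∀ {n} → List Item → Vec Key n → ℕ
  total xs v = Vec.sum (Vec.map (fiber xs) v)

  total-[] : ∀ {n} (v : Vec Key n) → total [] v ≡ 0
  total-[] []      = ≡.refl
  total-[] (r ∷ v) = total-[] v

  exchange : ∀ a b c → a ℕ.+ (b ℕ.+ c) ≡ b ℕ.+ (a ℕ.+ c)
  exchange = x∙yz≈y∙xz
    where open import Algebra.Properties.CommutativeSemigroup ℕ.+-commutativeSemigroup using (x∙yz≈y∙xz)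

  total-∷ : ∀ {n} x xs (v : Vec Key n) →
    total (x ∷ xs) v ≡ length (filter (f x ≟_) (Vec.toList v)) ℕ.+ total xs v
  total-∷ x xs []      = ≡.refl
  total-∷ x xs (r ∷ v) with does (f x ≟ r)
  ... | true  = ≡.cong suc (≡.trans (≡.cong (fiber xs r ℕ.+_) (total-∷ x xs v)) (exchange (fiber xs r) (length (filter (f x ≟_) (Vec.toList v))) (total xs v)))
  ... | false = ≡.trans (≡.cong (fiber xs r ℕ.+_) (total-∷ x xs v)) (exchange (fiber xs r) (length (filter (f x ≟_) (Vec.toList v))) (total xs v))

  length≤total : ∀ {n} (v : Vec Key n) → (∀ r → r ∈ Vec.toList v) → ∀ xs → length xs ℕ.≤ total xs v
  length≤total v all []       = z≤n
  length≤total v all (x ∷ xs) rewrite total-∷ x xs v =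
    ℕ.+-mono-≤ (filter-some (f x ≟_) (all (f x))) (length≤total v all xs)

  total≤length : ∀ {n} (v : Vec Key n) → Unique (Vec.toList v) → ∀ xs → total xs v ℕ.≤ length xs
  total≤length v u []       = ℕ.≤-reflexive (total-[] v)
  total≤length v u (x ∷ xs) rewrite total-∷ x xs v = ℕ.+-mono-≤ (at-most-once u) (total≤length v u xs)
    where
    at-most-once : ∀ {rs} → Unique rs → length (filter (f x ≟_) rs) ℕ.≤ 1
    at-most-once []       = z≤n
    at-most-once {r ∷ rs} (r∉ ∷ u) with f x ≟ r
    ... | no _       = at-most-once u
    ... | yes ≡.refl = s≤s (ℕ.≤-reflexive (≡.cong length (filter-none (f x ≟_) r∉)))

sum-mono : ∀ {Item : Set} {n} {f g : Item → ℕ} (v : Vec Item n) → (∀ x → f x ℕ.≤ g x) → Vec.sum (Vec.map f v) ℕ.≤ Vec.sum (Vec.map g v)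
sum-mono []      f≤g = z≤n
sum-mono (x ∷ v) f≤g = ℕ.+-mono-≤ (f≤g x) (sum-mono v f≤g)

invert : List Letter → List Letter
invert []      = []
invert (s ∷ r) = invert r ++ inv s ∷ []

inv-involutive : ∀ s → inv (inv s) ≡ s
inv-involutive (i , σ) = ≡.cong (i ,_) (not-involutive σ)

module Removal {Item : Set} (_≟_ : DecidableEquality Item) where

  remove : Item → List Item → List Item
  remove x = filter (¬? ∘ (_≟ x))

  remove-length : ∀ {xs} → Unique xs → ∀ x → length xs ℕ.≤ suc (length (remove x xs))
  remove-length []       x = z≤n
  remove-length {y ∷ xs} (y∉ ∷ u) x with y ≟ x
  ... | no _       = s≤s (remove-length u x)
  ... | yes ≡.refl = s≤s (ℕ.≤-reflexive (≡.cong length (≡.sym (filter-all (¬? ∘ (_≟ y)) (All.map (λ p q → p (≡.sym q)) y∉)))))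

-- Tree components and potentials on them.

-- Fewer edges than vertices force a tree component; on it the edge labels have a potential with values in words.
module Forests (c : ℕ) {V E : Set} (_≟_ : DecidableEquality V) (src dst : E → V) (label : E → Fin 2) where

  open Truncated c
  open Removal _≟_
  open import Data.List.Membership.DecPropositional _≟_ using (_∈?_)

  run-invert : ∀ r h → run r (run (invert r) h) ≃ h
  run-invert []      h = ≃-refl
  run-invert (s ∷ r) h = ≃-trans
    (λ j k _ → ≡.cong (λ h → run r (act s h) j k) (run-++ (invert r) (inv s ∷ []) h))
    (≃-trans (run-cong r (≡.subst (λ s′ → act s′ (act (inv s) h′) ≃ h′) (inv-involutive s) (act-inverse-≃ (inv s) h′)))
             (run-invert r h))
    where h′ = run (invert r) h

  -- Quantifying over all h makes this an identity between group elements; it therefore survives a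
  -- change of starting height, which is what merging two trees amounts to.
  Consistent : (V → List Letter) → E → Set
  Consistent φ e = ∀ h → act (label e , true) (run (φ (src e)) h) ≃ run (φ (dst e)) h

  -- The invariant of a union-find run in which `roots` keeps only classes that are still trees; the
  -- remaining classes carry no information. Each edge costs at most one root, which gives `enough`.
  record Forest (S : List V) (es : List E) : Set where
    field
      roots      : List V
      unique     : Unique roots
      roots⊆S    : ∀ {r} → r ∈ roots → r ∈ S
      class      : V → V
      class-root : ∀ {r} → r ∈ roots → class r ≡ r
      forward    : ∀ {e r} → e ∈ es → r ∈ roots → class (src e) ≡ r → class (dst e) ≡ r
      backward   : ∀ {e r} → e ∈ es → r ∈ roots → class (dst e) ≡ r → class (src e) ≡ r
      φ          : V → List Letter
      consistent : ∀ {e} → e ∈ es → class (src e) ∈ roots → Consistent φ e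
      enough     : length S ℕ.≤ length es ℕ.+ length roots

  module Extension {S es} (F : Forest S es) (e₀ : E) where

    open Forest F
    ca = class (src e₀)
    cb = class (dst e₀)

    ∈-remove : ∀ {r x} → r ∈ remove x roots → r ∈ roots × r ≢ x
    ∈-remove = ∈-filter⁻ (¬? ∘ (_≟ _))

    enough′ : ∀ x → length S ℕ.≤ length (e₀ ∷ es) ℕ.+ length (remove x roots)
    enough′ x = ℕ.≤-trans enough (ℕ.≤-trans (ℕ.+-monoʳ-≤ (length es) (remove-length unique x)) (ℕ.≤-reflexive (ℕ.+-suc _ _)))

    -- The new edge closes a cycle or leads into a class that has already been given up, so the
    -- class of its tail is given up as well.
    discard : (∀ {r} → r ∈ roots → r ≢ ca → cb ≢ r) → Forest S (e₀ ∷ es)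
    discard cb≢ = record
      { roots = remove ca roots ; unique = Unique.filter⁺ _ unique ; roots⊆S = roots⊆S ∘ proj₁ ∘ ∈-remove
      ; class = class ; class-root = class-root ∘ proj₁ ∘ ∈-remove
      ; forward = λ { (here ≡.refl) r∈ eq → contradiction (≡.sym eq) (proj₂ (∈-remove r∈))
                    ; (there e∈) r∈ → forward e∈ (proj₁ (∈-remove r∈)) }
      ; backward = λ { (here ≡.refl) r∈ eq → contradiction eq (cb≢ (proj₁ (∈-remove r∈)) (proj₂ (∈-remove r∈)))
                     ; (there e∈) r∈ → backward e∈ (proj₁ (∈-remove r∈)) }
      ; φ = φ
      ; consistent = λ { (here ≡.refl) r∈ → contradiction ≡.refl (proj₂ (∈-remove r∈))
                       ; (there e∈) r∈ → consistent e∈ (proj₁ (∈-remove r∈)) }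
      ; enough = enough′ ca
      }

    module Merge (cb∈ : cb ∈ roots) (ca≢cb : ca ≢ cb) where

      class′ : V → V
      class′ v with class v ≟ cb
      ... | yes _ = ca
      ... | no _  = class v

      -- Words act from the left end of the list on, so prefixing a word to a potential is a right
      -- translation in the group. It preserves consistency inside the class of the head, and this
      -- particular prefix makes `e₀` consistent too.
      shift : List Letter
      shift = φ (src e₀) ++ (label e₀ , true) ∷ invert (φ (dst e₀))

      φ′ : V → List Letter
      φ′ v with class v ≟ cb
      ... | yes _ = shift ++ φ v
      ... | no _  = φ v

      class′-yes : ∀ {v} → class v ≡ cb → class′ v ≡ ca
      class′-yes {v} eq with class v ≟ cb
      ... | yes _ = ≡.refl
      ... | no ¬p = contradiction eq ¬p

      class′-no : ∀ {v} → class v ≢ cb → class′ v ≡ class v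
      class′-no {v} ¬eq with class v ≟ cb
      ... | yes p = contradiction p ¬eq
      ... | no _  = ≡.refl

      φ′-yes : ∀ {v} → class v ≡ cb → φ′ v ≡ shift ++ φ v
      φ′-yes {v} eq with class v ≟ cb
      ... | yes _ = ≡.refl
      ... | no ¬p = contradiction eq ¬p

      φ′-no : ∀ {v} → class v ≢ cb → φ′ v ≡ φ v
      φ′-no {v} ¬eq with class v ≟ cb
      ... | yes p = contradiction p ¬eq
      ... | no _  = ≡.refl

      move : ∀ {r} {x y : V} → r ∈ remove cb roots → (∀ {r} → r ∈ roots → class x ≡ r → class y ≡ r) →
        class′ x ≡ r → class′ y ≡ r
      move {x = x} {y} r∈ step eq with class x ≟ cb
      ... | yes p = ≡.trans (class′-yes (step cb∈ p)) eq
      ... | no _  = ≡.trans (class′-no (λ q → proj₂ (∈-remove r∈) (≡.trans (≡.sym cy) q))) cy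
        where cy = step (proj₁ (∈-remove r∈)) eq

      consistent-old : ∀ {e} → e ∈ es → class′ (src e) ∈ remove cb roots → Consistent φ′ e
      consistent-old {e} e∈ r∈ h with class (src e) ≟ cb
      ... | yes p rewrite φ′-yes (forward e∈ cb∈ p) | run-++ shift (φ (src e)) h | run-++ shift (φ (dst e)) h =
        consistent e∈ (≡.subst (_∈ roots) (≡.sym p) cb∈) (run shift h)
      ... | no _ rewrite φ′-no {dst e} (λ q → proj₂ (∈-remove r∈)
                           (≡.trans (≡.sym (forward e∈ (proj₁ (∈-remove r∈)) ≡.refl)) q)) =
        consistent e∈ (proj₁ (∈-remove r∈)) h

      consistent-new : Consistent φ′ e₀
      consistent-new h rewrite φ′-no ca≢cb | φ′-yes {dst e₀} ≡.refl | run-++ shift (φ (dst e₀)) h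
                             | run-++ (φ (src e₀)) ((label e₀ , true) ∷ invert (φ (dst e₀))) h =
        ≃-sym (run-invert (φ (dst e₀)) _)

      merged : Forest S (e₀ ∷ es)
      merged = record
        { roots = remove cb roots ; unique = Unique.filter⁺ _ unique ; roots⊆S = roots⊆S ∘ proj₁ ∘ ∈-remove
        ; class = class′
        ; class-root = λ r∈ → let r∈roots , r≢cb = ∈-remove r∈ ; eq = class-root r∈roots in
            ≡.trans (class′-no λ p → r≢cb (≡.trans (≡.sym eq) p)) eq
        ; forward = λ { (here ≡.refl) r∈ eq → ≡.trans (class′-yes ≡.refl) (≡.trans (≡.sym (class′-no ca≢cb)) eq)
                      ; {e} (there e∈) r∈ → move {x = src e} {dst e} r∈ (forward e∈) }
        ; backward = λ { (here ≡.refl) r∈ eq → ≡.trans (class′-no ca≢cb) (≡.trans (≡.sym (class′-yes ≡.refl)) eq)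
                       ; {e} (there e∈) r∈ → move {x = dst e} {src e} r∈ (backward e∈) }
        ; φ = φ′
        ; consistent = λ { (here ≡.refl) _ → consistent-new ; (there e∈) r∈ → consistent-old e∈ r∈ }
        ; enough = enough′ cb
        }

    extend : Forest S (e₀ ∷ es)
    extend with cb ∈? roots | ca ≟ cb
    -- This also covers a tail whose class is no root: the tree at the head is then absorbed by a
    -- class without a valid potential.
    ... | yes cb∈ | no ca≢cb = Merge.merged cb∈ ca≢cb
    ... | no cb∉  | _        = discard λ r∈ _ eq → cb∉ (≡.subst (_∈ roots) (≡.sym eq) r∈)
    ... | yes _   | yes eq   = discard λ _ r≢ca eq′ → r≢ca (≡.trans (≡.sym eq′) (≡.sym eq))

  forest : ∀ {S} → Unique S → ∀ es → Forest S es
  forest {S} u [] = record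
    { roots = S ; unique = u ; roots⊆S = id ; class = id ; class-root = λ _ → ≡.refl
    ; forward = λ () ; backward = λ () ; φ = λ _ → [] ; consistent = λ () ; enough = ℕ.≤-refl }
  forest u (e ∷ es) = Extension.extend (forest u es) e

  record Tree (S : List V) (es : List E) : Set₁ where
    field
      Member     : Pred V 0ℓ
      inhabited  : ∃[ v ] v ∈ S × Member v
      forward    : ∀ {e} → e ∈ es → Member (src e) → Member (dst e)
      backward   : ∀ {e} → e ∈ es → Member (dst e) → Member (src e)
      φ          : V → List Letter
      consistent : ∀ {e} → e ∈ es → Member (src e) → Consistent φ e

  tree : ∀ {S} → Unique S → ∀ es → length es ℕ.< length S → Tree S es
  tree {S} u es es<S with forest u es
  ... | record { roots = [] ; enough = enough } =
    contradiction (ℕ.≤-trans enough (ℕ.≤-reflexive (ℕ.+-identityʳ _))) (ℕ.<⇒≱ es<S)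
  ... | record { roots = r ∷ rs ; roots⊆S = roots⊆S ; class = class ; class-root = class-root
               ; forward = forward ; backward = backward ; φ = φ ; consistent = consistent } = record
    { Member     = λ v → class v ≡ r
    ; inhabited  = r , roots⊆S (here ≡.refl) , class-root (here ≡.refl)
    ; forward    = λ e∈ → forward e∈ (here ≡.refl)
    ; backward   = λ e∈ → backward e∈ (here ≡.refl)
    ; φ          = φ
    ; consistent = λ e∈ eq → consistent e∈ (here eq)
    }

module _ {A : Set} {R : A → A → Set} where

  linked-take : ∀ n {xs} → Linked R xs → Linked R (take n xs)
  linked-take zero          _         = []
  linked-take (suc n)       []        = []
  linked-take (suc zero)    [-]       = [-]
  linked-take (suc (suc n)) [-]       = [-]
  linked-take (suc zero)    (p ∷ ps)  = [-]
  linked-take (suc (suc n)) (p ∷ ps)  = p ∷ linked-take (suc n) ps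

  linked-drop : ∀ n {xs} → Linked R xs → Linked R (drop n xs)
  linked-drop zero    ps       = ps
  linked-drop (suc n) []       = []
  linked-drop (suc zero)    [-] = []
  linked-drop (suc (suc n)) [-] = []
  linked-drop (suc n) (p ∷ ps) = linked-drop n ps

finite-unique : ∀ {A} (fin : Finite A) → Unique (Finite.elementList fin)
finite-unique fin = ≡.subst Unique (≡.sym (toList-tabulate at)) (Unique.tabulate⁺ λ eq →
  ≡.trans (≡.sym (Inverse.strictlyInverseˡ enum _)) (≡.trans (≡.cong (Inverse.to enum) eq) (Inverse.strictlyInverseˡ enum _)))
  where open Finite fin

module Extremal {A : Set} {_≺_ : A → A → Set} (≺-irrefl : ∀ {x} → ¬ x ≺ x) (≺-trans : ∀ {x y z} → x ≺ y → y ≺ z → x ≺ z)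
  (_≺?_ : ∀ x y → Dec (x ≺ y)) {p} {P : A → Set p} (P? : Decidable P) where

  Maximal : List A → A → Set p
  Maximal xs m = P m × (∀ {x} → x ∈ xs → P x → ¬ m ≺ x)

  maximal : ∀ xs → (∃[ m ] Maximal xs m) ⊎ (∀ {x} → x ∈ xs → ¬ P x)
  maximal []       = inj₂ λ ()
  maximal (x ∷ xs) with P? x | maximal xs
  ... | no ¬px | inj₂ none = inj₂ λ { (here ≡.refl) → ¬px ; (there y∈) → none y∈ }
  ... | yes px | inj₂ none = inj₁ (x , px , λ { (here ≡.refl) _ → ≺-irrefl ; (there y∈) py → contradiction py (none y∈) })
  ... | no ¬px | inj₁ (m , pm , max) = inj₁ (m , pm , λ { (here ≡.refl) px → contradiction px ¬px ; (there y∈) → max y∈ })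
  ... | yes px | inj₁ (m , pm , max) with m ≺? x
  ... | yes m≺x = inj₁ (x , px , λ { (here ≡.refl) _ → ≺-irrefl ; (there y∈) py x≺y → max y∈ py (≺-trans m≺x x≺y) })
  ... | no ¬m≺x = inj₁ (m , pm , λ { (here ≡.refl) _ → ¬m≺x ; (there y∈) → max y∈ })

-- The number of possible minima is at most ρ(L).

module Walks (lem : ∀ (P : Set) → Dec P) (𝒢 : FiniteGroup) (g₁ g₂ : FiniteGroup.Carrier 𝒢) (L : Subgraph (cayley 𝒢 g₁ g₂)) where

  open FiniteGroup 𝒢
  open Graph (cayley 𝒢 g₁ g₂) using (E; tl; hd; E-finite)
  open Subgraph L
  private
    module V = Finite finite
    module E = Finite E-finite
    group : Group _ _
    group = record { isGroup = isGroup }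
  open GroupProperties group using (\\-leftDividesˡ)

  gen : Fin 2 → Carrier
  gen = generator 𝒢 g₁ g₂

  -- A good walk has one letter followed by `size` more: the positions after its first letter number
  -- `size` + 1, one more than the vertices. All words that must act nontrivially are factors of
  -- such walks.
  degree : ℕ
  degree = suc size

  open Truncated degree

  dest : Carrier → Letter → Carrier
  dest y (i , true)  = gen i ∙ y
  dest y (i , false) = gen i ⁻¹ ∙ y

  edge : Carrier → Letter → E
  edge y (i , true)  = y , i
  edge y (i , false) = gen i ⁻¹ ∙ y , i

  Walkable : Carrier → List Letter → Set
  Walkable y []      = ⊤
  Walkable y (s ∷ r) = T (inE (edge y s)) × Walkable (dest y s) r

  end : Carrier → List Letter → Carrier
  end y []      = y
  end y (s ∷ r) = end (dest y s) r

  Rising : List Letter → Set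
  Rising t = ∀ r s r′ → t ≡ r ++ s ∷ r′ → Positive (r ++ s ∷ [])

  GoodWalk : Carrier → Fin 2 → Set
  GoodWalk u i = ∃[ r ] length r ≡ size × Reduced ((i , true) ∷ r) × Walkable u ((i , true) ∷ r) × Rising ((i , true) ∷ r)

  -- The vertices of L that can be the minimum of a cycle.
  Q : Carrier → Set
  Q u = ∀ i → GoodWalk u i

  Q? : Decidable Q
  Q? u = lem (Q u)

  Qs : List Carrier
  Qs = filter Q? V.elementList

  Q-edge : ∀ {u} i → Q u → T (inE (u , i))
  Q-edge i q = let _ , _ , _ , (e∈L , _) , _ = q i in e∈L

  open Representatives (components L) using (rep; sound; complete)

  rep-edge : ∀ {e} → T (inE e) → rep (tl e) ≡ rep (hd e)
  rep-edge {e} e∈L = complete (Eq.return (e , e∈L , ≡.refl , ≡.refl))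

  Vertex : Carrier → Pred Carrier 0ℓ
  Vertex r v = T (inV v) × rep v ≡ r

  Vertex? : ∀ r → Decidable (Vertex r)
  Vertex? r v = T? (inV v) ×-dec (rep v V.≟ r)

  Edge : Carrier → Pred E 0ℓ
  Edge r e = T (inE e) × rep (tl e) ≡ r

  Edge? : ∀ r → Decidable (Edge r)
  Edge? r e = T? (inE e) ×-dec (rep (tl e) V.≟ r)

  Deleted : Pred E 0ℓ
  Deleted (u , i) = i ≡ zero × Q u

  module Component (r₀ : Carrier) where

    vertices : List Carrier
    vertices = filter (Vertex? r₀) V.elementList

    edges : List E
    edges = filter (Edge? r₀) E.elementList

    minima : List Carrier
    minima = filter (λ u → rep u V.≟ r₀) Qs

    Removed : Pred E 0ℓ
    Removed e = Edge r₀ e × Deleted e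

    Removed? : Decidable Removed
    Removed? e = lem (Removed e)

    remaining : List E
    remaining = filter (¬? ∘ Removed?) edges

    ∈-remaining : ∀ {e} → Edge r₀ e → ¬ Deleted e → e ∈ remaining
    ∈-remaining {e} edge ¬del = ∈-filter⁺ (¬? ∘ Removed?) (∈-filter⁺ (Edge? r₀) (E.∈-elementList e) edge) (¬del ∘ proj₂)

    open Forests degree V._≟_ tl hd proj₂

    module _ (t : Tree vertices remaining) {q : Carrier} (Qq : Q q) (rep-q : rep q ≡ r₀) where

      open Tree t

      Λ : Carrier → Height
      Λ v = run (φ v) 𝟙

      -- (u , true) and (u , false) record that the tree contains the tail,
      -- respectively the head, of the deleted edge at u.
      Candidate : Carrier × Bool → Set
      Candidate (u , true)  = Q u × rep u ≡ r₀ × Member u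
      Candidate (u , false) = Q u × rep u ≡ r₀ × Member (gen zero ∙ u)

      -- The height of u as seen from the tree. When it is the head that lies there, u is reached by
      -- going down the deleted edge; if both ends lie in the tree, the two levels of u may differ.
      level : Carrier × Bool → Height
      level (u , true)  = Λ u
      level (u , false) = act (zero , false) (Λ (gen zero ∙ u))

      -- A path in L towards q stays in the tree until it meets a deleted edge, one end of which is
      -- then in the tree. If it meets none it arrives at q, the tail of a deleted edge.
      reach : ∀ z → Member z → rep z ≡ r₀ → Connected L z q → ∃ Candidate
      reach z z∈ rep-z ε = (z , true) , Qq , rep-z , z∈
      reach z z∈ rep-z (fwd (e@(u , i) , e∈L , ≡.refl , ≡.refl) ◅ path) with lem (Deleted e)
      ... | yes (≡.refl , Qu) = (u , true) , Qu , rep-z , z∈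
      ... | no ¬del = reach (hd e) (forward (∈-remaining (e∈L , rep-z) ¬del) z∈) (≡.trans (≡.sym (rep-edge e∈L)) rep-z) path
      reach z z∈ rep-z (bwd (e@(u , i) , e∈L , ≡.refl , ≡.refl) ◅ path) with lem (Deleted e)
      ... | yes (≡.refl , Qu) = (u , false) , Qu , ≡.trans (rep-edge e∈L) rep-z , z∈
      ... | no ¬del = reach u (backward (∈-remaining (e∈L , rep-u) ¬del) z∈) rep-u path
        where rep-u = ≡.trans (rep-edge e∈L) rep-z

      module _ (ℓ : Height) (highest : ∀ x → Candidate x → ¬ ℓ ⊏ level x) where

        record At (z : Carrier) (h : Height) : Set where
          field
            member : Member z
            rep-z  : rep z ≡ r₀
            height : h ≃ Λ z

        -- Crossing a deleted edge would exhibit a candidate above ℓ: forwards its tail at level h,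
        -- backwards its head, whose candidate has level `act s h`. This is why both heights are
        -- required to exceed ℓ.
        step : ∀ z h s → At z h → ℓ ⊏ h → ℓ ⊏ act s h → T (inE (edge z s)) → At (dest z s) (act s h)
        step z h (j , true) at ℓ⊏h _ e∈L with lem (Deleted (z , j))
        ... | yes (≡.refl , Qz) = contradiction (⊏-respʳ-≃ height ℓ⊏h) (highest (z , true) (Qz , rep-z , member))
          where open At at
        ... | no ¬del = record
          { member = forward e∈ member
          ; rep-z  = ≡.trans (≡.sym (rep-edge e∈L)) rep-z
          ; height = ≃-trans (act-cong (j , true) height) (consistent e∈ member 𝟙)
          }
          where
          open At at
          e∈ = ∈-remaining (e∈L , rep-z) ¬del
        step z h (j , false) at _ ℓ⊏h e∈L with lem (Deleted (gen j ⁻¹ ∙ z , j))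
        ... | yes (≡.refl , Qu) = contradiction
              (⊏-respʳ-≃ (≡.subst (λ y → act (zero , false) h ≃ act (zero , false) (Λ y)) (≡.sym return) (act-cong (zero , false) height)) ℓ⊏h)
              (highest (gen zero ⁻¹ ∙ z , false) (Qu , ≡.trans (rep-edge e∈L) (≡.trans (≡.cong rep return) rep-z) , ≡.subst Member (≡.sym return) member))
          where
          open At at
          return : gen zero ∙ (gen zero ⁻¹ ∙ z) ≡ z
          return = \\-leftDividesˡ (gen zero) z
        ... | no ¬del = record
          { member = u∈
          ; rep-z  = rep-u
          ; height = ≃-trans (act-cong (j , false) (≃-trans height (≡.subst (λ y → Λ y ≃ act (j , true) (Λ u)) return (≃-sym (consistent e∈ u∈ 𝟙)))))
                       (act-inverse-≃ (j , true) (Λ u))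
          }
          where
          open At at
          u = gen j ⁻¹ ∙ z
          return : gen j ∙ u ≡ z
          return = \\-leftDividesˡ (gen j) z
          rep-u : rep u ≡ r₀
          rep-u = ≡.trans (rep-edge e∈L) (≡.trans (≡.cong rep return) rep-z)
          e∈ = ∈-remaining (e∈L , rep-u) ¬del
          u∈ : Member u
          u∈ = backward e∈ (≡.subst Member (≡.sym return) member)

        stay : ∀ {t} → Rising t → ∀ k pre rest {z} → t ≡ pre ++ rest → Walkable z rest →
          At z (run pre ℓ) → ℓ ⊏ run pre ℓ → At (end z (take k rest)) (run (take k rest) (run pre ℓ))
        stay rising zero    pre rest       eq walk at _ = at
        stay rising (suc k) pre []         eq walk at _ = at
        stay rising (suc k) pre (s ∷ rest) {z} eq (e∈L , walk) at ℓ⊏ =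
          ≡.subst (λ h → At (end z (s ∷ take k rest)) (run (take k rest) h)) (run-++ pre (s ∷ []) ℓ)
            (stay rising k (pre ++ s ∷ []) rest (≡.trans eq (≡.sym (++-assoc pre (s ∷ []) rest))) walk
              (≡.subst (At (dest z s)) (≡.sym (run-++ pre (s ∷ []) ℓ)) (step z (run pre ℓ) s at ℓ⊏ ℓ⊏next e∈L))
              (rising pre s rest eq ℓ))
          where
          ℓ⊏next : ℓ ⊏ act s (run pre ℓ)
          ℓ⊏next = ≡.subst (ℓ ⊏_) (run-++ pre (s ∷ []) ℓ) (rising pre s rest eq ℓ)

        -- By the pigeonhole principle the walk returns to a vertex. Being confined to the tree, it
        -- has height Λ there both times, so the nonempty reduced factor in between fixes a height,
        -- against `reduced-moves`.
        no-walk : ∀ i r z → length r ≡ size → Reduced ((i , true) ∷ r) → Walkable z r → Rising ((i , true) ∷ r) →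
          ¬ At z (act (i , true) ℓ)
        no-walk i r z len red walk rising at = collide (pigeonhole ℕ.≤-refl λ k → Inverse.to V.enum (visited (toℕ k)))
          where
          visited : ℕ → Carrier
          visited k = end z (take k r)
          stays : ∀ k → At (visited k) (run (take k r) (act (i , true) ℓ))
          stays k = stay rising k ((i , true) ∷ []) r ≡.refl walk at (act-⊏ (s≤s z≤n) i ℓ)
          collide : ¬ (∃₂ λ (a b : Fin (suc size)) → toℕ a ℕ.< toℕ b × Inverse.to V.enum (visited (toℕ a)) ≡ Inverse.to V.enum (visited (toℕ b)))
          collide (a , b , a<b , eq) = loop (drop (toℕ a) (take (toℕ b) r)) ≡.refl
            where
            h = run (take (toℕ a) r) (act (i , true) ℓ)
            same : visited (toℕ a) ≡ visited (toℕ b)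
            same = ≡.trans (≡.sym (Inverse.strictlyInverseʳ V.enum _)) (≡.trans (≡.cong V.at eq) (Inverse.strictlyInverseʳ V.enum _))
            length-prefix : length (take (toℕ b) r) ≡ toℕ b
            length-prefix = ≡.trans (length-take (toℕ b) r) (ℕ.m≤n⇒m⊓n≡m (≡.subst (toℕ b ℕ.≤_) (≡.sym len) (ℕ.≤-pred (toℕ<n b))))
            split : take (toℕ a) r ++ drop (toℕ a) (take (toℕ b) r) ≡ take (toℕ b) r
            split = ≡.trans (≡.cong (_++ drop (toℕ a) (take (toℕ b) r))
              (≡.trans (≡.cong (λ k → take k r) (≡.sym (ℕ.m≤n⇒m⊓n≡m (ℕ.<⇒≤ a<b)))) (≡.sym (take-take (toℕ a) (toℕ b) r))))
              (take++drop≡id (toℕ a) (take (toℕ b) r))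
            fixed : run (drop (toℕ a) (take (toℕ b) r)) h ≃ h
            fixed = ≡.subst (_≃ h) (≡.trans (≡.cong (λ t → run t (act (i , true) ℓ)) (≡.sym split)) (run-++ (take (toℕ a) r) _ _))
              (≃-trans (At.height (stays (toℕ b))) (≡.subst (λ y → Λ y ≃ h) same (≃-sym (At.height (stays (toℕ a))))))
            loop : ∀ w → w ≢ drop (toℕ a) (take (toℕ b) r)
            loop [] eq′ = ℕ.<⇒≱ (ℕ.m<n⇒0<n∸m a<b) (ℕ.≤-reflexive (≡.trans (≡.trans (≡.cong (_∸ toℕ a) (≡.sym length-prefix)) (≡.sym (length-drop (toℕ a) (take (toℕ b) r)))) (≡.cong length (≡.sym eq′))))
            loop (s ∷ w) eq′ = reduced-moves s w
              (≡.subst Reduced (≡.sym eq′) (linked-drop (toℕ a) (linked-take (toℕ b) (Linked.tail red))))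
              (≡.subst (λ t → length t ℕ.≤ degree) (≡.sym eq′) (ℕ.≤-trans (ℕ.≤-reflexive (length-drop (toℕ a) (take (toℕ b) r)))
                (ℕ.≤-trans (ℕ.m∸n≤m _ (toℕ a)) (ℕ.≤-trans (ℕ.≤-reflexive length-prefix) (ℕ.<⇒≤ (toℕ<n b))))))
              h (≡.subst (λ t → run t h ≃ h) (≡.sym eq′) fixed)

      candidates : List (Carrier × Bool)
      candidates = List.cartesianProduct V.elementList (true ∷ false ∷ [])

      ∈-candidates : ∀ x → x ∈ candidates
      ∈-candidates (u , true)  = ∈-cartesianProduct⁺ (V.∈-elementList u) (here ≡.refl)
      ∈-candidates (u , false) = ∈-cartesianProduct⁺ (V.∈-elementList u) (there (here ≡.refl))

      candidate : ∃ Candidate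
      candidate with inhabited
      ... | v , v∈S , v∈T with _ , _ , rep-v ← ∈-filter⁻ (Vertex? r₀) {xs = V.elementList} v∈S =
        reach v v∈T rep-v (Eq.transitive _ (Eq.symmetric _ (sound v))
          (≡.subst (λ r → Connected L r q) (≡.trans rep-q (≡.sym rep-v)) (sound q)))

      -- If the tail u lies in the tree, the walk leaves by the edge of the other colour, which is
      -- not deleted. If the head does, the walk starts across the deleted edge and lands in the
      -- tree. Either way its second position is in the tree, above the highest level.
      no-highest : ∀ x → Candidate x → (∀ y → Candidate y → ¬ level x ⊏ level y) → ⊥
      no-highest (u , true) (Qu , rep-u , u∈) max
        with r , len , red , (e∈L , walk) , rising ← Qu (suc zero) =
          no-walk _ max (suc zero) r _ len red walk rising (record
            { member = forward (∈-remaining (e∈L , rep-u) λ ()) u∈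
            ; rep-z  = ≡.trans (≡.sym (rep-edge e∈L)) rep-u
            ; height = consistent (∈-remaining (e∈L , rep-u) λ ()) u∈ 𝟙
            })
      no-highest (u , false) (Qu , rep-u , z∈) max
        with r , len , red , (e∈L , walk) , rising ← Qu zero =
          no-walk _ max zero r _ len red walk rising (record
            { member = z∈
            ; rep-z  = ≡.trans (≡.sym (rep-edge e∈L)) rep-u
            ; height = act-inverse-≃ (zero , false) (Λ (gen zero ∙ u))
            })

      no-tree : ⊥
      no-tree with Extremal.maximal {_≺_ = λ x y → level x ⊏ level y} (⊏-irrefl ≃-refl) ⊏-trans (λ x y → ⊏-dec (level x) (level y)) (lem ∘ Candidate) candidates
      ... | inj₁ (x , Cx , max) = no-highest x Cx (λ y → max (∈-candidates y))
      ... | inj₂ none           = none (∈-candidates _) (proj₂ candidate)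

    Qs-unique : Unique Qs
    Qs-unique = Unique.filter⁺ Q? (finite-unique finite)

    minima-bound : ∀ {q} → Q q → rep q ≡ r₀ → length minima ℕ.+ length vertices ℕ.≤ length edges
    minima-bound Qq rep-q = ≡.subst (length minima ℕ.+ length vertices ℕ.≤_)
      (≡.sym (filter-split (Edge? r₀) Removed? proj₁ E.elementList)) (ℕ.+-mono-≤ minima≤ vertices≤)
      where
      minima≤ : length minima ℕ.≤ length (filter Removed? E.elementList)
      minima≤ = ≡.subst (ℕ._≤ length (filter Removed? E.elementList)) (length-map (_, zero) minima)
        (unique-length (Unique.map⁺ ,-injectiveˡ (Unique.filter⁺ _ Qs-unique)) removed)
        where
        removed : ∀ {e} → e ∈ List.map (_, zero) minima → e ∈ filter Removed? E.elementList
        removed e∈ with u , u∈ , ≡.refl ← ∈-map⁻ (_, zero) e∈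
                   with u∈Qs , rep-u ← ∈-filter⁻ (λ u → rep u V.≟ r₀) {xs = Qs} u∈
                   with Qu ← proj₂ (∈-filter⁻ Q? {xs = V.elementList} u∈Qs) =
          ∈-filter⁺ Removed? (E.∈-elementList _) ((Q-edge zero Qu , rep-u) , ≡.refl , Qu)
      vertices≤ : length vertices ℕ.≤ length remaining
      vertices≤ = ℕ.≮⇒≥ λ fewer → no-tree (tree (Unique.filter⁺ _ (finite-unique finite)) remaining fewer) Qq rep-q

    -- A component that contains no vertex of Q may well be a tree; there the claim is 0 ≤ a
    -- truncated difference. Any other component provides the q required by `minima-bound`.
    minima≤excess : length minima ℕ.≤ edgesOf L r₀ ∸ verticesOf L r₀
    minima≤excess rewrite count-filter (Edge? r₀) E.elements | count-filter (Vertex? r₀) V.elements = by-cases minima ≡.refl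
      where
      by-cases : ∀ xs → xs ≡ minima → length minima ℕ.≤ length edges ∸ length vertices
      by-cases []       eq = ≡.subst (λ xs → length xs ℕ.≤ length edges ∸ length vertices) eq z≤n
      by-cases (q ∷ xs) eq with q∈Qs , rep-q ← ∈-filter⁻ (λ u → rep u V.≟ r₀) {xs = Qs} (≡.subst (q ∈_) eq (here ≡.refl)) =
        ℕ.m+n≤o⇒m≤o∸n (length minima) (minima-bound (proj₂ (∈-filter⁻ Q? {xs = V.elementList} q∈Qs)) rep-q)

    -- At most one edge of the other colour starts at each vertex.
    excess≤colour : ∀ i → edgesOf L r₀ ∸ verticesOf L r₀ ℕ.≤
      length (filter (λ v → rep v V.≟ r₀) (filter (λ v → T? (inE (v , i))) V.elementList))
    excess≤colour i rewrite count-filter (Edge? r₀) E.elements | count-filter (Vertex? r₀) V.elements =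
      ℕ.m≤n+o⇒m∸n≤o (length edges) (length vertices)
        (≡.subst (ℕ._≤ length vertices ℕ.+ length tails) (≡.trans (ℕ.+-comm (length (filter (¬? ∘ Coloured?) edges)) _) (≡.sym (filter-split (Edge? r₀) Coloured? proj₁ E.elementList)))
          (ℕ.+-mono-≤ uncoloured≤ coloured≤))
      where
      tails : List Carrier
      tails = filter (λ v → rep v V.≟ r₀) (filter (λ v → T? (inE (v , i))) V.elementList)
      Coloured : Pred E 0ℓ
      Coloured e = Edge r₀ e × proj₂ e ≡ i
      Coloured? : Decidable Coloured
      Coloured? e = Edge? r₀ e ×-dec (proj₂ e ≟ᶠ i)
      coloured≤ : length (filter Coloured? E.elementList) ℕ.≤ length tails
      coloured≤ = ≡.subst (length (filter Coloured? E.elementList) ℕ.≤_) (length-map (_, i) tails)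
        (unique-length (Unique.filter⁺ _ (finite-unique E-finite)) λ e∈ → coloured (proj₂ (∈-filter⁻ Coloured? {xs = E.elementList} e∈)))
        where
        coloured : ∀ {e} → Coloured e → e ∈ List.map (_, i) tails
        coloured ((e∈L , rep-v) , ≡.refl) = ∈-map⁺ (_, i)
          (∈-filter⁺ (λ v → rep v V.≟ r₀) (∈-filter⁺ (λ v → T? (inE (v , i))) (V.∈-elementList _) e∈L) rep-v)
      uncoloured≤ : length (filter (¬? ∘ Coloured?) edges) ℕ.≤ length vertices
      uncoloured≤ = ≡.subst (length (filter (¬? ∘ Coloured?) edges) ℕ.≤_) (length-map (_, other i) vertices)
        (unique-length (Unique.filter⁺ _ (Unique.filter⁺ _ (finite-unique E-finite))) uncoloured)
        where
        uncoloured : ∀ {e} → e ∈ filter (¬? ∘ Coloured?) edges → e ∈ List.map (_, other i) vertices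
        uncoloured {v , j} e∈ with e∈edges , ¬coloured ← ∈-filter⁻ (¬? ∘ Coloured?) {xs = edges} e∈
                              with _ , e∈L , rep-v ← ∈-filter⁻ (Edge? r₀) {xs = E.elementList} e∈edges
                              with same-or-other i j
        ... | inj₁ ≡.refl = contradiction ((e∈L , rep-v) , ≡.refl) ¬coloured
        ... | inj₂ ≡.refl = ∈-map⁺ (_, other i) (∈-filter⁺ (Vertex? r₀) (V.∈-elementList v) (tl-in e∈L , rep-v))

  length-Qs : length Qs ℕ.≤ ρ L
  length-Qs = ℕ.≤-trans (Fibers.length≤total V._≟_ rep V.elements V.∈-elementList Qs)
    (sum-mono V.elements Component.minima≤excess)

  -- For L-surjectivity: an edge of colour i lies in as many translates of L as L has edges of that
  -- colour.
  ρ≤colour : ∀ i → ρ L ℕ.≤ length (filter (λ v → T? (inE (v , i))) V.elementList)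
  ρ≤colour i = ℕ.≤-trans (sum-mono V.elements (λ r → Component.excess≤colour r i))
    (Fibers.total≤length V._≟_ rep V.elements (finite-unique finite) (filter (λ v → T? (inE (v , i))) V.elementList))

-- Flows on the cover by heights, and the bound on the excess.

linked-++⁻ˡ : ∀ {A : Set} {R : A → A → Set} xs {ys} → Linked R (xs ++ ys) → Linked R xs
linked-++⁻ˡ []           _        = []
linked-++⁻ˡ (x ∷ [])     _        = [-]
linked-++⁻ˡ (x ∷ y ∷ xs) (p ∷ ps) = p ∷ linked-++⁻ˡ (y ∷ xs) ps

module Kernel {c ℓ : Level} (𝔽 : DiscreteField c ℓ) (lem : ∀ (P : Set) → Dec P)
  (𝒢 : FiniteGroup) (g₁ g₂ : FiniteGroup.Carrier 𝒢) (L : Subgraph (cayley 𝒢 g₁ g₂)) where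

  open DiscreteField 𝔽
  open CommutativeRing commutativeRing hiding (zero) renaming (Carrier to F)
  open LinearAlgebra 𝔽
  open MonoidSum +-monoid using (sum; sum-cong-≋)
  open CommutativeMonoidSum +-commutativeMonoid using (∑-distrib-+; ∑-comm)
  open SemiringSum semiring using (*-distribˡ-sum; *-distribʳ-sum)
  open Walks lem 𝒢 g₁ g₂ L
  open FiniteGroup 𝒢 renaming (Carrier to G; assoc to ∙-assoc; size to order)
  open Graph (cayley 𝒢 g₁ g₂) using (E)
  open Subgraph L using (inE)
  open Translates 𝒢 g₁ g₂ L using (𝒢E)
  open Truncated degree
  private
    group : Group _ _
    group = record { isGroup = isGroup }
  open GroupProperties group using (\\-leftDividesˡ; \\-leftDividesʳ; //-rightDividesˡ; ∙-cancelʳ; ⁻¹-injective)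

  open import Relation.Binary.Reasoning.Setoid setoid

  sum-bilinear : ∀ {m n} (c : Vector F m) (A : Fin m → Fin n → F) (y : Vector F n) →
    sum (λ i → c i * sum (λ l → A i l * y l)) ≈ sum (λ l → sum (λ i → c i * A i l) * y l)
  sum-bilinear {m} {n} c A y = begin
    sum (λ i → c i * sum (λ l → A i l * y l))   ≈⟨ sum-cong-≋ {m} (λ i → *-distribˡ-sum {n} (c i) _) ⟩
    sum (λ i → sum (λ l → c i * (A i l * y l))) ≈⟨ sum-cong-≋ {m} (λ i → sum-cong-≋ {n} λ l → *-assoc _ _ _) ⟨
    sum (λ i → sum (λ l → c i * A i l * y l))   ≈⟨ ∑-comm {m} {n} _ ⟩
    sum (λ l → sum (λ i → c i * A i l * y l))   ≈⟨ sum-cong-≋ {n} (λ l → *-distribʳ-sum {m} (y l) _) ⟨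
    sum (λ l → sum (λ i → c i * A i l) * y l)   ∎

  indicator : ∀ {p} {P : Set p} → Dec P → F
  indicator (yes _) = 1#
  indicator (no _)  = 0#

  indicator-yes : ∀ {p} {P : Set p} (d : Dec P) → P → indicator d ≈ 1#
  indicator-yes (yes _) _ = refl
  indicator-yes (no ¬p) p = contradiction p ¬p

  indicator-no : ∀ {p} {P : Set p} (d : Dec P) → ¬ P → indicator d ≈ 0#
  indicator-no (yes p) ¬p = contradiction p ¬p
  indicator-no (no _)  _  = refl

  indicator-cong : ∀ {p q} {P : Set p} {Q : Set q} (d : Dec P) (d′ : Dec Q) → (P → Q) → (Q → P) → indicator d ≈ indicator d′
  indicator-cong (yes p) d′ f g = sym (indicator-yes d′ (f p))
  indicator-cong (no ¬p) d′ f g = sym (indicator-no d′ (¬p ∘ g))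

  -- Conservation cannot hold with a single nonzero term, so the support of a flow has no dead ends
  -- and a walk in it can always avoid turning back.
  balance : ∀ (f : Letter → F) → f (zero , true) + f (suc zero , true) ≈ f (zero , false) + f (suc zero , false) →
    ∀ t → f t ≉ 0# → ∃[ s ] s ≢ t × f s ≉ 0#
  balance f eq t ft≉0
    with zero-or-invertible (f (zero , true)) | zero-or-invertible (f (suc zero , true))
       | zero-or-invertible (f (zero , false)) | zero-or-invertible (f (suc zero , false))
  balance f eq (zero , true)      ft≉0 | _ | inj₂ (p , _) | _ | _ = _ , (λ ()) , p
  balance f eq (zero , true)      ft≉0 | _ | _ | inj₂ (p , _) | _ = _ , (λ ()) , p
  balance f eq (zero , true)      ft≉0 | _ | _ | _ | inj₂ (p , _) = _ , (λ ()) , p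
  balance f eq (suc zero , true)  ft≉0 | inj₂ (p , _) | _ | _ | _ = _ , (λ ()) , p
  balance f eq (suc zero , true)  ft≉0 | _ | _ | inj₂ (p , _) | _ = _ , (λ ()) , p
  balance f eq (suc zero , true)  ft≉0 | _ | _ | _ | inj₂ (p , _) = _ , (λ ()) , p
  balance f eq (zero , false)     ft≉0 | inj₂ (p , _) | _ | _ | _ = _ , (λ ()) , p
  balance f eq (zero , false)     ft≉0 | _ | inj₂ (p , _) | _ | _ = _ , (λ ()) , p
  balance f eq (zero , false)     ft≉0 | _ | _ | _ | inj₂ (p , _) = _ , (λ ()) , p
  balance f eq (suc zero , false) ft≉0 | inj₂ (p , _) | _ | _ | _ = _ , (λ ()) , p
  balance f eq (suc zero , false) ft≉0 | _ | inj₂ (p , _) | _ | _ = _ , (λ ()) , p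
  balance f eq (suc zero , false) ft≉0 | _ | _ | inj₂ (p , _) | _ = _ , (λ ()) , p
  balance f eq (zero , true)      ft≉0 | _ | inj₁ q | inj₁ r | inj₁ s = contradiction
    (trans (trans (sym (+-identityʳ _)) (+-congˡ (sym q))) (trans eq (trans (+-cong r s) (+-identityˡ 0#)))) ft≉0
  balance f eq (suc zero , true)  ft≉0 | inj₁ p | _ | inj₁ r | inj₁ s = contradiction
    (trans (trans (sym (+-identityˡ _)) (+-congʳ (sym p))) (trans eq (trans (+-cong r s) (+-identityˡ 0#)))) ft≉0
  balance f eq (zero , false)     ft≉0 | inj₁ p | inj₁ q | _ | inj₁ s = contradiction
    (trans (trans (sym (+-identityʳ _)) (+-congˡ (sym s))) (trans (sym eq) (trans (+-cong p q) (+-identityˡ 0#)))) ft≉0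
  balance f eq (suc zero , false) ft≉0 | inj₁ p | inj₁ q | inj₁ r | _ = contradiction
    (trans (trans (sym (+-identityˡ _)) (+-congʳ (sym r))) (trans (sym eq) (trans (+-cong p q) (+-identityˡ 0#)))) ft≉0

  ColumnsIndependent : ∀ {k} → (Fin k × G → F) → Set _
  ColumnsIndependent M = ∀ xs → Unique xs → length xs ℕ.≤ ρ L → ∀ (a : G → F) → (∀ x → x ∉ xs → a x ≈ 0#) →
    (∀ j → sum (λ i → a (at i) * M (j , at i)) ≈ 0#) → ∀ x → a x ≈ 0#

  -- β i and μ l are bases of Γₕₜ(U) and U; `tails` and `heads` express the boundary maps in these bases.
  record BoundaryMaps {k} (M : Fin k × G → F) (d d′ : ℕ) : Set (c Level.⊔ ℓ) where
    field
      β           : Fin d → E → G → F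
      μ           : Fin d′ → G → G → F
      tails       : Fin d → Fin d′ → F
      heads       : Fin 2 → Fin d → Fin d′ → F
      tails-eq    : ∀ i v x → β i (v , zero) x + β i (v , suc zero) x ≈ sum (λ l → tails i l * μ l v x)
      heads-eq    : ∀ g i v x → β i (v , g) x ≈ sum (λ l → heads g i l * μ l (gen g ∙ v) x)
      supported   : ∀ i e x → ¬ 𝒢E e x → β i e x ≈ 0#
      killed      : ∀ i e j → sum (λ x → β i e (at x) * M (j , at x)) ≈ 0#
      independent : ∀ (c : Vector F d) → (∀ e x → sum (λ i → c i * β i e x) ≈ 0#) → ∀ i → c i ≈ 0#

  module _ {k} {M : Fin k × G → F} (good : ColumnsIndependent M) {d d′} (maps : BoundaryMaps M d d′) (d′<d : d′ ℕ.< d)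
    (følnerSet : FølnerSet degree d′) where

    open BoundaryMaps maps
    open FølnerSet følnerSet renaming (size to s; size⁺ to s⁺)

    shifted : Fin s → Height → F
    shifted p w = indicator (≃-dec (base p) w)

    -- The coefficient of an unknown in coordinate l of the twisted boundary at height w. A lifted
    -- edge is indexed by the height of its tail, so the edges ending at w have tails at a different
    -- height for each colour; `heads` therefore separates the colours, while `tails` may add them
    -- up.
    entry : Height → Fin d′ → Fin s → Fin d → F
    entry w l p i = shifted p w * tails i l +
      -1# * (shifted p (act (zero , false) w) * heads zero i l + shifted p (act (suc zero , false) w) * heads (suc zero) i l)

    system : Fin (s⁺ ℕ.* d′) → Fin (s ℕ.* d) → F
    system jl pi = entry (base⁺ (proj₁ (remQuot {s⁺} d′ jl))) (proj₂ (remQuot {s⁺} d′ jl)) (proj₁ (remQuot {s} d pi)) (proj₂ (remQuot {s} d pi))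

    fewer-equations : s⁺ ℕ.* d′ ℕ.< s ℕ.* d
    fewer-equations = ≡.subst₂ ℕ._<_ (ℕ.*-comm d′ s⁺) (ℕ.*-comm d s) (ℕ.<-≤-trans small-boundary (ℕ.*-monoˡ-≤ s d′<d))

    solution = underdetermined (s⁺ ℕ.* d′) (s ℕ.* d) fewer-equations system

    X : Fin s → Fin d → F
    X p i = proj₁ solution (combine p i)

    C : Height → Fin d → F
    C w i = sum (λ p → shifted p w * X p i)

    C-cong : ∀ {w w′} → w ≃ w′ → ∀ i → C w i ≈ C w′ i
    C-cong w≃w′ i = sum-cong-≋ {s} λ p → *-congʳ (indicator-cong (≃-dec (base p) _) (≃-dec (base p) _)
      (λ b≃w → ≃-trans b≃w w≃w′) (λ b≃w′ → ≃-trans b≃w′ (≃-sym w≃w′)))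

    C-outside : ∀ {w} → (∀ p → ¬ base p ≃ w) → ∀ i → C w i ≈ 0#
    C-outside outside i = sum-zero {s} λ p → trans (*-congʳ (indicator-no (≃-dec (base p) _) (outside p))) (zeroˡ _)

    C-base : ∀ p i → C (base p) i ≈ X p i
    C-base p i = begin
      sum (λ p′ → shifted p′ (base p) * X p′ i) ≈⟨ sum-single {s} _ p (λ p′ p′≢p → trans (*-congʳ (indicator-no (≃-dec (base p′) (base p)) (p′≢p ∘ base-injective p′ p))) (zeroˡ _)) ⟩
      shifted p (base p) * X p i                ≈⟨ *-congʳ (indicator-yes (≃-dec (base p) (base p)) ≃-refl) ⟩
      1# * X p i                                ≈⟨ *-identityˡ _ ⟩
      X p i                                     ∎

    sum-C : ∀ w (t : Vector F d) → sum (λ p → sum (λ i → shifted p w * t i * X p i)) ≈ sum (λ i → C w i * t i)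
    sum-C w t = begin
      sum (λ p → sum (λ i → shifted p w * t i * X p i)) ≈⟨ ∑-comm {s} {d} _ ⟩
      sum (λ i → sum (λ p → shifted p w * t i * X p i)) ≈⟨ sum-cong-≋ {d} (λ i → sum-cong-≋ {s} λ p → trans (*-assoc _ _ _) (trans (*-congˡ (*-comm _ _)) (sym (*-assoc _ _ _)))) ⟩
      sum (λ i → sum (λ p → shifted p w * X p i * t i)) ≈⟨ sum-cong-≋ {d} (λ i → *-distribʳ-sum {s} (t i) _) ⟨
      sum (λ i → C w i * t i)                           ∎

    Lhs Rhs₀ Rhs₁ : Height → Fin d′ → F
    Lhs w l = sum (λ i → C w i * tails i l)
    Rhs₀ w l = sum (λ i → C (act (zero , false) w) i * heads zero i l)
    Rhs₁ w l = sum (λ i → C (act (suc zero , false) w) i * heads (suc zero) i l)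

    entries-sum : ∀ w l → sum (λ p → sum (λ i → entry w l p i * X p i)) ≈ Lhs w l + -1# * (Rhs₀ w l + Rhs₁ w l)
    entries-sum w l = begin
      sum (λ p → sum (λ i → entry w l p i * X p i))
        ≈⟨ sum-cong-≋ {s} (λ p → sum-cong-≋ {d} λ i → expand _ _ _ _) ⟩
      sum (λ p → sum (λ i → A p i + -1# * (B p i + B′ p i)))
        ≈⟨ sum-cong-≋ {s} (λ p → trans (∑-distrib-+ {d} _ _) (+-congˡ (trans (sym (*-distribˡ-sum {d} -1# _)) (*-congˡ (∑-distrib-+ {d} _ _))))) ⟩
      sum (λ p → sum (A p) + -1# * (sum (B p) + sum (B′ p)))
        ≈⟨ trans (∑-distrib-+ {s} _ _) (+-congˡ (trans (sym (*-distribˡ-sum {s} -1# _)) (*-congˡ (∑-distrib-+ {s} _ _)))) ⟩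
      sum (λ p → sum (A p)) + -1# * (sum (λ p → sum (B p)) + sum (λ p → sum (B′ p)))
        ≈⟨ +-cong (sum-C w _) (*-congˡ (+-cong (sum-C _ _) (sum-C _ _))) ⟩
      Lhs w l + -1# * (Rhs₀ w l + Rhs₁ w l) ∎
      where
      A B B′ : Fin s → Fin d → F
      A p i = shifted p w * tails i l * X p i
      B p i = shifted p (act (zero , false) w) * heads zero i l * X p i
      B′ p i = shifted p (act (suc zero , false) w) * heads (suc zero) i l * X p i
      expand : ∀ a b b′ x → (a + -1# * (b + b′)) * x ≈ a * x + -1# * (b * x + b′ * x)
      expand a b b′ x = trans (distribʳ x a _) (+-congˡ (trans (*-assoc _ _ _) (*-congˡ (distribʳ x b b′))))

    equation-at-base⁺ : ∀ j l → Lhs (base⁺ j) l ≈ Rhs₀ (base⁺ j) l + Rhs₁ (base⁺ j) l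
    equation-at-base⁺ j l = begin
      Lhs w l                                                    ≈⟨ +-identityʳ _ ⟨
      Lhs w l + 0#                                               ≈⟨ +-congˡ (trans (+-comm _ _) (x+-1*x (Rhs₀ w l + Rhs₁ w l))) ⟨
      Lhs w l + (-1# * (Rhs₀ w l + Rhs₁ w l) + (Rhs₀ w l + Rhs₁ w l)) ≈⟨ +-assoc _ _ _ ⟨
      Lhs w l + -1# * (Rhs₀ w l + Rhs₁ w l) + (Rhs₀ w l + Rhs₁ w l)   ≈⟨ +-congʳ vanishes ⟩
      0# + (Rhs₀ w l + Rhs₁ w l)                                 ≈⟨ +-identityˡ _ ⟩
      Rhs₀ w l + Rhs₁ w l                                        ∎
      where
      w = base⁺ j
      vanishes : Lhs w l + -1# * (Rhs₀ w l + Rhs₁ w l) ≈ 0#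
      vanishes = begin
        Lhs w l + -1# * (Rhs₀ w l + Rhs₁ w l)
          ≈⟨ entries-sum w l ⟨
        sum (λ p → sum (λ i → entry w l p i * X p i))
          ≈⟨ sum-cong-≋ {s} (λ p → sum-cong-≋ {d} λ i → reflexive (≡.cong₂ (λ jl pi → entry (base⁺ (proj₁ jl)) (proj₂ jl) (proj₁ pi) (proj₂ pi) * X p i)
               (remQuot-combine {s⁺} j l) (remQuot-combine {s} p i))) ⟨
        sum (λ p → sum (λ i → system (combine j l) (combine p i) * X p i))
          ≈⟨ sum-combine s d (λ q → system (combine j l) q * proj₁ solution q) ⟨
        sum (λ q → system (combine j l) q * proj₁ solution q)
          ≈⟨ proj₂ (proj₂ solution) (combine j l) ⟩
        0# ∎

    -- Finitely many equations suffice: if w is not covered by `base⁺`, then neither w nor its two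
    -- predecessors are in the support of C, and both sides vanish.
    equation : ∀ w l → Lhs w l ≈ Rhs₀ w l + Rhs₁ w l
    equation w l with any? (λ j → ≃-dec (base⁺ j) w)
    ... | yes (j , b≃w) = begin
      Lhs w l                               ≈⟨ sum-cong-≋ {d} (λ i → *-congʳ (C-cong b≃w i)) ⟨
      Lhs (base⁺ j) l                       ≈⟨ equation-at-base⁺ j l ⟩
      Rhs₀ (base⁺ j) l + Rhs₁ (base⁺ j) l   ≈⟨ +-cong (sum-cong-≋ {d} λ i → *-congʳ (C-cong (act-cong (zero , false) b≃w) i)) (sum-cong-≋ {d} λ i → *-congʳ (C-cong (act-cong (suc zero , false) b≃w) i)) ⟩
      Rhs₀ w l + Rhs₁ w l                   ∎
    ... | no uncovered = trans (zero-sum (C-outside λ p b≃w → let j , eq = base⊆base⁺ p in uncovered (j , ≃-trans eq b≃w)))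
      (sym (trans (+-cong (zero-sum (outside zero)) (zero-sum (outside (suc zero)))) (+-identityˡ 0#)))
      where
      zero-sum : ∀ {w} {t : Vector F d} → (∀ i → C w i ≈ 0#) → sum (λ i → C w i * t i) ≈ 0#
      zero-sum C≈0 = sum-zero {d} λ i → trans (*-congʳ (C≈0 i)) (zeroˡ _)
      outside : ∀ g i → C (act (g , false) w) i ≈ 0#
      outside g = C-outside λ p b≃ → let j , eq = act-base⊆base⁺ g p in
        uncovered (j , ≃-trans eq (≃-trans (act-cong (g , true) b≃) (act-inverse-≃ (g , false) w)))

    a : Height → E → G → F
    a w e x = sum (λ i → C w i * β i e x)

    a-cong : ∀ {w w′} → w ≃ w′ → ∀ e x → a w e x ≈ a w′ e x
    a-cong w≃w′ e x = sum-cong-≋ {d} λ i → *-congʳ (C-cong w≃w′ i)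

    -- Kirchhoff's law on the cover. The equations hold for the coordinates with respect to the
    -- spanning family μ of U; expanding in μ turns them into equations between the actual values at
    -- v.
    vertex-equation : ∀ w v x → a w (v , zero) x + a w (v , suc zero) x ≈
      a (act (zero , false) w) (gen zero ⁻¹ ∙ v , zero) x + a (act (suc zero , false) w) (gen (suc zero) ⁻¹ ∙ v , suc zero) x
    vertex-equation w v x = begin
      a w (v , zero) x + a w (v , suc zero) x
        ≈⟨ ∑-distrib-+ {d} _ _ ⟨
      sum (λ i → C w i * β i (v , zero) x + C w i * β i (v , suc zero) x)
        ≈⟨ sum-cong-≋ {d} (λ i → trans (sym (distribˡ _ _ _)) (*-congˡ (tails-eq i v x))) ⟩
      sum (λ i → C w i * sum (λ l → tails i l * μ l v x))
        ≈⟨ sum-bilinear (C w) tails (λ l → μ l v x) ⟩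
      sum (λ l → Lhs w l * μ l v x)
        ≈⟨ sum-cong-≋ {d′} (λ l → trans (*-congʳ (equation w l)) (distribʳ _ _ _)) ⟩
      sum (λ l → Rhs₀ w l * μ l v x + Rhs₁ w l * μ l v x)
        ≈⟨ ∑-distrib-+ {d′} _ _ ⟩
      sum (λ l → Rhs₀ w l * μ l v x) + sum (λ l → Rhs₁ w l * μ l v x)
        ≈⟨ +-cong (head zero) (head (suc zero)) ⟩
      a (act (zero , false) w) (gen zero ⁻¹ ∙ v , zero) x + a (act (suc zero , false) w) (gen (suc zero) ⁻¹ ∙ v , suc zero) x ∎
      where
      head : ∀ g → sum (λ l → sum (λ i → C (act (g , false) w) i * heads g i l) * μ l v x) ≈ a (act (g , false) w) (gen g ⁻¹ ∙ v , g) x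
      head g = sym (begin
        a (act (g , false) w) (gen g ⁻¹ ∙ v , g) x
          ≈⟨ sum-cong-≋ {d} (λ i → *-congˡ (heads-eq g i (gen g ⁻¹ ∙ v) x)) ⟩
        sum (λ i → C (act (g , false) w) i * sum (λ l → heads g i l * μ l (gen g ∙ (gen g ⁻¹ ∙ v)) x))
          ≈⟨ reflexive (≡.cong (λ y → sum (λ i → C (act (g , false) w) i * sum (λ l → heads g i l * μ l y x))) (\\-leftDividesˡ (gen g) v)) ⟩
        sum (λ i → C (act (g , false) w) i * sum (λ l → heads g i l * μ l v x))
          ≈⟨ sum-bilinear (C (act (g , false) w)) (heads g) (λ l → μ l v x) ⟩
        sum (λ l → sum (λ i → C (act (g , false) w) i * heads g i l) * μ l v x) ∎)

    Live : Height → Set ℓ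
    Live w = ∃[ i ] C w i ≉ 0#

    live-dec : ∀ w → Dec (Live w)
    live-dec w with all-zero-or-invertible (C w)
    ... | inj₁ C≈0             = no λ (i , C≉0) → C≉0 (C≈0 i)
    ... | inj₂ (i , C≉0 , _)   = yes (i , C≉0)

    dead : ∀ {w} → ¬ Live w → ∀ e x → a w e x ≈ 0#
    dead {w} ¬live e x with all-zero-or-invertible (C w)
    ... | inj₁ C≈0           = sum-zero {d} λ i → trans (*-congʳ (C≈0 i)) (zeroˡ _)
    ... | inj₂ (i , C≉0 , _) = contradiction (i , C≉0) ¬live

    nonzero⇒live : ∀ {w e x} → a w e x ≉ 0# → Live w
    nonzero⇒live {w} {e} {x} a≉0 with live-dec w
    ... | yes live = live
    ... | no ¬live = contradiction (dead ¬live e x) a≉0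

    lowest : ∃[ p ] Live (base p) × (∀ q → Live (base q) → ¬ base q ⊏ base p)
    lowest with Extremal.maximal {_≺_ = λ p q → base q ⊏ base p} (⊏-irrefl ≃-refl) (λ q⊏p r⊏q → ⊏-trans r⊏q q⊏p)
                  (λ p q → ⊏-dec (base q) (base p)) (live-dec ∘ base) (allFin s)
    ... | inj₁ (p , live , min) = p , live , λ q → min (∈-allFin q)
    ... | inj₂ none = contradiction (proj₂ (remQuot {s} d q) , λ C≈0 → x≉0 (begin
              proj₁ solution q                                                     ≈⟨ reflexive (≡.cong (proj₁ solution) (combine-remQuot {s} d q)) ⟨
              X (proj₁ (remQuot {s} d q)) (proj₂ (remQuot {s} d q))                ≈⟨ C-base _ _ ⟨
              C (base (proj₁ (remQuot {s} d q))) (proj₂ (remQuot {s} d q))         ≈⟨ C≈0 ⟩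
              0#                                                                   ∎))
              (none (∈-allFin (proj₁ (remQuot {s} d q))))
      where
      q = proj₁ (proj₁ (proj₂ solution))
      x≉0 = proj₂ (proj₁ (proj₂ solution))

    w₀ : Height
    w₀ = base (proj₁ lowest)

    live-not-below : ∀ {w} → Live w → ¬ w ⊏ w₀
    live-not-below {w} (i , C≉0) w⊏w₀ with any? (λ p → ≃-dec (base p) w)
    ... | yes (p , b≃w) = proj₂ (proj₂ lowest) p (i , λ C≈0 → C≉0 (trans (sym (C-cong b≃w i)) C≈0)) (⊏-respˡ-≃ (≃-sym b≃w) w⊏w₀)
    ... | no none = C≉0 (C-outside (λ p b≃w → none (p , b≃w)) i)

    module _ (x : G) where

      -- The height of the tail of the edge that letter s crosses from height h; crossing backwards,
      -- the tail is the far end.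
      low : Height → Letter → Height
      low h (i , true)  = h
      low h (i , false) = act (i , false) h

      -- For fixed x the x-coordinates form a flow supported on Lx; this right translation lets it
      -- be read as a flow on L.
      shift : E → E
      shift (g , i) = g ∙ x , i

      ω : Height → G → Letter → F
      ω h y s = a (low h s) (shift (edge y s)) x

      ω-balance : ∀ h y → ω h y (zero , true) + ω h y (suc zero , true) ≈ ω h y (zero , false) + ω h y (suc zero , false)
      ω-balance h y = trans (vertex-equation h (y ∙ x) x) (reflexive (≡.cong₂ _+_ (move zero) (move (suc zero))))
        where
        move : ∀ g → a (act (g , false) h) (gen g ⁻¹ ∙ (y ∙ x) , g) x ≡ ω h y (g , false)
        move g = ≡.cong (λ z → a (act (g , false) h) (z , g) x) (≡.sym (∙-assoc (gen g ⁻¹) y x))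

      ω-reverse : ∀ h y s → ω (act s h) (dest y s) (inv s) ≈ ω h y s
      ω-reverse h y (i , false) = refl
      ω-reverse h y (i , true)  = trans
        (reflexive (≡.cong (λ z → a (act (i , false) (act (i , true) h)) (z ∙ x , i) x) (\\-leftDividesʳ (gen i) y)))
        (a-cong (act-inverse-≃ (i , true) h) _ x)

      ω-edge : ∀ h y s → ω h y s ≉ 0# → T (inE (edge y s))
      ω-edge h y s ω≉0 with T? (inE (edge y s))
      ... | yes e∈L = e∈L
      ... | no e∉L = contradiction (sum-zero {d} λ i → trans (*-congˡ (supported i _ x outside)) (zeroʳ _)) ω≉0
        where
        outside : ¬ 𝒢E (shift (edge y s)) x
        outside (g , i , e∈L , eq) = e∉L (≡.subst (T ∘ inE) (≡.cong₂ _,_ (∙-cancelʳ x _ _ (≡.cong proj₁ eq)) (≡.cong proj₂ eq)) e∈L)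

      not-below : ∀ h y s → ω h y s ≉ 0# → ¬ act s h ⊏ w₀
      not-below h y (i , true)  ω≉0 h′⊏w₀ = live-not-below (nonzero⇒live ω≉0) (⊏-trans (act-⊏ (s≤s z≤n) i h) h′⊏w₀)
      not-below h y (i , false) ω≉0 = live-not-below (nonzero⇒live ω≉0)

      -- The hypothesis says that the edge just crossed by s carries flow. By `balance` some other
      -- edge at y carries flow too, and leaving along it keeps the word reduced. No live edge has
      -- its tail below w₀, hence no visited height is below it.
      walk : ∀ m h y s → ω h y (inv s) ≉ 0# → ∃[ r ] length r ≡ m × Reduced (s ∷ r) × Walkable y r ×
        (∀ r₁ t r₂ → r ≡ r₁ ++ t ∷ r₂ → ¬ run (r₁ ++ t ∷ []) h ⊏ w₀)
      walk zero    h y s ω≉0 = [] , ≡.refl , [-] , _ , λ { [] _ _ () ; (_ ∷ _) _ _ () }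
      walk (suc m) h y s ω≉0
        with t , t≢ , ωt≉0 ← balance (ω h y) (ω-balance h y) (inv s) ω≉0
        with r , len , red , walkable , above ← walk m (act t h) (dest y t) t (λ eq → ωt≉0 (trans (sym (ω-reverse h y t)) eq)) =
          t ∷ r , ≡.cong suc len , t≢ ∷ red , (ω-edge h y t ωt≉0 , walkable) ,
          λ { [] _ _ ≡.refl → not-below h y t ωt≉0 ; (_ ∷ r₁) t r₂ ≡.refl → above r₁ t r₂ ≡.refl }

      -- No prefix ends below the lowest height w₀. None returns to it either, being reduced with at
      -- most `degree` letters. So each prefix rises from w₀, and by `positive` from every height.
      good-walk : ∀ u i → a w₀ (u ∙ x , i) x ≉ 0# → GoodWalk u i
      good-walk u i a≉0 with walk order (act (i , true) w₀) (gen i ∙ u) (i , true) (λ eq → a≉0 (trans (sym (ω-reverse w₀ u (i , true))) eq))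
      ... | r , len , red , walkable , above = r , len , red , (ω-edge w₀ u (i , true) a≉0 , walkable) , rising
        where
        rising : Rising ((i , true) ∷ r)
        rising []       t r₂ ≡.refl = act-⊏ (s≤s z≤n) i
        rising (_ ∷ r₁) t r₂ ≡.refl with compare w₀ (run (((i , true) ∷ r₁) ++ t ∷ []) w₀)
        ... | inj₂ (inj₁ w₀⊏) = positive (((i , true) ∷ r₁) ++ t ∷ []) w₀ w₀⊏
        ... | inj₂ (inj₂ ⊏w₀) = contradiction ⊏w₀ (above r₁ t r₂ ≡.refl)
        ... | inj₁ fixed = contradiction (≃-sym fixed) (reduced-moves (i , true) (r₁ ++ t ∷ [])
                (linked-++⁻ˡ ((i , true) ∷ r₁ ++ t ∷ []) (≡.subst Reduced (≡.cong ((i , true) ∷_) split) red))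
                (s≤s (≡.subst (length (r₁ ++ t ∷ []) ℕ.≤_) len (≡.subst (λ r → length (r₁ ++ t ∷ []) ℕ.≤ length r) (≡.sym split)
                  (≡.subst (length (r₁ ++ t ∷ []) ℕ.≤_) (≡.sym (length-++ (r₁ ++ t ∷ []))) (ℕ.m≤m+n _ _))))) w₀)
          where
          split : r₁ ++ t ∷ r₂ ≡ (r₁ ++ t ∷ []) ++ r₂
          split = ≡.sym (++-assoc r₁ (t ∷ []) r₂)

      -- Edges entering at the lowest height would have tails below it, so they carry nothing. The
      -- two outgoing values then sum to zero, and one is nonzero exactly when the other is.
      minimum-at : ∀ u i → a w₀ (u ∙ x , i) x ≉ 0# → Q u
      minimum-at u i a≉0 j = good-walk u j (both i j a≉0)
        where
        below-dead : ∀ g e → a (act (g , false) w₀) e x ≈ 0#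
        below-dead g e = dead (λ live → live-not-below live (⊏-respʳ-≃ (act-inverse-≃ (g , false) w₀) (act-⊏ (s≤s z≤n) g (act (g , false) w₀)))) e x
        cancels : a w₀ (u ∙ x , zero) x + a w₀ (u ∙ x , suc zero) x ≈ 0#
        cancels = trans (vertex-equation w₀ (u ∙ x) x) (trans (+-cong (below-dead zero _) (below-dead (suc zero) _)) (+-identityˡ 0#))
        both : ∀ i j → a w₀ (u ∙ x , i) x ≉ 0# → a w₀ (u ∙ x , j) x ≉ 0#
        both zero       zero       p = p
        both (suc zero) (suc zero) p = p
        both zero       (suc zero) p eq = p (trans (sym (+-identityʳ _)) (trans (+-congˡ (sym eq)) cancels))
        both (suc zero) zero       p eq = p (trans (sym (+-identityˡ _)) (trans (+-congʳ (sym eq)) cancels))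

    vanish : ∀ e x → a w₀ e x ≈ 0#
    vanish (v , i) = good xs unique length-xs (a w₀ (v , i)) outside killed-a
      where
      xs : List G
      xs = List.map (λ u → u ⁻¹ ∙ v) Qs
      unique : Unique xs
      unique = Unique.map⁺ (λ eq → ⁻¹-injective (∙-cancelʳ v _ _ eq)) (Unique.filter⁺ Q? (finite-unique finite))
      length-xs : length xs ℕ.≤ ρ L
      length-xs = ≡.subst (ℕ._≤ ρ L) (≡.sym (length-map (λ u → u ⁻¹ ∙ v) Qs)) length-Qs
      outside : ∀ x → x ∉ xs → a w₀ (v , i) x ≈ 0#
      outside x x∉ with zero-or-invertible (a w₀ (v , i) x)
      ... | inj₁ a≈0       = a≈0
      ... | inj₂ (a≉0 , _) = contradiction (≡.subst (_∈ xs) x≡ (∈-map⁺ (λ u → u ⁻¹ ∙ v) (∈-filter⁺ Q? (Finite.∈-elementList finite u) Qu))) x∉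
        where
        u = v ∙ x ⁻¹
        ux≡v : u ∙ x ≡ v
        ux≡v = //-rightDividesˡ x v
        Qu : Q u
        Qu = minimum-at x u i (≡.subst (λ z → a w₀ (z , i) x ≉ 0#) (≡.sym ux≡v) a≉0)
        x≡ : u ⁻¹ ∙ v ≡ x
        x≡ = ≡.trans (≡.cong (u ⁻¹ ∙_) (≡.sym ux≡v)) (\\-leftDividesʳ u x)
      killed-a : ∀ j → sum (λ y → a w₀ (v , i) (at y) * M (j , at y)) ≈ 0#
      killed-a j = begin
        sum (λ y → a w₀ (v , i) (at y) * M (j , at y))
          ≈⟨ sum-bilinear (C w₀) (λ l y → β l (v , i) (at y)) (λ y → M (j , at y)) ⟨
        sum (λ l → C w₀ l * sum (λ y → β l (v , i) (at y) * M (j , at y)))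
          ≈⟨ sum-zero {d} (λ l → trans (*-congˡ (killed l (v , i) j)) (zeroʳ _)) ⟩
        0# ∎

    contradictory : ⊥
    contradictory with i , C≉0 ← proj₁ (proj₂ lowest) = C≉0 (independent (C w₀) vanish i)

  dimension-bound : ∀ {k} {M : Fin k × G → F} → ColumnsIndependent M → ∀ {d d′} → BoundaryMaps M d d′ → d ℕ.≤ d′
  dimension-bound good {d′ = d′} maps = ℕ.≮⇒≥ λ d′<d → contradictory good maps d′<d (Følner.følnerSet degree d′)

-- Univariate polynomials, Vandermonde systems and Schur complements.

module PolynomialIdentities {a b} (R : CommutativeSemiring a b) where

  open CommutativeSemiring R
  open SemiringSolver R using (solve; _:=_; _:+_; _:*_)

  monic-step : ∀ s a x q → s * a + x * (a + (x + s) * q) ≈ (x + s) * (a + x * q)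
  monic-step = solve 4 (λ s a x q → s :* a :+ x :* (a :+ (x :+ s) :* q) := (x :+ s) :* (a :+ x :* q)) refl

  division-step : ∀ a s u α e → a + (s + u) * (α + u * e) ≈ a + s * α + u * (α + (s + u) * e)
  division-step = solve 5 (λ a s u α e → a :+ (s :+ u) :* (α :+ u :* e) := a :+ s :* α :+ u :* (α :+ (s :+ u) :* e)) refl

  addition-step : ∀ a b t p q → (a + t * p) + (b + t * q) ≈ (a + b) + t * (p + q)
  addition-step = solve 5 (λ a b t p q → (a :+ t :* p) :+ (b :+ t :* q) := (a :+ b) :+ t :* (p :+ q)) refl

  multiplication-step : ∀ a t p q → a * q + (0# + t * (p * q)) ≈ (a + t * p) * q
  multiplication-step a t p q = trans (+-congˡ (+-identityˡ _))
    (solve 4 (λ a t p q → a :* q :+ t :* (p :* q) := (a :+ t :* p) :* q) refl a t p q)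

  scaling-step : ∀ s a t p → s * a + t * (s * p) ≈ s * (a + t * p)
  scaling-step = solve 4 (λ s a t p → s :* a :+ t :* (s :* p) := s :* (a :+ t :* p)) refl

  vandermonde-step : ∀ m a t t₀ p → a * (t + m * t₀) * p ≈ a * (t * p) + m * t₀ * (a * p)
  vandermonde-step = solve 5 (λ m a t t₀ p → a :* (t :+ m :* t₀) :* p := a :* (t :* p) :+ m :* t₀ :* (a :* p)) refl

  schur-step : ∀ m a π v w z → a * (π * v + m * (w * z)) ≈ a * π * v + m * z * (a * w)
  schur-step = solve 6 (λ m a π v w z → a :* (π :* v :+ m :* (w :* z)) := a :* π :* v :+ m :* z :* (a :* w)) refl

  schur-head : ∀ m z s → m * z * s ≈ m * s * z
  schur-head = solve 3 (λ m z s → m :* z :* s := m :* s :* z) refl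

  schur-cancel : ∀ m π a z → m * z * (m * (a * π)) ≈ m * (π * (m * (a * z)))
  schur-cancel = solve 4 (λ m π a z → m :* z :* (m :* (a :* π)) := m :* (π :* (m :* (a :* z)))) refl

module Polynomials {c ℓ : Level} (𝔽 : DiscreteField c ℓ) where

  open DiscreteField 𝔽
  open CommutativeRing commutativeRing hiding (zero) renaming (Carrier to F)
  open LinearAlgebra 𝔽
  open RawSemiring (Semiring.rawSemiring semiring) using (_^_)
  open RingProperties ring using (+-cancelʳ)
  open MonoidSum +-monoid using (sum; sum-cong-≋)
  open CommutativeMonoidSum +-commutativeMonoid using (∑-distrib-+)
  open SemiringSum semiring using (*-distribˡ-sum)
  open PolynomialIdentities commutativeSemiring
  open import Relation.Binary.Reasoning.Setoid setoid

  difference-zero : ∀ x y → x + -1# * y ≈ 0# → x ≈ y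
  difference-zero x y eq = +-cancelʳ (-1# * y) x y (trans eq (sym (x+-1*x y)))

  split : ∀ t s → t ≈ s + (t + -1# * s)
  split t s = sym (trans (+-congˡ (+-comm _ _)) (trans (sym (+-assoc _ _ _)) (trans (+-congʳ (x+-1*x s)) (+-identityˡ t))))

  -- monic (a₀ ∷ … ∷ aₙ₋₁ ∷ []) is the polynomial a₀ + … + aₙ₋₁ xⁿ⁻¹ + xⁿ.
  monic : ∀ {n} → Vec F n → F → F
  monic []       x = 1#
  monic (a ∷ as) x = a + x * monic as x

  coefficients : ∀ {n} → Vec F n → Vector F (suc n)
  coefficients []       zero    = 1#
  coefficients (a ∷ as) zero    = a
  coefficients (a ∷ as) (suc i) = coefficients as i

  coefficients-last : ∀ {n} (as : Vec F n) → coefficients as (fromℕ n) ≡ 1#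
  coefficients-last []       = ≡.refl
  coefficients-last (a ∷ as) = coefficients-last as

  sum-coefficients : ∀ {n} (as : Vec F n) x → sum (λ i → coefficients as i * x ^ toℕ i) ≈ monic as x
  sum-coefficients []       x = trans (+-identityʳ _) (*-identityʳ _)
  sum-coefficients {suc n} (a ∷ as) x = +-cong (*-identityʳ a) (begin
    sum (λ i → coefficients as i * (x * x ^ toℕ i)) ≈⟨ sum-cong-≋ {suc n} (λ i → exchange (coefficients as i) (x ^ toℕ i)) ⟩
    sum (λ i → x * (coefficients as i * x ^ toℕ i)) ≈⟨ *-distribˡ-sum {suc n} x (λ i → coefficients as i * x ^ toℕ i) ⟨
    x * sum (λ i → coefficients as i * x ^ toℕ i)   ≈⟨ *-congˡ (sum-coefficients as x) ⟩
    x * monic as x                                  ∎)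
    where
    exchange : ∀ a p → a * (x * p) ≈ x * (a * p)
    exchange a p = trans (sym (*-assoc a x p)) (trans (*-congʳ (*-comm a x)) (*-assoc x a p))

  add-constant : ∀ {n} → F → Vec F (suc n) → Vec F (suc n)
  add-constant a (b ∷ bs) = a + b ∷ bs

  monic-add-constant : ∀ {n} a (bs : Vec F (suc n)) x → monic (add-constant a bs) x ≈ a + monic bs x
  monic-add-constant a (b ∷ bs) x = +-assoc _ _ _

  times-linear : ∀ {n} → F → Vec F n → Vec F (suc n)
  times-linear s []       = s ∷ []
  times-linear s (a ∷ as) = s * a ∷ add-constant a (times-linear s as)

  monic-times-linear : ∀ {n} s (as : Vec F n) x → monic (times-linear s as) x ≈ (x + s) * monic as x
  monic-times-linear s []       x = trans (+-comm _ _) (trans (+-congʳ (*-identityʳ x)) (sym (*-identityʳ _)))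
  monic-times-linear s (a ∷ as) x = begin
    s * a + x * monic (add-constant a (times-linear s as)) x ≈⟨ +-congˡ (*-congˡ (monic-add-constant a (times-linear s as) x)) ⟩
    s * a + x * (a + monic (times-linear s as) x)            ≈⟨ +-congˡ (*-congˡ (+-congˡ (monic-times-linear s as x))) ⟩
    s * a + x * (a + (x + s) * monic as x)                   ≈⟨ monic-step s a x (monic as x) ⟩
    (x + s) * (a + x * monic as x)                           ∎

  with-roots : ∀ {n} → (Fin n → F) → Vec F n
  with-roots {zero}  t = []
  with-roots {suc n} t = times-linear (-1# * t zero) (with-roots (t ∘ suc))

  with-roots-vanishes : ∀ {n} (t : Fin n → F) i x → x ≈ t i → monic (with-roots t) x ≈ 0#
  with-roots-vanishes t zero x x≈t = begin
    monic (with-roots t) x                                   ≈⟨ monic-times-linear (-1# * t zero) (with-roots (t ∘ suc)) x ⟩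
    (x + -1# * t zero) * monic (with-roots (t ∘ suc)) x      ≈⟨ *-congʳ (trans (+-congʳ x≈t) (x+-1*x (t zero))) ⟩
    0# * monic (with-roots (t ∘ suc)) x                      ≈⟨ zeroˡ _ ⟩
    0#                                                       ∎
  with-roots-vanishes t (suc i) x x≈t = begin
    monic (with-roots t) x                                   ≈⟨ monic-times-linear (-1# * t zero) (with-roots (t ∘ suc)) x ⟩
    (x + -1# * t zero) * monic (with-roots (t ∘ suc)) x      ≈⟨ *-congˡ (with-roots-vanishes (t ∘ suc) i x x≈t) ⟩
    (x + -1# * t zero) * 0#                                  ≈⟨ zeroʳ _ ⟩
    0#                                                       ∎

  Distinct : ∀ {n} → (Fin n → F) → Set ℓ
  Distinct t = ∀ i j → t i ≈ t j → i ≡ j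

  -- A root of 1 + ∏ (x − tᵢ) differs from every tᵢ.
  distinct-points : (∀ n (as : Vec F (suc n)) → ∃[ x ] monic as x ≈ 0#) → ∀ n → Σ (Fin n → F) Distinct
  distinct-points closed zero = (λ ()) , λ ()
  distinct-points closed (suc zero) = (λ _ → 0#) , λ { zero zero _ → ≡.refl }
  distinct-points closed (suc (suc n))
    with t , distinct ← distinct-points closed (suc n)
    with x , root ← closed n (add-constant 1# (with-roots t)) = t′ , distinct′
    where
    new : ∀ i → x ≉ t i
    new i x≈tᵢ = 1≉0 (begin
      1#                                         ≈⟨ +-identityʳ 1# ⟨
      1# + 0#                                    ≈⟨ +-congˡ (with-roots-vanishes t i x x≈tᵢ) ⟨
      1# + monic (with-roots t) x                ≈⟨ monic-add-constant 1# (with-roots t) x ⟨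
      monic (add-constant 1# (with-roots t)) x   ≈⟨ root ⟩
      0#                                         ∎)
    t′ : Fin (suc (suc n)) → F
    t′ zero    = x
    t′ (suc i) = t i
    distinct′ : Distinct t′
    distinct′ zero    zero    _  = ≡.refl
    distinct′ zero    (suc j) eq = contradiction eq (new j)
    distinct′ (suc i) zero    eq = contradiction (sym eq) (new i)
    distinct′ (suc i) (suc j) eq = ≡.cong suc (distinct i j eq)

  -- Subtracting t₀ times one power sum from the next kills the term of t₀ and multiplies the
  -- coefficient of every other tᵢ by the nonzero factor tᵢ - t₀; the induction runs on these new
  -- coefficients.
  vandermonde : ∀ {m} (t : Fin m → F) → Distinct t → ∀ (a : Vector F m) →
    (∀ j → j ℕ.< m → sum (λ i → a i * t i ^ j) ≈ 0#) → ∀ i → a i ≈ 0#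
  vandermonde {suc m} t distinct a eq = all
    where
    b : Vector F m
    b i = a (suc i) * (t (suc i) + -1# * t zero)

    power-sums : ∀ j → j ℕ.< m → sum (λ i → b i * t (suc i) ^ j) ≈ 0#
    power-sums j j<m = begin
      sum (λ i → b i * t (suc i) ^ j)
        ≈⟨ +-identityˡ _ ⟨
      0# + sum (λ i → b i * t (suc i) ^ j)
        ≈⟨ +-congʳ (trans (*-congʳ (trans (*-congˡ (x+-1*x (t zero))) (zeroʳ _))) (zeroˡ _)) ⟨
      sum (λ i → a i * (t i + -1# * t zero) * t i ^ j)
        ≈⟨ sum-cong-≋ {suc m} (λ i → vandermonde-step -1# (a i) (t i) (t zero) (t i ^ j)) ⟩
      sum (λ i → a i * t i ^ suc j + -1# * t zero * (a i * t i ^ j))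
        ≈⟨ ∑-distrib-+ {suc m} (λ i → a i * t i ^ suc j) (λ i → -1# * t zero * (a i * t i ^ j)) ⟩
      sum (λ i → a i * t i ^ suc j) + sum (λ i → -1# * t zero * (a i * t i ^ j))
        ≈⟨ +-cong (eq (suc j) (s≤s j<m)) (sym (*-distribˡ-sum {suc m} (-1# * t zero) (λ i → a i * t i ^ j))) ⟩
      0# + -1# * t zero * sum (λ i → a i * t i ^ j)
        ≈⟨ +-congˡ (trans (*-congˡ (eq j (ℕ.m<n⇒m<1+n j<m))) (zeroʳ _)) ⟩
      0# + 0#
        ≈⟨ +-identityˡ 0# ⟩
      0# ∎

    rest : ∀ i → a (suc i) ≈ 0#
    rest i = *-cancel-nonzero t≉t₀ (trans (*-comm _ _)
      (vandermonde (t ∘ suc) (λ i j eq → suc-injective (distinct (suc i) (suc j) eq)) b power-sums i))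
      where
      t≉t₀ : t (suc i) + -1# * t zero ≉ 0#
      t≉t₀ eq with () ← distinct (suc i) zero (difference-zero _ _ eq)

    all : ∀ i → a i ≈ 0#
    all (suc i) = rest i
    all zero    = begin
      a zero                              ≈⟨ *-identityʳ _ ⟨
      a zero * 1#                         ≈⟨ +-identityʳ _ ⟨
      a zero * 1# + 0#                    ≈⟨ +-congˡ (sum-zero {m} λ i → trans (*-congʳ (rest i)) (zeroˡ _)) ⟨
      sum (λ i → a i * t i ^ 0)           ≈⟨ eq 0 (s≤s z≤n) ⟩
      0#                                  ∎

  -- Elimination with pivot `v zero j₀`, cleared of denominators: the new entries remain polynomials
  -- in the old ones, so independence can be certified by the nonvanishing of polynomials.
  schur : ∀ {m k} → (Fin (suc m) → Fin k → F) → Fin k → Fin m → Fin k → F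
  schur v j₀ i j = v zero j₀ * v (suc i) j + -1# * (v (suc i) j₀ * v zero j)

  schur-combination : ∀ {m k} (v : Fin (suc m) → Fin k → F) j₀ (a : Vector F m) j →
    sum (λ i → a i * schur v j₀ i j) ≈
    sum (λ i → a i * v zero j₀ * v (suc i) j) + -1# * v zero j * sum (λ i → a i * v (suc i) j₀)
  schur-combination {m} v j₀ a j = begin
    sum (λ i → a i * schur v j₀ i j)
      ≈⟨ sum-cong-≋ {m} (λ i → schur-step -1# (a i) _ _ _ _) ⟩
    sum (λ i → a i * v zero j₀ * v (suc i) j + -1# * v zero j * (a i * v (suc i) j₀))
      ≈⟨ ∑-distrib-+ {m} _ _ ⟩
    sum (λ i → a i * v zero j₀ * v (suc i) j) + sum (λ i → -1# * v zero j * (a i * v (suc i) j₀))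
      ≈⟨ +-congˡ (*-distribˡ-sum {m} _ _) ⟨
    sum (λ i → a i * v zero j₀ * v (suc i) j) + -1# * v zero j * sum (λ i → a i * v (suc i) j₀) ∎

  schur-independent : ∀ {m k} (v : Fin (suc m) → Fin k → F) j₀ → v zero j₀ ≉ 0# → Independent v → Independent (schur v j₀)
  schur-independent {m} v j₀ π≉0 ind a eq i = *-cancel-nonzero π≉0 (trans (*-comm _ _) (ind b holds (suc i)))
    where
    b : Vector F (suc m)
    b zero    = -1# * sum (λ i → a i * v (suc i) j₀)
    b (suc i) = a i * v zero j₀
    holds : ∀ j → sum (λ i → b i * v i j) ≈ 0#
    holds j = trans (+-comm _ _) (trans (+-congˡ (sym (schur-head -1# (v zero j) _))) (trans (sym (schur-combination v j₀ a j)) (eq j)))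

  independent-schur : ∀ {m k} (v : Fin (suc m) → Fin k → F) j₀ → v zero j₀ ≉ 0# → Independent (schur v j₀) → Independent v
  independent-schur {m} v j₀ π≉0 ind a eq = all
    where
    π : F
    π = v zero j₀
    s : Fin _ → F
    s j = sum (λ i → a (suc i) * v (suc i) j)
    s≈ : ∀ j → s j ≈ -1# * (a zero * v zero j)
    s≈ j = begin
      s j                                                              ≈⟨ +-identityʳ _ ⟨
      s j + 0#                                                         ≈⟨ +-congˡ (x+-1*x (a zero * v zero j)) ⟨
      s j + (a zero * v zero j + -1# * (a zero * v zero j))            ≈⟨ +-assoc _ _ _ ⟨
      s j + a zero * v zero j + -1# * (a zero * v zero j)              ≈⟨ +-congʳ (trans (+-comm _ _) (eq j)) ⟩
      0# + -1# * (a zero * v zero j)                                   ≈⟨ +-identityˡ _ ⟩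
      -1# * (a zero * v zero j)                                        ∎
    reduced : ∀ j → sum (λ i → a (suc i) * schur v j₀ i j) ≈ 0#
    reduced j = begin
      sum (λ i → a (suc i) * schur v j₀ i j)
        ≈⟨ schur-combination v j₀ (a ∘ suc) j ⟩
      sum (λ i → a (suc i) * π * v (suc i) j) + -1# * v zero j * s j₀
        ≈⟨ +-cong (trans (sum-cong-≋ {m} λ i → trans (*-congʳ (*-comm _ _)) (*-assoc _ _ _)) (sym (*-distribˡ-sum {m} π _))) (*-congˡ (s≈ j₀)) ⟩
      π * s j + -1# * v zero j * (-1# * (a zero * π))
        ≈⟨ +-cong (*-congˡ (s≈ j)) (schur-cancel -1# π (a zero) (v zero j)) ⟩
      π * (-1# * (a zero * v zero j)) + -1# * (π * (-1# * (a zero * v zero j)))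
        ≈⟨ x+-1*x _ ⟩
      0# ∎
    rest : ∀ i → a (suc i) ≈ 0#
    rest = ind (a ∘ suc) reduced
    all : ∀ i → a i ≈ 0#
    all (suc i) = rest i
    all zero    = *-cancel-nonzero π≉0 (trans (*-comm _ _) (begin
      a zero * π          ≈⟨ +-identityʳ _ ⟨
      a zero * π + 0#     ≈⟨ +-congˡ (sum-zero {m} λ i → trans (*-congʳ (rest i)) (zeroˡ _)) ⟨
      a zero * π + s j₀   ≈⟨ eq j₀ ⟩
      0#                  ∎))

  eval : List F → F → F
  eval []       t = 0#
  eval (a ∷ as) t = a + t * eval as t

  add : List F → List F → List F
  add []       bs       = bs
  add (a ∷ as) []       = a ∷ as
  add (a ∷ as) (b ∷ bs) = a + b ∷ add as bs

  eval-add : ∀ as bs t → eval (add as bs) t ≈ eval as t + eval bs t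
  eval-add []       bs       t = sym (+-identityˡ _)
  eval-add (a ∷ as) []       t = sym (+-identityʳ _)
  eval-add (a ∷ as) (b ∷ bs) t = trans (+-congˡ (*-congˡ (eval-add as bs t))) (sym (addition-step a b t _ _))

  scale : F → List F → List F
  scale s = List.map (s *_)

  eval-scale : ∀ s as t → eval (scale s as) t ≈ s * eval as t
  eval-scale s []       t = sym (zeroʳ s)
  eval-scale s (a ∷ as) t = trans (+-congˡ (*-congˡ (eval-scale s as t))) (scaling-step s a t _)

  mul : List F → List F → List F
  mul []       bs = []
  mul (a ∷ as) bs = add (scale a bs) (0# ∷ mul as bs)

  eval-mul : ∀ as bs t → eval (mul as bs) t ≈ eval as t * eval bs t
  eval-mul []       bs t = sym (zeroˡ _)
  eval-mul (a ∷ as) bs t = begin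
    eval (add (scale a bs) (0# ∷ mul as bs)) t                ≈⟨ eval-add (scale a bs) (0# ∷ mul as bs) t ⟩
    eval (scale a bs) t + (0# + t * eval (mul as bs) t)       ≈⟨ +-cong (eval-scale a bs t) (+-congˡ (*-congˡ (eval-mul as bs t))) ⟩
    a * eval bs t + (0# + t * (eval as t * eval bs t))        ≈⟨ multiplication-step a t (eval as t) (eval bs t) ⟩
    (a + t * eval as t) * eval bs t                           ∎

  -- Synthetic division: dividing the polynomial `a ∷ as` by t - s gives `quotient s as`, whose
  -- coefficients are the intermediate values of Horner's scheme.
  quotient : F → List F → List F
  quotient s []       = []
  quotient s (a ∷ as) = eval (a ∷ as) s ∷ quotient s as

  length-quotient : ∀ s as → length (quotient s as) ≡ length as
  length-quotient s []       = ≡.refl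
  length-quotient s (a ∷ as) = ≡.cong suc (length-quotient s as)

  eval-quotient : ∀ a as s t → eval (a ∷ as) t ≈ eval (a ∷ as) s + (t + -1# * s) * eval (quotient s as) t
  eval-quotient a []       s t = trans (+-congˡ (trans (zeroʳ t) (sym (zeroʳ s))))
    (sym (trans (+-congˡ (zeroʳ _)) (+-identityʳ _)))
  eval-quotient a (b ∷ bs) s t = begin
    a + t * eval (b ∷ bs) t                         ≈⟨ +-congˡ (*-cong (split t s) (eval-quotient b bs s t)) ⟩
    a + (s + u) * (α + u * e)                       ≈⟨ division-step a s u α e ⟩
    a + s * α + u * (α + (s + u) * e)               ≈⟨ +-congˡ (*-congˡ (+-congˡ (*-congʳ (split t s)))) ⟨
    a + s * α + u * (α + t * e)                     ∎
    where
    u = t + -1# * s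
    α = eval (b ∷ bs) s
    e = eval (quotient s bs) t

  -- That the polynomial is nonzero is witnessed by a nonroot x, which may lie outside the tᵢ.
  -- Splitting off the root t₀ keeps x a nonroot of the quotient and shortens the list of
  -- coefficients.
  root-bound : ∀ as x → eval as x ≉ 0# → ∀ {n} → length as ℕ.≤ n → (t : Fin n → F) → Distinct t → ∃[ i ] eval as (t i) ≉ 0#
  root-bound []       x as≉0 _ t distinct = contradiction refl as≉0
  root-bound (a ∷ as) x as≉0 (s≤s as≤n) t distinct with zero-or-invertible (eval (a ∷ as) (t zero))
  ... | inj₂ (≉0 , _) = zero , ≉0
  ... | inj₁ root = suc i , λ vanishes → *-nonzero
          (λ eq → contradiction (distinct (suc i) zero (difference-zero _ _ eq)) λ ()) qᵢ≉0
          (trans (sym (factor (t (suc i)))) vanishes)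
    where
    q = quotient (t zero) as
    factor : ∀ y → eval (a ∷ as) y ≈ (y + -1# * t zero) * eval q y
    factor y = trans (eval-quotient a as (t zero) y) (trans (+-congʳ root) (+-identityˡ _))
    rec = root-bound q x (λ q≈0 → as≉0 (trans (factor x) (trans (*-congˡ q≈0) (zeroʳ _))))
      (≡.subst (ℕ._≤ _) (≡.sym (length-quotient (t zero) as)) as≤n) (t ∘ suc)
      (λ i j eq → suc-injective (distinct (suc i) (suc j) eq))
    i = proj₁ rec
    qᵢ≉0 = proj₂ rec

  -- Distinct points are arranged in a grid with one row for each coefficient of `bs`. Every row
  -- contains a nonroot of `as`; the points chosen in this way are distinct and numerous enough to
  -- include a nonroot of `bs`.
  common-nonroot : (∀ n → Σ (Fin n → F) Distinct) → ∀ as bs x y → eval as x ≉ 0# → eval bs y ≉ 0# →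
    ∃[ t ] eval as t ≉ 0# × eval bs t ≉ 0#
  common-nonroot points as bs x y as≉0 bs≉0
    with t , distinct ← points (length bs ℕ.* length as) = chosen (proj₁ good) , proj₂ (choice (proj₁ good)) , proj₂ good
    where
    choice : ∀ j → ∃[ i ] eval as (t (combine j i)) ≉ 0#
    choice j = root-bound as x as≉0 ℕ.≤-refl (λ i → t (combine j i))
      λ i i′ eq → proj₂ (combine-injective j i j i′ (distinct _ _ eq))
    chosen : Fin (length bs) → F
    chosen j = t (combine j (proj₁ (choice j)))
    good = root-bound bs y bs≉0 ℕ.≤-refl chosen λ j j′ eq → proj₁ (combine-injective j _ j′ _ (distinct _ _ eq))

-- Principal open sets and generic independence.

module GenericMatrices {c ℓ₁ ℓ₂} (em : ExcludedMiddle (c ⊔ ℓ₁ ⊔ ℓ₂)) (𝔽 : HeytingField c ℓ₁ ℓ₂) where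

  open OverField 𝔽
  open FieldProperties em 𝔽
  open CommutativeRing commutativeRing hiding (zero) renaming (Carrier to F)
  open LinearAlgebra discreteField
  open Polynomials discreteField
  open MonoidSum +-monoid using (sum; sum-cong-≋)
  open CommutativeMonoidSum +-commutativeMonoid using (∑-comm)

  lem : ∀ (P : Set) → Dec P
  lem P = map′ lower lift (em {Lift (c ⊔ ℓ₁ ⊔ ℓ₂) P})

  points : AlgebraicallyClosed → ∀ n → Σ (Fin n → F) Distinct
  points closed = distinct-points λ n as →
    let x , root = closed n (coefficients as) (λ eq → 1≉0 (trans (reflexive (≡.sym (coefficients-last as))) eq))
    in x , trans (sym (sum-coefficients as x)) root

  module _ {I : Set} where

    restrict : Poly I → (I → F) → (I → F) → List F
    restrict (con a) x y = a ∷ []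
    restrict (var i) x y = x i ∷ y i ∷ []
    restrict (p ⊕ q) x y = add (restrict p x y) (restrict q x y)
    restrict (p ⊗ q) x y = mul (restrict p x y) (restrict q x y)

    eval-restrict : ∀ p x y t → eval (restrict p x y) t ≈ ⟦ p ⟧ (λ i → x i + t * y i)
    eval-restrict (con a) x y t = trans (+-congˡ (zeroʳ t)) (+-identityʳ a)
    eval-restrict (var i) x y t = +-congˡ (*-congˡ (trans (+-congˡ (zeroʳ t)) (+-identityʳ _)))
    eval-restrict (p ⊕ q) x y t = trans (eval-add (restrict p x y) (restrict q x y) t) (+-cong (eval-restrict p x y t) (eval-restrict q x y t))
    eval-restrict (p ⊗ q) x y t = trans (eval-mul (restrict p x y) (restrict q x y) t) (*-cong (eval-restrict p x y t) (eval-restrict q x y t))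

    ⟦⟧-cong : ∀ p {x y : I → F} → (∀ i → x i ≈ y i) → ⟦ p ⟧ x ≈ ⟦ p ⟧ y
    ⟦⟧-cong (con a) eq = refl
    ⟦⟧-cong (var i) eq = eq i
    ⟦⟧-cong (p ⊕ q) eq = +-cong (⟦⟧-cong p eq) (⟦⟧-cong q eq)
    ⟦⟧-cong (p ⊗ q) eq = *-cong (⟦⟧-cong p eq) (⟦⟧-cong q eq)

    direction : (I → F) → (I → F) → I → F
    direction x y i = y i + -1# * x i

    restrict-0 : ∀ p x y → eval (restrict p x (direction x y)) 0# ≈ ⟦ p ⟧ x
    restrict-0 p x y = trans (eval-restrict p x (direction x y) 0#)
      (⟦⟧-cong p λ i → trans (+-congˡ (zeroˡ _)) (+-identityʳ _))

    restrict-1 : ∀ p x y → eval (restrict p x (direction x y)) 1# ≈ ⟦ p ⟧ y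
    restrict-1 p x y = trans (eval-restrict p x (direction x y) 1#)
      (⟦⟧-cong p λ i → trans (+-congˡ (*-identityˡ _)) (sym (split (y i) (x i))))

    -- Restricting to the line through x and y reduces the irreducibility of affine space to one variable.
    common-nonzero : AlgebraicallyClosed → ∀ (p q : Poly I) x y → ⟦ p ⟧ x ≉ 0# → ⟦ q ⟧ y ≉ 0# →
      Σ (I → F) λ z → ⟦ p ⟧ z ≉ 0# × ⟦ q ⟧ z ≉ 0#
    common-nonzero closed p q x y p≉0 q≉0 = on-line
      (common-nonroot (points closed) (restrict p x (direction x y)) (restrict q x (direction x y)) 0# 1#
        (λ eq → p≉0 (trans (sym (restrict-0 p x y)) eq))
        (λ eq → q≉0 (trans (sym (restrict-1 q x y)) eq)))
      where
      on-line : ∃[ t ] eval (restrict p x (direction x y)) t ≉ 0# × eval (restrict q x (direction x y)) t ≉ 0# →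
        Σ (I → F) λ z → ⟦ p ⟧ z ≉ 0# × ⟦ q ⟧ z ≉ 0#
      on-line (t , pt≉0 , qt≉0) = (λ i → x i + t * direction x y i) ,
        (λ eq → pt≉0 (trans (eval-restrict p x (direction x y) t) eq)) ,
        (λ eq → qt≉0 (trans (eval-restrict q x (direction x y) t) eq))

    -- R contains a principal open neighbourhood of x₀. Products of polynomials intersect such
    -- neighbourhoods, so finite conjunctions preserve this property.
    Near : ∀ {r} → (I → F) → Pred (I → F) r → Set (c ⊔ ℓ₁ ⊔ r)
    Near x₀ R = Σ (Poly I) λ p → ⟦ p ⟧ x₀ ≉ 0# × (∀ x → ⟦ p ⟧ x ≉ 0# → R x)

    module _ {r : Level} {x₀ : I → F} where

      near-map : {R S : Pred (I → F) r} → (∀ x → R x → S x) → Near x₀ R → Near x₀ S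
      near-map f (p , p≉0 , R) = p , p≉0 , λ x p≉0 → f x (R x p≉0)

      near-always : {R : Pred (I → F) r} → (∀ x → R x) → Near x₀ R
      near-always R = con 1# , 1≉0 , λ x _ → R x

      near-and : ∀ {s t} {R : Pred (I → F) r} {S : Pred (I → F) s} {T : Pred (I → F) t} → (∀ x → R x → S x → T x) → Near x₀ R → Near x₀ S → Near x₀ T
      near-and f (p , p≉0 , R) (q , q≉0 , S) = p ⊗ q , *-nonzero p≉0 q≉0 ,
        λ x pq≉0 → f x (R x (*-nonzero⁻ˡ pq≉0)) (S x (*-nonzero⁻ʳ pq≉0))

      near-≤ : ∀ K {R : ℕ → Pred (I → F) r} → (∀ m → Near x₀ (R m)) → Near x₀ (λ x → ∀ m → m ℕ.≤ K → R m x)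
      near-≤ zero    near = near-map (λ { x R zero z≤n → R }) (near zero)
      near-≤ (suc K) near = near-and (λ { x R Rs zero z≤n → R ; x R Rs (suc m) (s≤s m≤K) → Rs m m≤K })
        (near zero) (near-≤ K (near ∘ suc))

      near-Fin : ∀ n {R : Fin n → Pred (I → F) r} → (∀ i → Near x₀ (R i)) → Near x₀ (λ x → ∀ i → R i x)
      near-Fin zero    near = near-always λ _ ()
      near-Fin (suc n) near = near-and (λ { x R Rs zero → R ; x R Rs (suc i) → Rs i }) (near zero) (near-Fin n (near ∘ suc))

      near-finite : ∀ {A : Set} (fin : Finite A) {R : A → Pred (I → F) r} → (∀ a → Near x₀ (R a)) → Near x₀ (λ x → ∀ a → R a x)
      near-finite fin {R} near = near-map
        (λ x Rs a → ≡.subst (λ a → R a x) (Inverse.strictlyInverseʳ (Finite.enum fin) a) (Rs (Inverse.to (Finite.enum fin) a)))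
        (near-Fin (Finite.size fin) (near ∘ Finite.at fin))

      near-Vec : ∀ {A : Set} (fin : Finite A) m {R : Vec A m → Pred (I → F) r} → (∀ v → Near x₀ (R v)) → Near x₀ (λ x → ∀ v → R v x)
      near-Vec fin zero    near = near-map (λ { x R [] → R }) (near [])
      near-Vec fin (suc m) near = near-map (λ { x R (a ∷ v) → R a v }) (near-finite fin λ a → near-Vec fin m (near ∘ (a ∷_)))

    -- Recursion on Schur complements instead of minors: a pivot that is nonzero at x₀ stays nonzero
    -- on a neighbourhood, and there independence is equivalent to that of the polynomial matrix
    -- with one row fewer.
    near-independent : ∀ {m k} (P : Fin m → Fin k → Poly I) x₀ →
      Independent (λ i j → ⟦ P i j ⟧ x₀) → Near x₀ (λ x → Independent (λ i j → ⟦ P i j ⟧ x))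
    near-independent {zero}  P x₀ ind = near-always λ _ _ _ ()
    near-independent {suc m} P x₀ ind with all-zero-or-invertible (λ j → ⟦ P zero j ⟧ x₀)
    ... | inj₁ row≈0 = contradiction (ind e (λ j → trans (+-cong (trans (*-identityˡ _) (row≈0 j)) (sum-zero {m} λ i → zeroˡ _)) (+-identityˡ 0#)) zero) 1≉0
      where
      e : Vector F (suc m)
      e zero    = 1#
      e (suc _) = 0#
    ... | inj₂ (j₀ , π≉0 , _) = near-and
        (λ x pivot≉0 ind′ → independent-schur (λ i j → ⟦ P i j ⟧ x) j₀ pivot≉0 ind′)
        (P zero j₀ , π≉0 , λ x → id)
        (near-independent (λ i j → (P zero j₀ ⊗ P (suc i) j) ⊕ (con -1# ⊗ (P (suc i) j₀ ⊗ P zero j))) x₀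
          (schur-independent (λ i j → ⟦ P i j ⟧ x₀) j₀ π≉0 ind))

  module _ {G : Set} (fin : Finite G) where

    open Finite fin using (size; at; enum)
    private module Fin-G = Finite fin

    select : ∀ {P : Set} → Dec P → F → F
    select (yes _) a = a
    select (no _)  a = 0#

    select-yes : ∀ {P : Set} (d : Dec P) {a} → P → select d a ≈ a
    select-yes (yes _) p = refl
    select-yes (no ¬p) p = contradiction p ¬p

    select-no : ∀ {P : Set} (d : Dec P) {a} → ¬ P → select d a ≈ 0#
    select-no (yes p) ¬p = contradiction p ¬p
    select-no (no _)  ¬p = refl

    indexed : ∀ {m} → (Fin m → G) → Vector F m → G → F
    indexed xs α x = sum (λ k → select (xs k Fin-G.≟ x) (α k))

    indexed-at : ∀ {m} (xs : Fin m → G) → (∀ i j → xs i ≡ xs j → i ≡ j) → ∀ α k → indexed xs α (xs k) ≈ α k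
    indexed-at {m} xs inj α k = trans
      (sum-single {m} (λ j → select (xs j Fin-G.≟ xs k) (α j)) k λ j j≢k → select-no (xs j Fin-G.≟ xs k) (j≢k ∘ inj j k))
      (select-yes (xs k Fin-G.≟ xs k) ≡.refl)

    indexed-outside : ∀ {m} (xs : Fin m → G) α x → (∀ k → xs k ≢ x) → indexed xs α x ≈ 0#
    indexed-outside {m} xs α x outside = sum-zero {m} λ k → select-no (xs k Fin-G.≟ x) (outside k)

    sum-reindex : ∀ {m} (xs : Fin m → G) → (∀ i j → xs i ≡ xs j → i ≡ j) → ∀ (f : G → F) →
      (∀ x → (∀ k → xs k ≢ x) → f x ≈ 0#) → sum (λ i → f (at i)) ≈ sum (λ k → f (xs k))
    sum-reindex {m} xs inj f f≈0 = trans (sum-cong-≋ {size} expand) (trans (∑-comm {size} {m} _) (sum-cong-≋ {m} contract))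
      where
      term : Fin size → Fin m → F
      term i k = select (xs k Fin-G.≟ at i) (f (xs k))
      expand : ∀ i → f (at i) ≈ sum (term i)
      expand i with lem (∃[ k ] xs k ≡ at i)
      ... | yes (k , eq) = sym (trans (sum-single {m} (term i) k λ j j≢k → select-no (xs j Fin-G.≟ at i) λ eq′ → j≢k (inj j k (≡.trans eq′ (≡.sym eq))))
                             (trans (select-yes (xs k Fin-G.≟ at i) eq) (reflexive (≡.cong f eq))))
      ... | no none = trans (f≈0 (at i) λ k eq → none (k , eq)) (sym (sum-zero {m} λ k → select-no (xs k Fin-G.≟ at i) λ eq → none (k , eq)))
      contract : ∀ k → sum (λ i → term i k) ≈ f (xs k)
      contract k = trans (sum-single {size} (λ i → term i k) (Inverse.to enum (xs k))
          λ i i≢ → select-no (xs k Fin-G.≟ at i) λ eq → i≢ (≡.trans (≡.sym (Inverse.strictlyInverseˡ enum i)) (≡.cong (Inverse.to enum) (≡.sym eq))))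
        (select-yes (xs k Fin-G.≟ at (Inverse.to enum (xs k))) (≡.sym (Inverse.strictlyInverseʳ enum (xs k))))

-- The sheaf of kernels for a generic matrix.

module Main {c ℓ₁ ℓ₂} (em : ExcludedMiddle (c ⊔ ℓ₁ ⊔ ℓ₂)) (𝔽 : HeytingField c ℓ₁ ℓ₂)
  (𝒢 : FiniteGroup) (g₁ g₂ : FiniteGroup.Carrier 𝒢) (L : Subgraph (cayley 𝒢 g₁ g₂)) where

  open OverField 𝔽
  open FieldProperties em 𝔽
  open GenericMatrices em 𝔽
  open CommutativeRing commutativeRing hiding (zero) renaming (Carrier to F)
  open LinearAlgebra discreteField
  open Polynomials discreteField
  open MonoidSum +-monoid using (sum; sum-cong-≋)
  open RawSemiring (Semiring.rawSemiring semiring) using (_^_)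
  open FiniteGroup 𝒢 renaming (Carrier to G; assoc to ∙-assoc; size to order)
  open Graph (cayley 𝒢 g₁ g₂) using (E; tl)
  open Subgraph L using (inE)
  open Translates 𝒢 g₁ g₂ L
  open Walks lem 𝒢 g₁ g₂ L using (gen; ρ≤colour)
  open Kernels 𝒢 g₁ g₂ L (ρ L)
  open Kernel discreteField lem 𝒢 g₁ g₂ L using (ColumnsIndependent; BoundaryMaps; dimension-bound)
  private
    group : Group _ _
    group = record { isGroup = isGroup }
    module FinG = Finite finite
  open GroupProperties group using (\\-leftDividesˡ; ∙-cancelʳ; ∙-cancelˡ; ⁻¹-injective)

  Injective : ∀ {m} → (Fin m → G) → Set
  Injective xs = ∀ i j → xs i ≡ xs j → i ≡ j

  columns : ∀ {m} → Matrix → (Fin m → G) → Fin m → Fin (ρ L) → F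
  columns M xs i j = M (j , xs i)

  -- Tuples are vectors rather than functions so that `near-Vec` can exhaust them by recursion. All
  -- sizes up to ρ are included since Q may have fewer than ρ elements.
  FewIndependent : Pred Matrix (c ⊔ ℓ₁)
  FewIndependent M = ∀ m → m ℕ.≤ ρ L → (v : Vec G m) → Injective (Vec.lookup v) → Independent (columns M (Vec.lookup v))

  few-independent : ∀ M → FewIndependent M → ∀ {m} → m ℕ.≤ ρ L → (xs : Fin m → G) → Injective xs → Independent (columns M xs)
  few-independent M few {m} m≤ρ xs inj a eq = few m m≤ρ (Vec.tabulate xs)
    (λ i j eq → inj i j (≡.trans (≡.sym (lookup∘tabulate xs i)) (≡.trans eq (lookup∘tabulate xs j)))) a
    λ j → trans (sum-cong-≋ {m} λ i → reflexive (≡.cong (λ x → a i * M (j , x)) (lookup∘tabulate xs i))) (eq j)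

  columns-independent : ∀ M → FewIndependent M → ColumnsIndependent M
  columns-independent M few xs unique len a outside eq x with lem (x ∈ xs)
  ... | no x∉  = outside x x∉
  ... | yes x∈ = trans (reflexive (≡.cong a (lookup-index x∈)))
        (few-independent M few len (lookup xs) (lookup-injective unique) (a ∘ lookup xs) reindexed (index x∈))
    where
    reindexed : ∀ j → sum (λ k → a (lookup xs k) * M (j , lookup xs k)) ≈ 0#
    reindexed j = trans (sym (sum-reindex finite (lookup xs) (lookup-injective unique) (λ y → a y * M (j , y))
      λ y y∉ → trans (*-congʳ (outside y λ y∈ → y∉ (index y∈) (≡.sym (lookup-index y∈)))) (zeroˡ _))) (eq j)

  spans : ∀ M → FewIndependent M → ∀ {X : Pred G _} (xs : Fin (ρ L) → G) → Injective xs → (∀ k → X (xs k)) → ColumnsSpan M X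
  spans M few {X} xs inj xs⊆X b = indexed finite xs α ,
      (λ x x∉ → indexed-outside finite xs α x λ k eq → x∉ (≡.subst X eq (xs⊆X k))) ,
      λ j → trans (sum-reindex finite xs inj (λ x → indexed finite xs α x * M (j , x))
          (λ x x∉ → trans (*-congʳ (indexed-outside finite xs α x x∉)) (zeroˡ _)))
        (trans (sum-cong-≋ {ρ L} λ k → *-congʳ (indexed-at finite xs inj α k)) (proj₂ spanning j))
    where
    spanning = independent⇒spanning (columns M xs) (few-independent M few ℕ.≤-refl xs inj) b
    α = proj₁ spanning

  -- The edge (v , i) lies in Lx precisely when x = g⁻¹v for an edge (g , i) of L, and `ρ≤colour`
  -- provides ρ(L) such g.
  surjective-at-edges : ∀ M → FewIndependent M → ∀ e → ColumnsSpan M (𝒢E e)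
  surjective-at-edges M few (v , i) = spans M few xs xs-injective λ k → g k , i , g∈L k , ≡.cong (_, i) (\\-leftDividesˡ (g k) v)
    where
    starts : List G
    starts = filter (λ v → T? (inE (v , i))) FinG.elementList
    g : Fin (ρ L) → G
    g k = lookup starts (inject≤ k (ρ≤colour i))
    g∈L : ∀ k → T (inE (g k , i))
    g∈L k = proj₂ (∈-filter⁻ (λ v → T? (inE (v , i))) {xs = FinG.elementList} (∈-lookup (inject≤ k (ρ≤colour i))))
    xs : Fin (ρ L) → G
    xs k = g k ⁻¹ ∙ v
    xs-injective : Injective xs
    xs-injective k l eq = inject≤-injective (ρ≤colour i) (ρ≤colour i) k l
      (lookup-injective (Unique.filter⁺ _ (finite-unique finite)) _ _ (⁻¹-injective (∙-cancelʳ v _ _ eq)))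

  surjective : ∀ M → FewIndependent M → LSurjective M
  -- Every translate containing the edge (v , zero) contains its tail v, so a solution at the edge
  -- serves at the vertex.
  surjective M few = (λ v b → let a , supported , eq = surjective-at-edges M few (v , zero) b
                            in a , (λ x x∉ → supported x (x∉ ∘ 𝒢E⊆tl)) , eq)
                 , surjective-at-edges M few

  vandermonde-matrix : (Fin order → F) → Matrix
  vandermonde-matrix t (j , x) = t (Inverse.to FinG.enum x) ^ toℕ j

  near-vandermonde : ∀ t → Distinct t → Near (vandermonde-matrix t) FewIndependent
  near-vandermonde t distinct = near-map (λ M few m m≤ρ → few m m≤ρ m≤ρ)
    (near-≤ (ρ L) λ m → near-bounded m (m ℕ.≤? ρ L))
    where
    independent-here : ∀ {m} → m ℕ.≤ ρ L → (v : Vec G m) → Injective (Vec.lookup v) →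
      Independent (columns (vandermonde-matrix t) (Vec.lookup v))
    independent-here m≤ρ v inj a eq = vandermonde (λ i → t (Inverse.to FinG.enum (Vec.lookup v i)))
      (λ i j eq → inj i j (≡.trans (≡.sym (Inverse.strictlyInverseʳ FinG.enum _))
        (≡.trans (≡.cong FinG.at (distinct _ _ eq)) (Inverse.strictlyInverseʳ FinG.enum _)))) a
      λ j j<m → let j<ρ = ℕ.<-≤-trans j<m m≤ρ in
        ≡.subst (λ j → sum (λ i → a i * t (Inverse.to FinG.enum (Vec.lookup v i)) ^ j) ≈ 0#) (toℕ-fromℕ< j<ρ) (eq (fromℕ< j<ρ))

    near-Vec-independent : ∀ {m} → m ℕ.≤ ρ L → (v : Vec G m) → Dec (Injective (Vec.lookup v)) →
      Near (vandermonde-matrix t) λ M → Injective (Vec.lookup v) → Independent (columns M (Vec.lookup v))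
    near-Vec-independent m≤ρ v (yes inj) = near-map (λ M ind _ → ind)
      (near-independent (λ i j → var (j , Vec.lookup v i)) (vandermonde-matrix t) (independent-here m≤ρ v inj))
    near-Vec-independent m≤ρ v (no ¬inj) = near-always λ M inj → contradiction inj ¬inj

    near-bounded : ∀ m → Dec (m ℕ.≤ ρ L) → Near (vandermonde-matrix t)
      λ M → m ℕ.≤ ρ L → (v : Vec G m) → Injective (Vec.lookup v) → Independent (columns M (Vec.lookup v))
    near-bounded m (yes m≤ρ) = near-map (λ M few _ → few)
      (near-Vec finite m λ v → near-Vec-independent m≤ρ v (lem (Injective (Vec.lookup v))))
    near-bounded m (no m≰ρ)  = near-always λ M m≤ρ → contradiction m≤ρ m≰ρ

  module Excess (M : Matrix) (few : FewIndependent M) where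

    𝓕V-space = 𝓕V (𝒦 M)
    𝓕E-space = 𝓕E (𝒦 M)
    private
      module 𝓕V-module = LeftModule 𝓕V-space
      module 𝓕E-module = LeftModule 𝓕E-space

    entryV : 𝓕V-module.Carrierᴹ → G → G → F
    entryV z v = proj₁ (z v)

    entryE : 𝓕E-module.Carrierᴹ → E → G → F
    entryE w e = proj₁ (w e)

    sumV : ∀ {d} → Vector 𝓕V-module.Carrierᴹ d → 𝓕V-module.Carrierᴹ
    sumV = RawMonoidDefinitions.sum 𝓕V-module.+ᴹ-rawMonoid

    sumV-entry : ∀ {d} (z : Vector 𝓕V-module.Carrierᴹ d) v x → entryV (sumV z) v x ≈ sum (λ i → entryV (z i) v x)
    sumV-entry {zero}  z v x = refl
    sumV-entry {suc d} z v x = +-congˡ (sumV-entry (z ∘ suc) v x)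

    sumV-member : ∀ {s} (U : Subspace 𝓕V-space s) {d} {z : Vector 𝓕V-module.Carrierᴹ d} →
      (∀ i → Subspace.Mem U (z i)) → Subspace.Mem U (sumV z)
    sumV-member U {zero}  z∈U = Subspace.0-closed U
    sumV-member U {suc d} z∈U = Subspace.+-closed U (z∈U zero) (sumV-member U (z∈U ∘ suc))

    combinationV-entry : ∀ {d} (a : Vector F d) z v x → entryV (combination 𝓕V-space a z) v x ≈ sum (λ i → a i * entryV (z i) v x)
    combinationV-entry {zero}  a z v x = refl
    combinationV-entry {suc d} a z v x = +-congˡ (combinationV-entry (a ∘ suc) (z ∘ suc) v x)

    combinationE-entry : ∀ {d} (a : Vector F d) w e x → entryE (combination 𝓕E-space a w) e x ≈ sum (λ i → a i * entryE (w i) e x)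
    combinationE-entry {zero}  a w e x = refl
    combinationE-entry {suc d} a w e x = +-congˡ (combinationE-entry (a ∘ suc) (w ∘ suc) e x)

    summand-same : ∀ v (s : Subspace.asVectorSpace (kernel M (𝒢V v)) .LeftModule.Carrierᴹ) {u} x → v ≡ u →
      entryV (summand (𝒦 M) v s) u x ≡ proj₁ s x
    summand-same v s {u} x v≡u with v FinG.≟ u
    ... | yes ≡.refl = ≡.refl
    ... | no v≢u     = contradiction v≡u v≢u

    summand-other : ∀ v (s : Subspace.asVectorSpace (kernel M (𝒢V v)) .LeftModule.Carrierᴹ) {u} x → v ≢ u →
      entryV (summand (𝒦 M) v s) u x ≡ 0#
    summand-other v s {u} x v≢u with v FinG.≟ u
    ... | yes v≡u = contradiction v≡u v≢u
    ... | no _    = ≡.refl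

    module Maps {s} (U : Subspace 𝓕V-space s) {d d′} (b : Vector 𝓕E-module.Carrierᴹ d) (b-basis : IsBasis 𝓕E-space (Γht (𝒦 M) U) b)
      (u : Vector 𝓕V-module.Carrierᴹ d′) (u-basis : IsBasis 𝓕V-space U u) where

      open Subspace U using (Mem)
      private
        module B = IsBasis b-basis
        module U′ = IsBasis u-basis

      -- Edges of one colour have distinct tails, and distinct heads since left multiplication is
      -- injective. So the images of all of them add up to one element of U in which every edge
      -- value can still be read off.
      tail-sum : Fin 2 → Fin d → 𝓕V-module.Carrierᴹ
      tail-sum g i = sumV λ y → dₜ (𝒦 M) (at y , g) (b i (at y , g))

      head-sum : Fin 2 → Fin d → 𝓕V-module.Carrierᴹ
      head-sum g i = sumV λ y → dₕ (𝒦 M) (at y , g) (b i (at y , g))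

      tail-sum-member : ∀ g i → Mem (tail-sum g i)
      tail-sum-member g i = sumV-member U λ y → proj₂ (B.members i (at y , g))

      head-sum-member : ∀ g i → Mem (head-sum g i)
      head-sum-member g i = sumV-member U λ y → proj₁ (B.members i (at y , g))

      at-to : ∀ v → at (Inverse.to FinG.enum v) ≡ v
      at-to = Inverse.strictlyInverseʳ FinG.enum

      at-injective : ∀ {y v} → at y ≡ v → y ≡ Inverse.to FinG.enum v
      at-injective {y} eq = ≡.trans (≡.sym (Inverse.strictlyInverseˡ FinG.enum y)) (≡.cong (Inverse.to FinG.enum) eq)

      tail-sum-entry : ∀ g i v x → entryV (tail-sum g i) v x ≈ entryE (b i) (v , g) x
      tail-sum-entry g i v x = trans (sumV-entry {order} (λ y → dₜ (𝒦 M) (at y , g) (b i (at y , g))) v x)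
        (trans (sum-single {order} (λ y → entryV (dₜ (𝒦 M) (at y , g) (b i (at y , g))) v x) (Inverse.to FinG.enum v)
            λ y y≢ → reflexive (summand-other (at y) _ x λ eq → y≢ (at-injective eq)))
          (reflexive (≡.trans (summand-same (at (Inverse.to FinG.enum v)) _ x (at-to v)) (≡.cong (λ z → entryE (b i) (z , g) x) (at-to v)))))

      head-sum-entry : ∀ g i v x → entryV (head-sum g i) (gen g ∙ v) x ≈ entryE (b i) (v , g) x
      head-sum-entry g i v x = trans (sumV-entry {order} (λ y → dₕ (𝒦 M) (at y , g) (b i (at y , g))) (gen g ∙ v) x)
        (trans (sum-single {order} (λ y → entryV (dₕ (𝒦 M) (at y , g) (b i (at y , g))) (gen g ∙ v) x) (Inverse.to FinG.enum v)
            λ y y≢ → reflexive (summand-other (gen g ∙ at y) _ x λ eq → y≢ (at-injective (∙-cancelˡ (gen g) _ _ eq))))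
          (reflexive (≡.trans (summand-same (gen g ∙ at (Inverse.to FinG.enum v)) _ x (≡.cong (gen g ∙_) (at-to v))) (≡.cong (λ z → entryE (b i) (z , g) x) (at-to v)))))

      tails : ∀ i → ∃[ a ] _
      tails i = U′.spanning (Subspace.+-closed U (tail-sum-member zero i) (tail-sum-member (suc zero) i))

      heads : ∀ g i → ∃[ a ] _
      heads g i = U′.spanning (head-sum-member g i)

      maps : BoundaryMaps M d d′
      maps = record
        { β           = λ i → entryE (b i)
        ; μ           = λ l → entryV (u l)
        ; tails       = λ i → proj₁ (tails i)
        ; heads       = λ g i → proj₁ (heads g i)
        ; tails-eq    = λ i v x → trans (sym (+-cong (tail-sum-entry zero i v x) (tail-sum-entry (suc zero) i v x)))
            (trans (proj₂ (tails i) v x) (combinationV-entry (proj₁ (tails i)) u v x))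
        ; heads-eq    = λ g i v x → trans (sym (head-sum-entry g i v x))
            (trans (proj₂ (heads g i) (gen g ∙ v) x) (combinationV-entry (proj₁ (heads g i)) u (gen g ∙ v) x))
        ; supported   = λ i e x → proj₁ (proj₂ (b i e)) x
        ; killed      = λ i e j → proj₂ (proj₂ (b i e)) j
        ; independent = λ a eq → B.independent a λ e x → trans (combinationE-entry a b e x) (eq e x)
        }

    excess≤0 : ∀ {s} (U : Subspace 𝓕V-space s) {y} → IsExcess (𝒦 M) U y → y ℤ.≤ 0ℤ
    excess≤0 U (d , d′ , (b , b-basis) , (u , u-basis) , ≡.refl) =
      ≡.subst (d ⊖ d′ ℤ.≤_) (ℤ.n⊖n≡0 d′) (ℤ.⊖-monoˡ-≤ d′ (dimension-bound (columns-independent M few) (Maps.maps U b b-basis u u-basis)))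

    trivial : Subspace 𝓕V-space (c ⊔ ℓ₁)
    trivial = record
      { Mem       = λ z → Lift (c ⊔ ℓ₁) (∀ v x → entryV z v x ≈ 0#)
      ; resp      = λ eq (lift z≈0) → lift λ v x → trans (sym (eq v x)) (z≈0 v x)
      ; 0-closed  = lift λ v x → refl
      ; +-closed  = λ (lift p) (lift q) → lift λ v x → trans (+-cong (p v x) (q v x)) (+-identityˡ 0#)
      ; *ₗ-closed = λ a (lift p) → lift λ v x → trans (*-congˡ (p v x)) (zeroʳ a)
      }

    trivial-excess : IsExcess (𝒦 M) trivial 0ℤ
    trivial-excess = 0 , 0 ,
      ((λ ()) , record
        { members     = λ ()
        ; independent = λ _ _ ()
        -- Restriction to the tail is an inclusion, so a value whose image lies in the zero subspace
        -- is itself zero.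
        ; spanning    = λ {w} w∈ → (λ ()) , λ e x → trans (reflexive (≡.sym (summand-same (tl e) (LinearMap.map (Sheaf.resₜ (𝒦 M) e) (w e)) x ≡.refl)))
            (lower (proj₂ (w∈ e)) (tl e) x)
        }) ,
      ((λ ()) , record
        { members     = λ ()
        ; independent = λ _ _ ()
        ; spanning    = λ (lift z≈0) → (λ ()) , z≈0
        }) , ≡.refl

    max-excess-0 : IsMaxExcess (𝒦 M) 0ℤ
    max-excess-0 = record { attained = trivial , trivial-excess ; maximal = excess≤0 }

    max-excess≤0 : ∀ {z} → IsMaxExcess (𝒦 M) z → z ℤ.≤ 0ℤ
    max-excess≤0 max = let U , excess = IsMaxExcess.attained max in IsMaxExcess.maximal max-excess-0 U excess

  -- Taking every polynomial whose nonvanishing implies `FewIndependent` makes `Generic` the union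
  -- of all principal open sets inside that condition, hence open by construction.
  Witness : Pred (Poly (Fin (ρ L) × G)) (c ⊔ ℓ₁)
  Witness p = ∀ M → ⟦ p ⟧ M ≉ 0# → FewIndependent M

  Generic : Pred Matrix (c ⊔ ℓ₁)
  Generic M = ∃[ p ] Witness p × ⟦ p ⟧ M ≉ 0#

  generic-open : ZariskiOpen Generic
  generic-open = Witness , λ M → mk⇔ id id

  generic⇒few : ∀ M → Generic M → FewIndependent M
  generic⇒few M (p , witness , p≉0) = witness M p≉0

  generic-good : ∀ M → Generic M → LSurjective M × IsMaxExcess (𝒦 M) 0ℤ
  generic-good M generic = surjective M (generic⇒few M generic) , Excess.max-excess-0 M (generic⇒few M generic)

  module _ (closed : AlgebraicallyClosed) where

    generic-nonempty : Satisfiable Generic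
    generic-nonempty = let t , distinct = points closed order in from-near t (near-vandermonde t distinct)
      where
      from-near : ∀ t → Near (vandermonde-matrix t) FewIndependent → Satisfiable Generic
      from-near t (p , p≉0 , witness) = vandermonde-matrix t , p , witness , p≉0

    generic-dense : ZariskiDense (ExcessAtLeast 0ℤ)
    generic-dense U (S , U⇔) (M₁ , M₁∈U) = meet (Equivalence.to (U⇔ M₁) M₁∈U) generic-nonempty
      where
      good : ∀ M → U M → Generic M → Σ Matrix λ M → U M × ExcessAtLeast 0ℤ M
      good M M∈U generic = let surj , max = generic-good M generic in M , M∈U , surj , 0ℤ , max , ℤ.≤-refl
      meet : ∃[ p ] S p × ⟦ p ⟧ M₁ ≉ 0# → Satisfiable Generic → Σ Matrix λ M → U M × ExcessAtLeast 0ℤ M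
      meet (p , p∈S , p≉0) (M₀ , q , witness , q≉0) =
        let M , pM≉0 , qM≉0 = common-nonzero closed p q M₁ M₀ p≉0 q≉0
        in good M (Equivalence.from (U⇔ M) (p , p∈S , pM≉0)) (q , witness , qM≉0)

    -- A dense set meets the nonempty open set `Generic`, and at any common matrix the maximum
    -- excess is at most zero.
    generic-largest : ∀ m → ZariskiDense (ExcessAtLeast m) → m ℤ.≤ 0ℤ
    generic-largest m dense = bound (dense Generic generic-open generic-nonempty)
      where
      bound : (Σ Matrix λ M → Generic M × ExcessAtLeast m M) → m ℤ.≤ 0ℤ
      bound (M , generic , _ , z , max , m≤z) = ℤ.≤-trans m≤z (Excess.max-excess≤0 M (generic⇒few M generic) max)

    result : IsGenericMaxExcess 0ℤ ×
      (Σ (Pred Matrix (c ⊔ ℓ₁)) λ U → ZariskiOpen U × Satisfiable U × (∀ M → U M → LSurjective M × IsMaxExcess (𝒦 M) 0ℤ))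
    result = record { dense = generic-dense ; largest = generic-largest } ,
      Generic , generic-open , generic-nonempty , generic-good

theorem2 : ∀ {c ℓ₁ ℓ₂} → ExcludedMiddle (c ⊔ ℓ₁ ⊔ ℓ₂) →
    (𝔽 : HeytingField c ℓ₁ ℓ₂) (let open OverField 𝔽) → AlgebraicallyClosed →
    (𝒢 : FiniteGroup) (g₁ g₂ : FiniteGroup.Carrier 𝒢)
    (L : Subgraph (cayley 𝒢 g₁ g₂)) (let open Kernels 𝒢 g₁ g₂ L (ρ L)) →
    IsGenericMaxExcess 0ℤ ×
    (Σ (Pred Matrix (c ⊔ ℓ₁)) λ U → ZariskiOpen U × Satisfiable U ×
    (∀ M → U M → LSurjective M × IsMaxExcess (𝒦 M) 0ℤ))
theorem2 em 𝔽 closed 𝒢 g₁ g₂ L = Main.result em 𝔽 𝒢 g₁ g₂ L closed
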